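{- (Operator Theorem) Let $n,r\ge1$ be integers. The inverse system $SI_{n,r}^\perp$ is the smallest $\mathbb{C}$-linear subspace of $\Omega$ which (i) contains the polynomial $\delta_{n,r}\in S=\mathbb{C}[x_1,\dots,x_n]$, (ii) is closed under the partial derivatives $\partial_1,\dots,\partial_n$, and (iii) is closed under the higher Euler operators $d_1,d_{r+1},d_{2r+1},\dots,d_{(n-1)r+1}$.
   Context: Let $\zeta=\exp(2\pi i/r)$. $\mathbb{Z}_r\wr\mathfrak{S}_n$ is the group of $n\times n$ complex monomial matrices (exactly one nonzero entry in each row and column) whose nonzero entries are $r$-th roots of unity. $S=\mathbb{C}[x_1,\dots,x_n]$, and $\Omega=S\otimes\wedge\{\theta_1,\dots,\theta_n\}$ is the unital associative $\mathbb{C}$-algebra generated by $x_i,\theta_i$ with relations $x_ix_j=x_jx_i$, $x_i\theta_j=\theta_jx_i$, $\theta_i\theta_j=-\theta_j\theta_i$. The group acts on $\Omega$ by algebra automorphisms: $\mathrm{diag}(\zeta^{c_1},\dots,\zeta^{c_n})$ sends $x_i\mapsto\zeta^{ -c_i}x_i$, $\theta_i\mapsto\zeta^{ -c_i}\theta_i$, and a permutation matrix $w$ sends $x_i\mapsto x_{w(i)}$, $\theta_i\mapsto\theta_{w(i)}$. $SI_{n,r}\subseteq\Omega$ is the two-sided ideal generated by all $(\mathbb{Z}_r\wr\mathfrak{S}_n)$-invariant elements with vanishing constant term. $\partial_i$ is partial differentiation in $x_i$, acting on $\Omega$ through the factor $S$. $\partial_i^\theta:\Omega\to\Omega$ is the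 $S$-linear contraction operator: for distinct $j_1,\dots,j_k$, $\partial_i^\theta(\theta_{j_1}\cdots\theta_{j_k})=(-1)^{s-1}\theta_{j_1}\cdots\widehat{\theta_{j_s}}\cdots\theta_{j_k}$ if $j_s=i$, and $0$ if $i\notin\{j_1,\dots,j_k\}$. For $f\in\Omega$, $f\odot g$ is the result of applying to $g\in\Omega$ the operator obtained from $f$ by replacing $x_i\to\partial_i$, $\theta_i\to\partial_i^\theta$. For a bigraded ideal $I\subseteq\Omega$, the inverse system is $I^\perp:=\{g\in\Omega: f\odot g=0\text{ for all }f\in I\}$. For $j\ge1$ the higher Euler operator $d_j:\Omega\to\Omega$ is $d_j(f):=\sum_{i=1}^n(\partial_i^jf)\cdot\theta_i$. Finally $\delta_{n,r}:=(x_1\cdots x_n)^{r-1}\prod_{1\le i<j\le n}(x_i^r-x_j^r)$. -}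

module Defs where

open import Level using (Level; 0ℓ; _⊔_)
open import Algebra.Bundles using (CommutativeRing; AbelianGroup; Semiring)
import Algebra.Construct.DirectProduct as DirectProduct
import Algebra.Definitions.RawSemiring as RawSemiring
import Algebra.Solver.Ring.NaturalCoefficients.Default as NaturalCoefficients
open import Data.Bool.Base using (Bool; true; false; if_then_else_)
import Data.Bool.Properties as Bool
open import Data.Fin.Base using (Fin; zero; suc; toℕ)
open import Data.Fin.Permutation using (Permutation′; _⟨$⟩ʳ_)
import Data.Fin.Properties as Fin
open import Data.Fin.Subset using (Subset; inside; outside; ⊥)
open import Data.List.Base using (List; []; _∷_; _++_; map; concatMap; foldr; allFin)
open import Data.Nat.Base as ℕ using (ℕ; zero; suc; NonZero)
open import Data.Nat.GeneralisedArithmetic using (fold)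
import Data.Nat.Properties as ℕ
open import Data.Product.Base using (_×_; _,_; ∃; proj₁; proj₂)
import Data.Product.Properties as Product
open import Data.Rational.Base as ℚ using (ℚ; 0ℚ; 1ℚ; ½; ∣_∣; positive; 1/_)
import Data.Rational.Properties as ℚ
open import Data.Rational.Solver using (module +-*-Solver)
open import Data.Vec.Base using (Vec; []; _∷_; lookup; replicate; _[_]%=_; _[_]≔_)
import Data.Vec.Properties as Vec
open import Function.Base using (id; _∘_)
open import Relation.Binary.Definitions using (DecidableEquality)
open import Relation.Binary.PropositionalEquality
  using (_≡_; refl; sym; trans; cong; subst; module ≡-Reasoning)
open import Relation.Nullary using (¬_)
open import Relation.Nullary.Decidable using (does)
open import Relation.Unary using (Pred; _∈_)

------------------------------------------------------------------------
-- ℝ: Cauchy sequences of rationals, with equality "the difference tends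
-- to 0".

Cauchy : (ℕ → ℚ) → Set
Cauchy s = ∀ ε → 0ℚ ℚ.< ε →
  ∃ λ N → ∀ m n → N ℕ.≤ m → N ℕ.≤ n → ∣ s m ℚ.- s n ∣ ℚ.< ε

record ℝ : Set where
  constructor mkℝ
  field
    seq    : ℕ → ℚ
    cauchy : Cauchy seq

open ℝ public

infix 4 _≃_

_≃_ : ℝ → ℝ → Set
x ≃ y = ∀ ε → 0ℚ ℚ.< ε →
  ∃ λ N → ∀ n → N ℕ.≤ n → ∣ seq x n ℚ.- seq y n ∣ ℚ.< ε

private
  half>0 : ∀ {ε} → 0ℚ ℚ.< ε → 0ℚ ℚ.< ε ℚ.* ½
  half>0 {ε} p = ℚ.positive⁻¹ (ε ℚ.* ½) {{ℚ.pos*pos⇒pos ε {{positive p}} ½}}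

  half+half : ∀ ε → ε ℚ.* ½ ℚ.+ ε ℚ.* ½ ≡ ε
  half+half ε = trans (sym (ℚ.*-distribˡ-+ ε ½ ½)) (ℚ.*-identityʳ ε)

  sum-small : ∀ ε u v → ∣ u ∣ ℚ.< ε ℚ.* ½ → ∣ v ∣ ℚ.< ε ℚ.* ½ → ∣ u ℚ.+ v ∣ ℚ.< ε
  sum-small ε u v p q = ℚ.≤-<-trans (ℚ.∣p+q∣≤∣p∣+∣q∣ u v)
    (subst (∣ u ∣ ℚ.+ ∣ v ∣ ℚ.<_) (half+half ε) (ℚ.+-mono-< p q))

  scale : ∀ ε B → 0ℚ ℚ.< B → ℚ
  scale ε B B>0 = (ε ℚ.* ½) ℚ.* (1/ B) {{ℚ.pos⇒nonZero B {{positive B>0}}}}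

  scale>0 : ∀ {ε} B (B>0 : 0ℚ ℚ.< B) → 0ℚ ℚ.< ε → 0ℚ ℚ.< scale ε B B>0
  scale>0 {ε} B B>0 p = ℚ.positive⁻¹ _
    {{ℚ.pos*pos⇒pos (ε ℚ.* ½) {{positive (half>0 p)}} _ {{ℚ.1/pos⇒pos B {{positive B>0}}}}}}

  scaled-small : ∀ ε B (B>0 : 0ℚ ℚ.< B) a u →
    ∣ a ∣ ℚ.≤ B → ∣ u ∣ ℚ.< scale ε B B>0 → ∣ a ℚ.* u ∣ ℚ.< ε ℚ.* ½
  scaled-small ε B B>0 a u a≤B u<η =
    subst (ℚ._< ε ℚ.* ½) (sym (ℚ.∣p*q∣≡∣p∣*∣q∣ a u))
      (ℚ.≤-<-trans (ℚ.*-monoʳ-≤-nonNeg ∣ u ∣ {{ℚ.∣-∣-nonNeg u}} a≤B)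
        (subst (B ℚ.* ∣ u ∣ ℚ.<_) cancel (ℚ.*-monoʳ-<-pos B {{positive B>0}} u<η)))
    where
    instance
      B≢0 : ℚ.NonZero B
      B≢0 = ℚ.pos⇒nonZero B {{positive B>0}}
    cancel : B ℚ.* ((ε ℚ.* ½) ℚ.* 1/ B) ≡ ε ℚ.* ½
    cancel = begin
      B ℚ.* ((ε ℚ.* ½) ℚ.* 1/ B)  ≡⟨ cong (B ℚ.*_) (ℚ.*-comm (ε ℚ.* ½) (1/ B)) ⟩
      B ℚ.* (1/ B ℚ.* (ε ℚ.* ½))  ≡⟨ ℚ.*-assoc B (1/ B) (ε ℚ.* ½) ⟨
      (B ℚ.* 1/ B) ℚ.* (ε ℚ.* ½)  ≡⟨ cong (ℚ._* (ε ℚ.* ½)) (ℚ.*-inverseʳ B) ⟩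
      1ℚ ℚ.* (ε ℚ.* ½)            ≡⟨ ℚ.*-identityˡ (ε ℚ.* ½) ⟩
      ε ℚ.* ½                     ∎
      where open ≡-Reasoning

  +-difference : ∀ a b c d → (a ℚ.+ b) ℚ.- (c ℚ.+ d) ≡ (a ℚ.- c) ℚ.+ (b ℚ.- d)
  +-difference = solve 4 (λ a b c d → (a :+ b) :- (c :+ d) := (a :- c) :+ (b :- d)) refl
    where open +-*-Solver

  *-difference : ∀ a b c d → a ℚ.* b ℚ.- c ℚ.* d ≡ a ℚ.* (b ℚ.- d) ℚ.+ d ℚ.* (a ℚ.- c)
  *-difference = solve 4 (λ a b c d → a :* b :- c :* d := a :* (b :- d) :+ d :* (a :- c)) refl
    where open +-*-Solver

  neg-difference : ∀ a b → (ℚ.- a) ℚ.- (ℚ.- b) ≡ ℚ.- (a ℚ.- b)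
  neg-difference = solve 2 (λ a b → (:- a) :- (:- b) := :- (a :- b)) refl
    where open +-*-Solver

  swap-difference : ∀ a b → b ℚ.- a ≡ ℚ.- (a ℚ.- b)
  swap-difference = solve 2 (λ a b → b :- a := :- (a :- b)) refl
    where open +-*-Solver

  split-difference : ∀ a b c → a ℚ.- c ≡ (a ℚ.- b) ℚ.+ (b ℚ.- c)
  split-difference = solve 3 (λ a b c → a :- c := (a :- b) :+ (b :- c)) refl
    where open +-*-Solver

  restore : ∀ a b → b ℚ.+ (a ℚ.- b) ≡ a
  restore = solve 2 (λ a b → b :+ (a :- b) := a) refl
    where open +-*-Solver

  neg-small : ∀ ε u v → v ≡ ℚ.- u → ∣ u ∣ ℚ.< ε → ∣ v ∣ ℚ.< ε
  neg-small ε u v refl = subst (ℚ._< ε) (sym (ℚ.∣-p∣≡∣p∣ u))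

  +-small : ∀ ε a b c d → ∣ a ℚ.- c ∣ ℚ.< ε ℚ.* ½ → ∣ b ℚ.- d ∣ ℚ.< ε ℚ.* ½ →
    ∣ (a ℚ.+ b) ℚ.- (c ℚ.+ d) ∣ ℚ.< ε
  +-small ε a b c d p q = subst (λ u → ∣ u ∣ ℚ.< ε) (sym (+-difference a b c d))
    (sum-small ε (a ℚ.- c) (b ℚ.- d) p q)

  *-small : ∀ ε B (B>0 : 0ℚ ℚ.< B) a b c d → ∣ a ∣ ℚ.≤ B → ∣ d ∣ ℚ.≤ B →
    ∣ a ℚ.- c ∣ ℚ.< scale ε B B>0 → ∣ b ℚ.- d ∣ ℚ.< scale ε B B>0 →
    ∣ a ℚ.* b ℚ.- c ℚ.* d ∣ ℚ.< ε
  *-small ε B B>0 a b c d a≤B d≤B p q =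
    subst (λ u → ∣ u ∣ ℚ.< ε) (sym (*-difference a b c d))
      (sum-small ε (a ℚ.* (b ℚ.- d)) (d ℚ.* (a ℚ.- c))
        (scaled-small ε B B>0 a (b ℚ.- d) a≤B q)
        (scaled-small ε B B>0 d (a ℚ.- c) d≤B p))

  ⊔-left : ∀ {M N n} → M ℕ.⊔ N ℕ.≤ n → M ℕ.≤ n
  ⊔-left {M} {N} = ℕ.≤-trans (ℕ.m≤m⊔n M N)

  ⊔-right : ∀ {M N n} → M ℕ.⊔ N ℕ.≤ n → N ℕ.≤ n
  ⊔-right {M} {N} = ℕ.≤-trans (ℕ.m≤n⊔m M N)

  record Bound (x y : ℝ) : Set where
    field
      B       : ℚ
      B>0     : 0ℚ ℚ.< B
      from    : ℕ
      boundˡ  : ∀ n → from ℕ.≤ n → ∣ seq x n ∣ ℚ.≤ B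
      boundʳ  : ∀ n → from ℕ.≤ n → ∣ seq y n ∣ ℚ.≤ B

  bound₁ : ∀ x → ∃ λ B → 0ℚ ℚ.< B × ∃ λ N → ∀ n → N ℕ.≤ n → ∣ seq x n ∣ ℚ.≤ B
  bound₁ x with cauchy x 1ℚ (ℚ.positive⁻¹ 1ℚ)
  ... | N , h = ∣ seq x N ∣ ℚ.+ 1ℚ
              , ℚ.+-mono-≤-< {0ℚ} {∣ seq x N ∣} {0ℚ} {1ℚ} (ℚ.0≤∣p∣ (seq x N)) (ℚ.positive⁻¹ 1ℚ)
              , N , λ n N≤n →
      subst (λ q → ∣ q ∣ ℚ.≤ ∣ seq x N ∣ ℚ.+ 1ℚ) (restore (seq x n) (seq x N))
        (ℚ.≤-trans (ℚ.∣p+q∣≤∣p∣+∣q∣ (seq x N) (seq x n ℚ.- seq x N))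
          (ℚ.+-mono-≤ (ℚ.≤-refl {∣ seq x N ∣}) (ℚ.<⇒≤ (h n N N≤n ℕ.≤-refl))))

  bound : ∀ x y → Bound x y
  bound x y = combine (bound₁ x) (bound₁ y)
    where
    combine : (∃ λ B → 0ℚ ℚ.< B × ∃ λ N → ∀ n → N ℕ.≤ n → ∣ seq x n ∣ ℚ.≤ B) →
              (∃ λ B → 0ℚ ℚ.< B × ∃ λ N → ∀ n → N ℕ.≤ n → ∣ seq y n ∣ ℚ.≤ B) → Bound x y
    combine (B , B>0 , M , p) (C , C>0 , N , q) = record
      { B      = B ℚ.⊔ C
      ; B>0    = ℚ.<-≤-trans B>0 (ℚ.p≤p⊔q B C)
      ; from   = M ℕ.⊔ N
      ; boundˡ = λ n h → ℚ.≤-trans (p n (⊔-left {M} h)) (ℚ.p≤p⊔q B C)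
      ; boundʳ = λ n h → ℚ.≤-trans (q n (⊔-right {M} h)) (ℚ.p≤q⊔p B C)
      }

  pointwise : ∀ {x y} → (∀ n → seq x n ≡ seq y n) → x ≃ y
  pointwise {x} {y} h ε ε>0 = 0 , λ n _ → subst (ℚ._< ε)
    (sym (cong ∣_∣ (trans (cong (ℚ._- seq y n) (h n)) (ℚ.+-inverseʳ (seq y n))))) ε>0

  ≃-sym : ∀ {x y} → x ≃ y → y ≃ x
  ≃-sym {x} {y} p ε ε>0 with p ε ε>0
  ... | N , h = N , λ n N≤n →
    neg-small ε (seq x n ℚ.- seq y n) (seq y n ℚ.- seq x n) (swap-difference (seq x n) (seq y n)) (h n N≤n)

  ≃-trans : ∀ {x y z} → x ≃ y → y ≃ z → x ≃ z
  ≃-trans {x} {y} {z} p q ε ε>0 with p (ε ℚ.* ½) (half>0 ε>0) | q (ε ℚ.* ½) (half>0 ε>0)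
  ... | M , g | N , h = M ℕ.⊔ N , λ n k →
    subst (λ d → ∣ d ∣ ℚ.< ε) (sym (split-difference (seq x n) (seq y n) (seq z n)))
      (sum-small ε (seq x n ℚ.- seq y n) (seq y n ℚ.- seq z n)
        (g n (⊔-left {M} k)) (h n (⊔-right {M} k)))

infixl 6 _+ℝ_
infixl 7 _*ℝ_
infix  8 -ℝ_

_+ℝ_ _*ℝ_ : ℝ → ℝ → ℝ
-ℝ_ : ℝ → ℝ

seq (x +ℝ y) n = seq x n ℚ.+ seq y n
cauchy (x +ℝ y) ε ε>0 with cauchy x (ε ℚ.* ½) (half>0 ε>0) | cauchy y (ε ℚ.* ½) (half>0 ε>0)
... | M , g | N , h = M ℕ.⊔ N , λ m n p q →
  +-small ε (seq x m) (seq y m) (seq x n) (seq y n)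
    (g m n (⊔-left {M} p) (⊔-left {M} q)) (h m n (⊔-right {M} p) (⊔-right {M} q))

seq (x *ℝ y) n = seq x n ℚ.* seq y n
cauchy (x *ℝ y) ε ε>0 = M ℕ.⊔ N ℕ.⊔ from , λ m n p q →
  *-small ε B B>0 (seq x m) (seq y m) (seq x n) (seq y n)
    (boundˡ m (⊔-right {M ℕ.⊔ N} p))
    (boundʳ n (⊔-right {M ℕ.⊔ N} q))
    (proj₂ X m n (⊔-left {M} (⊔-left {M ℕ.⊔ N} p)) (⊔-left {M} (⊔-left {M ℕ.⊔ N} q)))
    (proj₂ Y m n (⊔-right {M} (⊔-left {M ℕ.⊔ N} p)) (⊔-right {M} (⊔-left {M ℕ.⊔ N} q)))
  where
  open Bound (bound x y)
  X = cauchy x (scale ε B B>0) (scale>0 B B>0 ε>0)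
  Y = cauchy y (scale ε B B>0) (scale>0 B B>0 ε>0)
  M = proj₁ X
  N = proj₁ Y

seq (-ℝ x) n = ℚ.- seq x n
cauchy (-ℝ x) ε ε>0 with cauchy x ε ε>0
... | N , h = N , λ m n p q →
  neg-small ε (seq x m ℚ.- seq x n) ((ℚ.- seq x m) ℚ.- (ℚ.- seq x n))
    (neg-difference (seq x m) (seq x n)) (h m n p q)

fromℚ : ℚ → ℝ
seq (fromℚ q) n = q
cauchy (fromℚ q) ε ε>0 = 0 , λ _ _ _ _ →
  subst (ℚ._< ε) (sym (cong ∣_∣ (ℚ.+-inverseʳ q))) ε>0

private
  +ℝ-cong : ∀ {x x′ y y′} → x ≃ x′ → y ≃ y′ → x +ℝ y ≃ x′ +ℝ y′
  +ℝ-cong {x} {x′} {y} {y′} p q ε ε>0 with p (ε ℚ.* ½) (half>0 ε>0) | q (ε ℚ.* ½) (half>0 ε>0)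
  ... | M , g | N , h = M ℕ.⊔ N , λ n k →
    +-small ε (seq x n) (seq y n) (seq x′ n) (seq y′ n)
      (g n (⊔-left {M} k)) (h n (⊔-right {M} k))

  *ℝ-cong : ∀ {x x′ y y′} → x ≃ x′ → y ≃ y′ → x *ℝ y ≃ x′ *ℝ y′
  *ℝ-cong {x} {x′} {y} {y′} p q ε ε>0 = M ℕ.⊔ N ℕ.⊔ from , λ n k →
    *-small ε B B>0 (seq x n) (seq y n) (seq x′ n) (seq y′ n)
      (boundˡ n (⊔-right {M ℕ.⊔ N} k))
      (boundʳ n (⊔-right {M ℕ.⊔ N} k))
      (proj₂ X n (⊔-left {M} (⊔-left {M ℕ.⊔ N} k)))
      (proj₂ Y n (⊔-right {M} (⊔-left {M ℕ.⊔ N} k)))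
    where
    open Bound (bound x y′)
    X = p (scale ε B B>0) (scale>0 B B>0 ε>0)
    Y = q (scale ε B B>0) (scale>0 B B>0 ε>0)
    M = proj₁ X
    N = proj₁ Y

  -ℝ-cong : ∀ {x x′} → x ≃ x′ → -ℝ x ≃ -ℝ x′
  -ℝ-cong {x} {x′} p ε ε>0 with p ε ε>0
  ... | N , h = N , λ n k →
    neg-small ε (seq x n ℚ.- seq x′ n) ((ℚ.- seq x n) ℚ.- (ℚ.- seq x′ n))
      (neg-difference (seq x n) (seq x′ n)) (h n k)

ℝ-ring : CommutativeRing 0ℓ 0ℓ
ℝ-ring = record
  { Carrier = ℝ
  ; _≈_ = _≃_
  ; _+_ = _+ℝ_
  ; _*_ = _*ℝ_
  ; -_  = -ℝ_
  ; 0#  = fromℚ 0ℚ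
  ; 1#  = fromℚ 1ℚ
  ; isCommutativeRing = record
    { isRing = record
      { +-isAbelianGroup = record
        { isGroup = record
          { isMonoid = record
            { isSemigroup = record
              { isMagma = record
                { isEquivalence = record
                  { refl  = λ {x} → pointwise {x} {x} λ _ → refl
                  ; sym   = λ {x} {y} → ≃-sym {x} {y}
                  ; trans = λ {x} {y} {z} → ≃-trans {x} {y} {z}
                  }
                ; ∙-cong = λ {x} {x′} {y} {y′} → +ℝ-cong {x} {x′} {y} {y′}
                }
              ; assoc = λ x y z → pointwise {(x +ℝ y) +ℝ z} {x +ℝ (y +ℝ z)}
                  λ n → ℚ.+-assoc (seq x n) (seq y n) (seq z n)
              }
            ; identity = (λ x → pointwise {fromℚ 0ℚ +ℝ x} {x} λ n → ℚ.+-identityˡ (seq x n))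
                       , (λ x → pointwise {x +ℝ fromℚ 0ℚ} {x} λ n → ℚ.+-identityʳ (seq x n))
            }
          ; inverse = (λ x → pointwise { -ℝ x +ℝ x} {fromℚ 0ℚ} λ n → ℚ.+-inverseˡ (seq x n))
                    , (λ x → pointwise {x +ℝ -ℝ x} {fromℚ 0ℚ} λ n → ℚ.+-inverseʳ (seq x n))
          ; ⁻¹-cong = λ {x} {x′} → -ℝ-cong {x} {x′}
          }
        ; comm = λ x y → pointwise {x +ℝ y} {y +ℝ x} λ n → ℚ.+-comm (seq x n) (seq y n)
        }
      ; *-cong = λ {x} {x′} {y} {y′} → *ℝ-cong {x} {x′} {y} {y′}
      ; *-assoc = λ x y z → pointwise {(x *ℝ y) *ℝ z} {x *ℝ (y *ℝ z)}
          λ n → ℚ.*-assoc (seq x n) (seq y n) (seq z n)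
      ; *-identity = (λ x → pointwise {fromℚ 1ℚ *ℝ x} {x} λ n → ℚ.*-identityˡ (seq x n))
                   , (λ x → pointwise {x *ℝ fromℚ 1ℚ} {x} λ n → ℚ.*-identityʳ (seq x n))
      ; distrib = (λ x y z → pointwise {x *ℝ (y +ℝ z)} {(x *ℝ y) +ℝ (x *ℝ z)}
                     λ n → ℚ.*-distribˡ-+ (seq x n) (seq y n) (seq z n))
                , (λ x y z → pointwise {(y +ℝ z) *ℝ x} {(y *ℝ x) +ℝ (z *ℝ x)}
                     λ n → ℚ.*-distribʳ-+ (seq x n) (seq y n) (seq z n))
      }
    ; *-comm = λ x y → pointwise {x *ℝ y} {y *ℝ x} λ n → ℚ.*-comm (seq x n) (seq y n)
    }
  }

------------------------------------------------------------------------
-- R[X]/(X² - m), with (a , b) standing for a + b X.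

module AdjoinSqrt {c ℓ} (R : CommutativeRing c ℓ) (m : CommutativeRing.Carrier R) where

  private
    module R = CommutativeRing R
    module G = AbelianGroup
      (DirectProduct.abelianGroup R.+-abelianGroup R.+-abelianGroup)

    open R using (_≈_; _+_; _*_; 0#; 1#)
    open NaturalCoefficients R.commutativeSemiring

    assoc-fst : ∀ m a b c d e f →
      (a * c + m * (b * d)) * e + m * ((a * d + b * c) * f) ≈
      a * (c * e + m * (d * f)) + m * (b * (c * f + d * e))
    assoc-fst = solve 7 (λ m a b c d e f →
      (a :* c :+ m :* (b :* d)) :* e :+ m :* ((a :* d :+ b :* c) :* f) :=
      a :* (c :* e :+ m :* (d :* f)) :+ m :* (b :* (c :* f :+ d :* e))) R.refl

    assoc-snd : ∀ m a b c d e f →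
      (a * c + m * (b * d)) * f + (a * d + b * c) * e ≈ a * (c * f + d * e) + b * (c * e + m * (d * f))
    assoc-snd = solve 7 (λ m a b c d e f →
      (a :* c :+ m :* (b :* d)) :* f :+ (a :* d :+ b :* c) :* e :=
      a :* (c :* f :+ d :* e) :+ b :* (c :* e :+ m :* (d :* f))) R.refl

    comm-fst : ∀ m a b c d → a * c + m * (b * d) ≈ c * a + m * (d * b)
    comm-fst = solve 5 (λ m a b c d →
      a :* c :+ m :* (b :* d) := c :* a :+ m :* (d :* b)) R.refl

    comm-snd : ∀ a b c d → a * d + b * c ≈ c * b + d * a
    comm-snd = solve 4 (λ a b c d →
      a :* d :+ b :* c := c :* b :+ d :* a) R.refl

    identityˡ-fst : ∀ a b → 1# * a + m * (0# * b) ≈ a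
    identityˡ-fst a b = R.trans
      (R.+-cong (R.*-identityˡ a) (R.trans (R.*-congˡ (R.zeroˡ b)) (R.zeroʳ m)))
      (R.+-identityʳ a)

    identityˡ-snd : ∀ a b → 1# * b + 0# * a ≈ b
    identityˡ-snd a b = R.trans (R.+-cong (R.*-identityˡ b) (R.zeroˡ a)) (R.+-identityʳ b)

    distribˡ-fst : ∀ m a b c d e f →
      a * (c + e) + m * (b * (d + f)) ≈
      (a * c + m * (b * d)) + (a * e + m * (b * f))
    distribˡ-fst = solve 7 (λ m a b c d e f →
      a :* (c :+ e) :+ m :* (b :* (d :+ f)) :=
      (a :* c :+ m :* (b :* d)) :+ (a :* e :+ m :* (b :* f))) R.refl

    distribˡ-snd : ∀ a b c d e f →
      a * (d + f) + b * (c + e) ≈ (a * d + b * c) + (a * f + b * e)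
    distribˡ-snd = solve 6 (λ a b c d e f →
      a :* (d :+ f) :+ b :* (c :+ e) :=
      (a :* d :+ b :* c) :+ (a :* f :+ b :* e)) R.refl

    distribʳ-fst : ∀ m a b c d e f →
      (c + e) * a + m * ((d + f) * b) ≈
      (c * a + m * (d * b)) + (e * a + m * (f * b))
    distribʳ-fst = solve 7 (λ m a b c d e f →
      (c :+ e) :* a :+ m :* ((d :+ f) :* b) :=
      (c :* a :+ m :* (d :* b)) :+ (e :* a :+ m :* (f :* b))) R.refl

    distribʳ-snd : ∀ a b c d e f →
      (c + e) * b + (d + f) * a ≈ (c * b + d * a) + (e * b + f * a)
    distribʳ-snd = solve 6 (λ a b c d e f →
      (c :+ e) :* b :+ (d :+ f) :* a :=
      (c :* b :+ d :* a) :+ (e :* b :+ f :* a)) R.refl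

  _⊗_ : G.Carrier → G.Carrier → G.Carrier
  (a , b) ⊗ (c , d) = (a R.* c R.+ m R.* (b R.* d)) , (a R.* d R.+ b R.* c)

  ring : CommutativeRing c ℓ
  ring = record
    { Carrier = G.Carrier
    ; _≈_ = G._≈_
    ; _+_ = G._∙_
    ; _*_ = _⊗_
    ; -_  = G._⁻¹
    ; 0#  = G.ε
    ; 1#  = R.1# , R.0#
    ; isCommutativeRing = record
      { isRing = record
        { +-isAbelianGroup = G.isAbelianGroup
        ; *-cong = λ (p , q) (r , s) →
            R.+-cong (R.*-cong p r) (R.*-cong R.refl (R.*-cong q s))
          , R.+-cong (R.*-cong p s) (R.*-cong q r)
        ; *-assoc = λ (a , b) (c , d) (e , f) → assoc-fst m a b c d e f , assoc-snd m a b c d e f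
        ; *-identity = (λ (a , b) → identityˡ-fst a b , identityˡ-snd a b)
                     , (λ (a , b) →
                         R.trans (comm-fst m a b 1# 0#) (identityˡ-fst a b)
                       , R.trans (comm-snd a b 1# 0#) (identityˡ-snd a b))
        ; distrib = (λ (a , b) (c , d) (e , f) → distribˡ-fst m a b c d e f , distribˡ-snd a b c d e f)
                  , (λ (a , b) (c , d) (e , f) → distribʳ-fst m a b c d e f , distribʳ-snd a b c d e f)
        }
      ; *-comm = λ (a , b) (c , d) → comm-fst m a b c d , comm-snd a b c d
      }
    }

ℂ-ring : CommutativeRing 0ℓ 0ℓ
ℂ-ring = AdjoinSqrt.ring ℝ-ring (-ℝ fromℚ 1ℚ)

ℂ : Set
ℂ = CommutativeRing.Carrier ℂ-ring

------------------------------------------------------------------------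

module Superspace {c ℓ} (K : CommutativeRing c ℓ) where

  private
    module K = CommutativeRing K
    open RawSemiring (Semiring.rawSemiring K.semiring) using () renaming (_^_ to _^ᴷ_; _×_ to _×ᴷ_)

  IsPrimitiveRoot : ℕ → K.Carrier → Set ℓ
  IsPrimitiveRoot r ζ =
    ((ζ ^ᴷ r) K.≈ K.1#) ×
    (∀ k → 0 ℕ.< k → k ℕ.< r → ¬ ((ζ ^ᴷ k) K.≈ K.1#))

  -- (a , J) stands for x₁^a₁ ⋯ xₙ^aₙ θ_{j₁} ⋯ θ_{jₖ}, where j₁ < ⋯ < jₖ are
  -- the elements of J.  These monomials are a K-basis of superspace, whose
  -- elements are represented by formal linear combinations of them, two such
  -- being identified by _≈_ when all their coefficients agree.
  Monomial : ℕ → Set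
  Monomial n = Vec ℕ n × Subset n

  Ω : ℕ → Set c
  Ω n = List (K.Carrier × Monomial n)

  private variable
    n : ℕ

  infix 4 _≟ᵐ_ _≈_

  _≟ᵐ_ : DecidableEquality (Monomial n)
  _≟ᵐ_ = Product.≡-dec (Vec.≡-dec ℕ._≟_) (Vec.≡-dec Bool._≟_)

  coeff : Monomial n → Ω n → K.Carrier
  coeff m [] = K.0#
  coeff m ((k , m′) ∷ f) = (if does (m ≟ᵐ m′) then k else K.0#) K.+ coeff m f

  _≈_ : Ω n → Ω n → Set ℓ
  f ≈ g = ∀ m → coeff m f K.≈ coeff m g

  infixl 6 _+_ _-_
  infixl 7 _*_ _·_ _⊙_
  infixr 8 _^_

  0Ω 1Ω : Ω n
  0Ω = []
  1Ω {n} = (K.1# , replicate n 0 , ⊥) ∷ []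

  _+_ : Ω n → Ω n → Ω n
  _+_ = _++_

  _·_ : K.Carrier → Ω n → Ω n
  k · f = map (λ (k′ , m) → k K.* k′ , m) f

  linear : (Monomial n → Ω n) → Ω n → Ω n
  linear φ = concatMap (λ (k , m) → k · φ m)

  -- (-1) to the number of elements of J smaller than i: the sign incurred by
  -- moving θᵢ between the front of θ_J and its place in increasing order.
  sign : Fin n → Subset n → K.Carrier
  sign zero    J             = K.1#
  sign (suc i) (inside  ∷ J) = K.- sign i J
  sign (suc i) (outside ∷ J) = sign i J

  -- Left multiplications by xᵢ and θᵢ; products of general elements are
  -- obtained from these through `operator`.
  mulˣ mulᶿ : Fin n → Ω n → Ω n
  mulˣ i = linear λ (a , J) → (K.1# , a [ i ]%= suc , J) ∷ []
  mulᶿ i = linear λ (a , J) →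
    if lookup J i then [] else (sign i J , a , J [ i ]≔ inside) ∷ []

  ∂ ∂ᶿ : Fin n → Ω n → Ω n
  ∂  i = linear λ (a , J) → (lookup a i ×ᴷ K.1# , a [ i ]%= ℕ.pred , J) ∷ []
  ∂ᶿ i = linear λ (a , J) →
    if lookup J i then (sign i J , a , J [ i ]≔ outside) ∷ [] else []

  -- The operator obtained from f by replacing xᵢ → X i and θᵢ → Θ i.
  operator : (X Θ : Fin n → Ω n → Ω n) → Ω n → Ω n → Ω n
  operator {n} X Θ f g = concatMap (λ (k , m) → k · monomial m g) f
    where
    compose : (Fin n → Ω n → Ω n) → Ω n → Ω n
    compose F h = foldr F h (allFin n)

    monomial : Monomial n → Ω n → Ω n
    monomial (a , J) h =
      compose (λ i h′ → fold h′ (X i) (lookup a i))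
        (compose (λ i → if lookup J i then Θ i else id) h)

  _*_ : Ω n → Ω n → Ω n
  _*_ = operator mulˣ mulᶿ

  _⊙_ : Ω n → Ω n → Ω n
  _⊙_ = operator ∂ ∂ᶿ

  _-_ : Ω n → Ω n → Ω n
  f - g = f + (K.- K.1#) · g

  _^_ : Ω n → ℕ → Ω n
  f ^ k = fold 1Ω (f *_) k

  x θ : Fin n → Ω n
  x i = mulˣ i 1Ω
  θ i = mulᶿ i 1Ω

  ∑ ∏ : (Fin n → Ω n) → Ω n
  ∑ {n} F = foldr (λ i → F i +_) 0Ω (allFin n)
  ∏ {n} F = foldr (λ i → F i *_) 1Ω (allFin n)

  constantTerm : Ω n → K.Carrier
  constantTerm {n} = coeff (replicate n 0 , ⊥)

  -- (c , w) is the monomial matrix diag(ζ^c₁, …, ζ^cₙ) · w; as ζ is a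
  -- primitive r-th root of unity, each monomial matrix whose nonzero entries
  -- are r-th roots of unity has exactly one such expression.
  Wreath : ℕ → ℕ → Set
  Wreath r n = (Fin n → Fin r) × Permutation′ n

  module _ (r : ℕ) (ζ : K.Carrier) where

    -- w sends xᵢ to x_{w(i)}, which diag(ζ^c₁, …, ζ^cₙ) then scales by
    -- ζ^{-c_{w(i)}}; since ζ^r = 1, ζ^{-k} is written ζ^(r - k).
    act : Wreath r n → Ω n → Ω n
    act (c , w) f = operator (image x) (image θ) f 1Ω
      where
      image : (Fin _ → Ω _) → Fin _ → Ω _ → Ω _
      image y i = ((ζ ^ᴷ (r ℕ.∸ toℕ (c (w ⟨$⟩ʳ i)))) · y (w ⟨$⟩ʳ i)) *_

    Invariant : Pred (Ω n) ℓ
    Invariant f = ∀ σ → act σ f ≈ f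

  data Ideal {p} (P : Pred (Ω n) p) : Pred (Ω n) (c ⊔ ℓ ⊔ p) where
    gen       : ∀ {f} → f ∈ P → f ∈ Ideal P
    0-closed  : 0Ω ∈ Ideal P
    +-closed  : ∀ {f g} → f ∈ Ideal P → g ∈ Ideal P → f + g ∈ Ideal P
    *-closedˡ : ∀ h {f} → f ∈ Ideal P → h * f ∈ Ideal P
    *-closedʳ : ∀ h {f} → f ∈ Ideal P → f * h ∈ Ideal P
    ≈-closed  : ∀ {f g} → f ≈ g → f ∈ Ideal P → g ∈ Ideal P

  SI : (n r : ℕ) (ζ : K.Carrier) → Pred (Ω n) (c ⊔ ℓ)
  SI n r ζ = Ideal λ f → Invariant r ζ f × (constantTerm f K.≈ K.0#)

  infix 9 _^⊥

  _^⊥ : ∀ {p} → Pred (Ω n) p → Pred (Ω n) (c ⊔ ℓ ⊔ p)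
  (I ^⊥) g = ∀ {f} → f ∈ I → f ⊙ g ≈ 0Ω

  d : ℕ → Ω n → Ω n
  d j f = ∑ λ i → fold f (∂ i) j * θ i

  δ : (n r : ℕ) → Ω n
  δ n r = ∏ (λ i → x i ^ (r ℕ.∸ 1)) *
          ∏ λ i → ∏ λ j → if does (i Fin.<? j) then x i ^ r - x j ^ r else 1Ω

  record IsSubspace {p} (V : Pred (Ω n) p) : Set (c ⊔ ℓ ⊔ p) where
    field
      respects-≈ : ∀ {f g} → f ≈ g → f ∈ V → g ∈ V
      0∈V        : 0Ω ∈ V
      +∈V        : ∀ {f g} → f ∈ V → g ∈ V → f + g ∈ V
      ·∈V        : ∀ k {f} → f ∈ V → k · f ∈ V

  record IsOperatorClosed (n r : ℕ) {p} (V : Pred (Ω n) p) : Set (c ⊔ ℓ ⊔ p) where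
    field
      isSubspace : IsSubspace V
      δ∈V        : δ n r ∈ V
      ∂-closed   : ∀ (i : Fin n) {f} → f ∈ V → ∂ i f ∈ V
      d-closed   : ∀ (k : Fin n) {f} → f ∈ V → d (toℕ k ℕ.* r ℕ.+ 1) f ∈ V

open Superspace ℂ-ring public

{-# OPTIONS --safe #-}
module Submission where

-- In the coordinates g ↦ a! [x^a θ_J] g every ∂ᵢ is a shift of exponents, and SI^⊥
-- becomes a module over a polynomial ring, with components g_J.  It is closed under d_j for
-- j ≡ 1 mod r because f ⊙ d_j g and d_j (f ⊙ g) differ, up to parity, by (Σ xᵢ^j ∂ᶿᵢ f) ⊙ g,
-- and this contraction of an invariant f is again invariant.  It contains δ because f ⊙ δ is
-- alternating, supported on exponents ≡ -1 mod r, and of degree below that of δ.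
--
-- For minimality, let g ∈ SI^⊥ and take J of largest element sum with g_J ≠ 0.  Pairing with the
-- invariants Σ xᵢ^{kr} and Σ xᵢ^{kr-1} θᵢ shows that g_J is killed by the power sums Σ xᵢ^{kr} and by
-- Fⱼ = xⱼ^{r-1} ∏_{i<j, i∉J} (xⱼ^r - xᵢ^r) for j ∈ J.  Combinations of Euler operators applied
-- to δ have the top component f_J ⊙ δ, where f_J = ∏_{j∈J} xⱼ ∏_{i>j} (xⱼ^r - xᵢ^r).  So g
-- reduces to zero once everything killed by the power sums and the Fⱼ is a multiple of f_J ⊙ δ.
-- This holds for power sums with arbitrary positive weights, by induction on the number of
-- variables: split Fⱼ into its factors; on the kernel of xⱼ^r - xᵢ^r the weights of i and j add
-- up, and on the kernel of xⱼ the variable xⱼ disappears.  The constants that occur are nonzero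
-- because these kernels vanish in the degrees above their socle.

open import Algebra.Bundles using (CommutativeRing; Semiring)
import Algebra.Definitions.RawSemiring as RawSemiring
import Algebra.Properties.AbelianGroup as AbelianGroupProperties
open import Algebra.Properties.CommutativeMonoid.Sum as CMSum using ()
import Algebra.Properties.CommutativeSemiring.Exp as CSExp
import Algebra.Properties.Ring as RingProperties
import Algebra.Properties.Semiring.Mult as SemiringMult
import Algebra.Solver.Ring.NaturalCoefficients.Default as NaturalCoefficients
open import Data.Bool.Base using (Bool; true; false; if_then_else_; not)
import Data.Bool.Properties as Bool
open import Data.Empty using (⊥-elim)
open import Data.Fin.Base as Fin using (Fin; zero; suc; toℕ)
open import Data.Fin.Permutation as Perm using (Permutation′; _⟨$⟩ʳ_; _⟨$⟩ˡ_)
import Data.Fin.Properties as Fin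
open import Data.Fin.Subset as Subset using (Subset; inside; outside; ⊥)
open import Data.List.Base as List using (List; []; _∷_; _++_; map; replicate; length; foldr; allFin; tabulate)
open import Data.List.Membership.Propositional using (_∈_)
open import Data.List.Membership.Propositional.Properties using (∈-++⁺ˡ; ∈-++⁺ʳ; ∈-map⁺; ∈-tabulate⁺)
import Data.List.Properties as List
open import Data.List.Relation.Unary.All as All using (All; []; _∷_)
import Data.List.Relation.Unary.All.Properties as All
open import Data.List.Relation.Unary.Any using (here; there)
open import Data.Nat.Base as ℕ using (ℕ; zero; suc; NonZero; _!)
open import Data.Nat.DivMod using (_/_; _%_; m≡m%n+[m/n]*n; m%n<n)
open import Data.Nat.Divisibility using (_∣_; divides)
open import Data.Nat.GeneralisedArithmetic using (fold)
import Data.Nat.Properties as ℕ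
open import Data.Nat.Tactic.RingSolver using (solve-∀)
open import Data.Product.Base using (_×_; _,_; ∃; ∃₂; proj₁; proj₂)
open import Data.Product.Properties using (,-injectiveˡ; ,-injectiveʳ)
open import Data.Rational.Base as ℚ using (ℚ; 0ℚ; 1ℚ; ½)
import Data.Rational.Properties as ℚ
open import Data.Rational.Solver using (module +-*-Solver)
open import Data.Sum.Base using (_⊎_; inj₁; inj₂)
open import Data.Unit.Polymorphic.Base using (⊤; tt)
open import Data.Vec.Base as Vec using (Vec; []; _∷_; lookup; _[_]%=_)
import Data.Vec.Properties as Vec
import Defs
open import Function.Base using (id; _∘_)
open import Level using (Level; 0ℓ; _⊔_)
open import Relation.Binary.Definitions using (tri<; tri≈; tri>)
open import Relation.Binary.PropositionalEquality as ≡ using (_≡_; _≢_)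
import Relation.Binary.Reasoning.Setoid as SetoidReasoning
open import Relation.Nullary using (¬_; yes; no; Dec; does)
open import Relation.Nullary.Decidable using (dec-true; dec-false)
open import Relation.Unary using (Pred; _⊆_)

-- Equality of complex numbers given by Cauchy sequences cannot be decided, and knowing that an
-- element is not zero does not yet give an inverse. Three features of the proof answer this. Every
-- scalar that is divided by is an integer: a weight, a factorial, a sign, or a value of a socle
-- generator. For the last kind integrality (`IntFn`) travels through the whole induction, because
-- an integer multiple of 1 that is not zero is a unit. That `ζ ^ k` differs from 1 is used only in
-- the form that `ζ ^ k * x ≈ x` forces `x ≈ 0#`, which is obtained from 0 and 1 being the only
-- idempotents. And the descent clears every J of a given sum instead of selecting one with g_J ≠ 0.
-- The shape of f_J is dictated by duality. For j in J, the product of Fⱼ and the factor of f_J at j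
-- is Yⱼ ∏ (Yⱼ - Yₗ), with Yᵢ = xᵢ^r and l running over the later indices and the earlier ones
-- outside J. This product kills everything once the earlier indices of J have been eliminated, so
-- applying the factor to a socle generator leads into the part killed by Fⱼ.

module _ {c ℓ} (K : CommutativeRing c ℓ) where
  open CommutativeRing K
  open RawSemiring (Semiring.rawSemiring semiring) using () renaming (_×_ to _×′_)

  InvertibleNaturals : Set (c ⊔ ℓ)
  InvertibleNaturals = ∀ m → ∃ λ k → k * (suc m ×′ 1#) ≈ 1#

  Nontrivial : Set ℓ
  Nontrivial = ¬ 1# ≈ 0#

module Theory {c ℓ} (K : CommutativeRing c ℓ) (inverse : InvertibleNaturals K) (nontrivial : Nontrivial K) where
  open CommutativeRing K hiding (_-_; zero)
  private
    module Mult = SemiringMult semiring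
    module Exp = CSExp commutativeSemiring
    module G = AbelianGroupProperties +-abelianGroup

  open RawSemiring (Semiring.rawSemiring semiring) public using (_^_) renaming (_×_ to _×′_)
  open RingProperties ring public
    using (-0#≈0#; -‿+-comm; -‿distribˡ-*; -‿distribʳ-*; -1*x≈-x; -‿involutive)

  -- Linear operators on function spaces, and polynomials in commuting operators.

  Fn : Set → Set c
  Fn I = I → Carrier

  infix 4 _≗_
  _≗_ : {I : Set} → Fn I → Fn I → Set ℓ
  F ≗ G = ∀ i → F i ≈ G i

  infixl 6 _⊞_
  infixr 7 _⊡_

  _⊞_ : {I : Set} → Fn I → Fn I → Fn I
  (F ⊞ G) i = F i + G i

  _⊡_ : {I : Set} → Carrier → Fn I → Fn I
  (k ⊡ F) i = k * F i

  𝟘 : {I : Set} → Fn I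
  𝟘 i = 0#

  record Lin (I J : Set) : Set (c ⊔ ℓ) where
    field
      fn     : Fn I → Fn J
      fncong : ∀ {F G} → F ≗ G → fn F ≗ fn G
      fn-⊞   : ∀ F G → fn (F ⊞ G) ≗ fn F ⊞ fn G
      fn-⊡   : ∀ k F → fn (k ⊡ F) ≗ k ⊡ fn F

    fn-𝟘 : fn 𝟘 ≗ 𝟘
    fn-𝟘 j = trans (fncong (λ i → sym (zeroˡ 0#)) j) (trans (fn-⊡ 0# 𝟘 j) (zeroˡ _))

    fn-zero : ∀ {F} → F ≗ 𝟘 → fn F ≗ 𝟘
    fn-zero p j = trans (fncong p j) (fn-𝟘 j)

  open Lin public

  infixr 9 _⊚_
  _⊚_ : {I J L : Set} → Lin J L → Lin I J → Lin I L
  fn (S ⊚ T) F = fn S (fn T F)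
  fncong (S ⊚ T) p = fncong S (fncong T p)
  fn-⊞ (S ⊚ T) F G l = trans (fncong S (fn-⊞ T F G) l) (fn-⊞ S _ _ l)
  fn-⊡ (S ⊚ T) k F l = trans (fncong S (fn-⊡ T k F) l) (fn-⊡ S k _ l)

  idL : {I : Set} → Lin I I
  fn idL F = F
  fncong idL p = p
  fn-⊞ idL F G i = refl
  fn-⊡ idL k F i = refl

  zeroL : {I J : Set} → Lin I J
  fn zeroL F = 𝟘
  fncong zeroL p i = refl
  fn-⊞ zeroL F G i = sym (+-identityˡ 0#)
  fn-⊡ zeroL k F i = sym (zeroʳ k)

  +-interchange : ∀ a b c d → (a + b) + (c + d) ≈ (a + c) + (b + d)
  +-interchange a b c d = trans (+-assoc a b (c + d)) (trans (+-congˡ (trans (sym (+-assoc b c d))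
    (trans (+-congʳ (+-comm b c)) (+-assoc c b d)))) (sym (+-assoc a c (b + d))))

  *-swap : ∀ a b c → a * (b * c) ≈ b * (a * c)
  *-swap a b c = trans (sym (*-assoc a b c)) (trans (*-congʳ (*-comm a b)) (*-assoc b a c))

  addL : {I J : Set} → Lin I J → Lin I J → Lin I J
  fn (addL S T) F = fn S F ⊞ fn T F
  fncong (addL S T) p i = +-cong (fncong S p i) (fncong T p i)
  fn-⊞ (addL S T) F G i = trans (+-cong (fn-⊞ S F G i) (fn-⊞ T F G i)) (+-interchange _ _ _ _)
  fn-⊡ (addL S T) k F i = trans (+-cong (fn-⊡ S k F i) (fn-⊡ T k F i)) (sym (distribˡ k _ _))

  scaleL : {I J : Set} → Carrier → Lin I J → Lin I J
  fn (scaleL k T) F = k ⊡ fn T F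
  fncong (scaleL k T) p i = *-congˡ (fncong T p i)
  fn-⊞ (scaleL k T) F G i = trans (*-congˡ (fn-⊞ T F G i)) (distribˡ k _ _)
  fn-⊡ (scaleL k T) l F i = trans (*-congˡ (fn-⊡ T l F i)) (*-swap k l _)

  infixl 6 _⊕_
  infixl 7 _⊗_
  -- Kept as syntax because one polynomial acts in several ways: by derivatives, by multiplications,
  -- through substituted operators and through its value at a point. `intertwine-⟦⟧` carries results
  -- between these actions.
  data Expr (n : ℕ) : Set c where
    con     : Carrier → Expr n
    var     : Fin n → Expr n
    _⊕_ _⊗_ : Expr n → Expr n → Expr n

  module _ {n : ℕ} {I : Set} (X : Fin n → Lin I I) where
    ⟦_⟧ : Expr n → Lin I I
    ⟦ con k ⟧ = scaleL k idL
    ⟦ var i ⟧ = X i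
    ⟦ p ⊕ q ⟧ = addL ⟦ p ⟧ ⟦ q ⟧
    ⟦ p ⊗ q ⟧ = ⟦ p ⟧ ⊚ ⟦ q ⟧

  intertwine-⟦⟧ : ∀ {n I J} (X : Fin n → Lin I I) (Y : Fin n → Lin J J) (T : Lin I J) →
    (∀ i F → fn T (fn (X i) F) ≗ fn (Y i) (fn T F)) →
    ∀ p F → fn T (fn (⟦ X ⟧ p) F) ≗ fn (⟦ Y ⟧ p) (fn T F)
  intertwine-⟦⟧ X Y T h (con k) F i = fn-⊡ T k F i
  intertwine-⟦⟧ X Y T h (var j) F i = h j F i
  intertwine-⟦⟧ X Y T h (p ⊕ q) F i =
    trans (fn-⊞ T _ _ i) (+-cong (intertwine-⟦⟧ X Y T h p F i) (intertwine-⟦⟧ X Y T h q F i))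
  intertwine-⟦⟧ X Y T h (p ⊗ q) F i =
    trans (intertwine-⟦⟧ X Y T h p _ i) (fncong (⟦ Y ⟧ p) (intertwine-⟦⟧ X Y T h q F) i)

  Commute : {I : Set} → Lin I I → Lin I I → Set (c ⊔ ℓ)
  Commute S T = ∀ F → fn S (fn T F) ≗ fn T (fn S F)

  -- Polynomials, identified when they act equally through the commuting operators X.
  module ExprRing {n : ℕ} {I : Set} (X : Fin n → Lin I I)
    (commute : ∀ i j → Commute (X i) (X j)) where

    infix 4 _≋_
    record _≋_ (p q : Expr n) : Set (c ⊔ ℓ) where
      constructor equal
      field
        at : ∀ F → fn (⟦ X ⟧ p) F ≗ fn (⟦ X ⟧ q) F

    open _≋_ public

    -- `intertwine-⟦⟧` is used twice: the inner use moves one variable past p, the outer one then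
    -- moves p past all of q.
    ⊗-comm : ∀ p q → p ⊗ q ≋ q ⊗ p
    ⊗-comm p q = equal λ F → intertwine-⟦⟧ X X (⟦ X ⟧ p)
      (λ i G j → sym (intertwine-⟦⟧ X X (X i) (commute i) p G j)) q F

    exprRing : CommutativeRing c (c ⊔ ℓ)
    exprRing = record
      { Carrier = Expr n
      ; _≈_ = _≋_
      ; _+_ = _⊕_
      ; _*_ = _⊗_
      ; -_ = λ p → con (- 1#) ⊗ p
      ; 0# = con 0#
      ; 1# = con 1#
      ; isCommutativeRing = record
        { isRing = record
          { +-isAbelianGroup = record
            { isGroup = record
              { isMonoid = record
                { isSemigroup = record
                  { isMagma = record
                    { isEquivalence = record
                      { refl = equal λ F i → refl
                      ; sym = λ p → equal λ F i → sym (at p F i)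
                      ; trans = λ p q → equal λ F i → trans (at p F i) (at q F i)
                      }
                    ; ∙-cong = λ p q → equal λ F i → +-cong (at p F i) (at q F i)
                    }
                  ; assoc = λ p q s → equal λ F i → +-assoc _ _ _
                  }
                ; identity = (λ p → equal λ F i → trans (+-congʳ (zeroˡ _)) (+-identityˡ _))
                           , (λ p → equal λ F i → trans (+-congˡ (zeroˡ _)) (+-identityʳ _))
                }
              ; inverse = (λ p → equal λ F i → trans (+-congʳ (-1*x≈-x _)) (trans (-‿inverseˡ _) (sym (zeroˡ _))))
                        , (λ p → equal λ F i → trans (+-congˡ (-1*x≈-x _)) (trans (-‿inverseʳ _) (sym (zeroˡ _))))
              ; ⁻¹-cong = λ p → equal λ F i → *-congˡ (at p F i)
              }
            ; comm = λ p q → equal λ F i → +-comm _ _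
            }
          ; *-cong = λ {p} {p′} {q} {q′} e f → equal λ F i → trans (at e _ i) (fncong (⟦ X ⟧ p′) (at f F) i)
          ; *-assoc = λ p q s → equal λ F i → refl
          ; *-identity = (λ p → equal λ F i → *-identityˡ _) ,
              (λ p → equal λ F i → trans (fn-⊡ (⟦ X ⟧ p) 1# F i) (*-identityˡ _))
          ; distrib = (λ p q s → equal λ F i → fn-⊞ (⟦ X ⟧ p) _ _ i) , (λ p q s → equal λ F i → refl)
          }
        ; *-comm = ⊗-comm
        }
      }

  -- Integer scalars and units.

  data Int : Carrier → Set (c ⊔ ℓ) where
    int-0    : Int 0#
    int-1    : Int 1#
    int-neg  : ∀ {k} → Int k → Int (- k)
    int-+    : ∀ {k l} → Int k → Int l → Int (k + l)
    int-resp : ∀ {k l} → k ≈ l → Int k → Int l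

  int-* : ∀ {k l} → Int k → Int l → Int (k * l)
  int-* int-0 q = int-resp (sym (zeroˡ _)) int-0
  int-* int-1 q = int-resp (sym (*-identityˡ _)) q
  int-* (int-neg p) q = int-resp (-‿distribˡ-* _ _) (int-neg (int-* p q))
  int-* (int-+ p p′) q = int-resp (sym (distribʳ _ _ _)) (int-+ (int-* p q) (int-* p′ q))
  int-* (int-resp e p) q = int-resp (*-congʳ e) (int-* p q)

  int-× : ∀ m → Int (m ×′ 1#)
  int-× zero    = int-0
  int-× (suc m) = int-+ int-1 (int-× m)

  -- The pair m, l stands for the integer m - l, so that a question about the scalar k becomes one
  -- about natural numbers.
  int-difference : ∀ {k} → Int k → ∃₂ λ m l → k + l ×′ 1# ≈ m ×′ 1#
  int-difference int-0 = 0 , 0 , +-identityˡ 0#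
  int-difference int-1 = 1 , 0 , refl
  int-difference (int-neg {k} p) with int-difference p
  ... | m , l , e = l , m , trans (+-congˡ (sym e)) (trans (sym (+-assoc _ _ _))
                              (trans (+-congʳ (-‿inverseˡ k)) (+-identityˡ _)))
  int-difference (int-+ p q) with int-difference p | int-difference q
  ... | m , l , e | m′ , l′ , e′ = m ℕ.+ m′ , l ℕ.+ l′ ,
    trans (+-congˡ (Mult.×-homo-+ 1# l l′)) (trans (+-interchange _ _ _ _)
      (trans (+-cong e e′) (sym (Mult.×-homo-+ 1# m m′))))
  int-difference (int-resp e p) with int-difference p
  ... | m , l , f = m , l , trans (+-congʳ (sym e)) f

  Unit : Carrier → Set (c ⊔ ℓ)
  Unit k = ∃ λ k⁻¹ → k⁻¹ * k ≈ 1#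

  unit-neg : ∀ {k} → Unit k → Unit (- k)
  unit-neg (k⁻¹ , e) = - k⁻¹ , trans (sym (-‿distribˡ-* _ _)) (trans (-‿cong (sym (-‿distribʳ-* _ _)))
                               (trans (-‿involutive _) e))

  unit-resp : ∀ {k l} → k ≈ l → Unit k → Unit l
  unit-resp e (k⁻¹ , f) = k⁻¹ , trans (*-congˡ (sym e)) f

  unit-* : ∀ {k l} → Unit k → Unit l → Unit (k * l)
  unit-* {k} {l} (k⁻¹ , e) (l⁻¹ , f) = l⁻¹ * k⁻¹ , trans (*-assoc _ _ _) (trans (*-congˡ
    (trans (sym (*-assoc _ _ _)) (trans (*-congʳ e) (*-identityˡ l)))) f)

  unit-suc : ∀ m → Unit (suc m ×′ 1#)
  unit-suc = inverse

  unit-≉0 : ∀ {k} → Unit k → ¬ k ≈ 0#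
  unit-≉0 (k⁻¹ , e) z = nontrivial (trans (sym e) (trans (*-congˡ z) (zeroʳ k⁻¹)))

  unit-cancel : ∀ {k x} → Unit k → k * x ≈ 0# → x ≈ 0#
  unit-cancel {k} {x} (k⁻¹ , e) z = trans (sym (*-identityˡ x)) (trans (*-congʳ (sym e))
    (trans (*-assoc _ _ _) (trans (*-congˡ z) (zeroʳ k⁻¹))))

  cancelʳ : ∀ {k} x y → k + x ≈ y + x → k ≈ y
  cancelʳ {k} x y = G.∙-cancelʳ x k y

  unit-difference : ∀ {k} m l → m ≢ l → k + l ×′ 1# ≈ m ×′ 1# → Unit k
  unit-difference {k} zero zero m≢l e = ⊥-elim (m≢l ≡.refl)
  unit-difference {k} (suc m) zero m≢l e = unit-resp (trans (sym e) (+-identityʳ k)) (unit-suc m)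
  unit-difference {k} zero (suc l) m≢l e =
    unit-resp (sym (G.inverseˡ-unique k (suc l ×′ 1#) e)) (unit-neg (unit-suc l))
  unit-difference {k} (suc m) (suc l) m≢l e = unit-difference m l (λ q → m≢l (≡.cong suc q))
    (G.∙-cancelˡ 1# _ _ (trans (trans (sym (+-assoc _ _ _)) (trans (+-congʳ (+-comm 1# k)) (+-assoc _ _ _))) e))

  -- Equality of m and l is decidable although equality of scalars is not. Equal m and l would give
  -- `k ≈ 0#`; otherwise k is plus or minus a positive natural number, which is invertible.
  int-unit : ∀ {k} → Int k → ¬ k ≈ 0# → Unit k
  int-unit {k} i k≉0 with int-difference i
  ... | m , l , e with m ℕ.≟ l
  ... | no m≢l = unit-difference m l m≢l e
  ... | yes ≡.refl = ⊥-elim (k≉0 (cancelʳ (l ×′ 1#) 0# (trans e (sym (+-identityˡ _)))))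

  -- Remembers the position of the chosen entry, so that `replaced` can put another entry in the
  -- same place.
  data Split {a} {A : Set a} : List A → A → List A → Set a where
    here  : ∀ {x xs} → Split (x ∷ xs) x xs
    there : ∀ {y ys x xs} → Split xs x ys → Split (y ∷ xs) x (y ∷ ys)

  -- Functions on exponents as a module on which the variables act by shifts.

  module Core {n : ℕ} where

    -- The full linear dual of the polynomial ring, with arbitrary support; `shift i` is the
    -- transpose of multiplication by xᵢ.
    U : Set c
    U = Fn (Vec ℕ n)

    shift : Fin n → Lin (Vec ℕ n) (Vec ℕ n)
    fn (shift i) u a = u (a [ i ]%= suc)
    fncong (shift i) p a = p _
    fn-⊞ (shift i) u v a = refl
    fn-⊡ (shift i) k u a = refl

    shift-comm : ∀ i j → Commute (shift i) (shift j)
    shift-comm i j u a with i Fin.≟ j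
    ... | yes ≡.refl = refl
    ... | no i≢j = reflexive (≡.cong u (≡.sym (Vec.updateAt-commutes i j i≢j a)))

    open ExprRing shift shift-comm public
    module A = CommutativeRing exprRing
    open RawSemiring (Semiring.rawSemiring A.semiring) public using () renaming (_^_ to _^ᴬ_)

    infixr 7 _▸_
    _▸_ : Expr n → U → U
    p ▸ u = fn (⟦ shift ⟧ p) u

    ▸-zero : ∀ p {u} → u ≗ 𝟘 → p ▸ u ≗ 𝟘
    ▸-zero p = fn-zero (⟦ shift ⟧ p)

    ▸-cong : ∀ p {u v} → u ≗ v → p ▸ u ≗ p ▸ v
    ▸-cong p = fncong (⟦ shift ⟧ p)

    -1ᴬ : Expr n
    -1ᴬ = con (- 1#)

    infixl 6 _⊟_
    _⊟_ : Expr n → Expr n → Expr n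
    p ⊟ q = p ⊕ -1ᴬ ⊗ q

    ⊟-kills⁻¹ : ∀ p q {u} → (p ⊟ q) ▸ u ≗ 𝟘 → p ▸ u ≗ q ▸ u
    ⊟-kills⁻¹ p q {u} e a = cancelʳ (- (q ▸ u) a) _
      (trans (+-congˡ (sym (-1*x≈-x _))) (trans (e a) (sym (-‿inverseʳ _))))

    -- Degrees and integrality

    Supp : ℕ → U → Set ℓ
    Supp d u = ∀ a → Vec.sum a ≢ d → u a ≈ 0#

    sum-suc : ∀ {m} (a : Vec ℕ m) i → Vec.sum (a [ i ]%= suc) ≡ suc (Vec.sum a)
    sum-suc (k ∷ a) zero    = ≡.refl
    sum-suc (k ∷ a) (suc i) = ≡.trans (≡.cong (k ℕ.+_) (sum-suc a i)) (ℕ.+-suc k (Vec.sum a))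

    -- Homogeneity is tested on the action and not on the syntax. Adding b to the degree of a,
    -- instead of subtracting it from d, makes `p ▸ u` vanish altogether when b exceeds d.
    Deg : ℕ → Expr n → Set (c ⊔ ℓ)
    Deg b p = ∀ {d u} → Supp d u → ∀ a → Vec.sum a ℕ.+ b ≢ d → (p ▸ u) a ≈ 0#

    deg-con : ∀ k → Deg 0 (con k)
    deg-con k s a h = trans (*-congˡ (s a (λ e → h (≡.trans (ℕ.+-identityʳ _) e)))) (zeroʳ k)

    deg-var : ∀ i → Deg 1 (var i)
    deg-var i s a h = s _ (λ e → h (≡.trans (ℕ.+-comm _ 1) (≡.trans (≡.sym (sum-suc a i)) e)))

    deg-⊕ : ∀ {b p q} → Deg b p → Deg b q → Deg b (p ⊕ q)
    deg-⊕ dp dq s a h = trans (+-cong (dp s a h) (dq s a h)) (+-identityˡ 0#)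

    deg-lower : ∀ {b p d u} → Deg b p → Supp (d ℕ.+ b) u → Supp d (p ▸ u)
    deg-lower dp s a h = dp s a (λ e → h (ℕ.+-cancelʳ-≡ _ _ _ e))

    deg-⊗ : ∀ {b b′ p q} → Deg b p → Deg b′ q → Deg (b ℕ.+ b′) (p ⊗ q)
    deg-⊗ {b} {b′} {p} {q} dp dq {d} {u} s a h with b′ ℕ.≤? d
    ... | yes b′≤d = dp (deg-lower {p = q} dq (≡.subst (λ e → Supp e u) (≡.sym (ℕ.m∸n+n≡m b′≤d)) s)) a
      λ e → h (≡.trans (≡.sym (ℕ.+-assoc (Vec.sum a) b b′))
        (≡.trans (≡.cong (ℕ._+ b′) e) (ℕ.m∸n+n≡m b′≤d)))
    -- A q of degree above that of u already kills u.
    ... | no b′≰d = ▸-zero p (λ x → dq s x (λ e → b′≰d (ℕ.m+n≤o⇒n≤o (Vec.sum x) (ℕ.≤-reflexive e)))) a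

    deg-⊟ : ∀ {b p q} → Deg b p → Deg b q → Deg b (p ⊟ q)
    deg-⊟ {p = p} {q} dp dq = deg-⊕ {p = p} {q = -1ᴬ ⊗ q} dp (deg-⊗ {p = -1ᴬ} {q} (deg-con (- 1#)) dq)

    deg-^ : ∀ {p} → Deg 1 p → ∀ k → Deg k (p ^ᴬ k)
    deg-^ dp zero = deg-con 1#
    deg-^ {p} dp (suc k) = deg-⊗ {p = p} {p ^ᴬ k} dp (deg-^ dp k)

    IntFn : U → Set (c ⊔ ℓ)
    IntFn u = ∀ a → Int (u a)

    Integral : Expr n → Set (c ⊔ ℓ)
    Integral p = ∀ {u} → IntFn u → IntFn (p ▸ u)

    integral-con : ∀ {k} → Int k → Integral (con k)
    integral-con i j a = int-* i (j a)

    integral-⊟ : ∀ {p q} → Integral p → Integral q → Integral (p ⊟ q)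
    integral-⊟ ip iq i a = int-+ (ip i a) (int-* (int-neg int-1) (iq i a))

    integral-^ : ∀ {p} → Integral p → ∀ k → Integral (p ^ᴬ k)
    integral-^ ip zero = integral-con int-1
    integral-^ ip (suc k) i = ip (integral-^ ip k i)

    record Factor : Set (c ⊔ ℓ) where
      field
        poly     : Expr n
        deg      : ℕ
        hasDeg   : Deg deg poly
        integral : Integral poly
        positive : 1 ℕ.≤ deg

    open Factor

    prod : List Factor → Expr n
    prod []       = con 1#
    prod (α ∷ αs) = poly α ⊗ prod αs

    tot : List Factor → ℕ
    tot []       = 0
    tot (α ∷ αs) = deg α ℕ.+ tot αs

    tot-++ : ∀ αs βs → tot (αs ++ βs) ≡ tot αs ℕ.+ tot βs
    tot-++ []       βs = ≡.refl
    tot-++ (α ∷ αs) βs = ≡.trans (≡.cong (deg α ℕ.+_) (tot-++ αs βs)) (≡.sym (ℕ.+-assoc (deg α) _ _))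

    prod-++ : ∀ αs βs → prod (αs ++ βs) ≋ prod αs ⊗ prod βs
    prod-++ []       βs = A.sym (A.*-identityˡ _)
    prod-++ (α ∷ αs) βs = A.trans (A.*-congˡ {poly α} (prod-++ αs βs))
                            (A.sym (A.*-assoc (poly α) (prod αs) (prod βs)))

    prod-deg : ∀ αs → Deg (tot αs) (prod αs)
    prod-deg []       = deg-con 1#
    prod-deg (α ∷ αs) = deg-⊗ {p = poly α} {prod αs} (hasDeg α) (prod-deg αs)

    prod-integral : ∀ αs → Integral (prod αs)
    prod-integral []       = integral-con int-1
    prod-integral (α ∷ αs) i = integral α (prod-integral αs i)

    tot-split : ∀ {αs α rest} → Split αs α rest → tot αs ≡ deg α ℕ.+ tot rest
    tot-split here = ≡.refl
    tot-split (there {β} {rest} {α} s) = ≡.trans (≡.cong (deg β ℕ.+_) (tot-split s))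
      (≡.trans (≡.sym (ℕ.+-assoc (deg β) (deg α) (tot rest)))
        (≡.trans (≡.cong (ℕ._+ tot rest) (ℕ.+-comm (deg β) (deg α))) (ℕ.+-assoc (deg α) (deg β) (tot rest))))

    prod-split : ∀ {αs α rest} → Split αs α rest → prod αs ≋ poly α ⊗ prod rest
    prod-split here = A.refl
    prod-split (there {β} {rest} {α} s) = A.trans (A.*-congˡ {poly β} (prod-split s))
      (A.trans (A.sym (A.*-assoc (poly β) (poly α) (prod rest)))
        (A.trans (A.*-congʳ (A.*-comm (poly β) (poly α))) (A.*-assoc (poly α) (poly β) (prod rest))))

    all-split : ∀ {a p} {B : Set a} {P : B → Set p} {xs x rest} → Split xs x rest → All P xs → P x × All P rest
    all-split here (p ∷ ps) = p , ps
    all-split (there s) (q ∷ ps) with all-split s ps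
    ... | p , ps′ = p , q ∷ ps′

    -- Cyclic modules

    record Submodule (P : U → Set ℓ) : Set (c ⊔ ℓ) where
      field
        resp     : ∀ {u v} → u ≗ v → P u → P v
        ⊞-closed : ∀ {u v} → P u → P v → P (u ⊞ v)
        ▸-closed : ∀ p {u} → P u → P (p ▸ u)

    open Submodule

    infix 4 _∈⟨_⟩
    _∈⟨_⟩ : U → U → Set (c ⊔ ℓ)
    u ∈⟨ D ⟩ = ∃ λ h → u ≗ h ▸ D

    _∩ker_ : (U → Set ℓ) → Expr n → U → Set ℓ
    (P ∩ker α) u = P u × (α ▸ u ≗ 𝟘)

    ▸-comm : ∀ p q u → p ▸ q ▸ u ≗ q ▸ p ▸ u
    ▸-comm p q u = at (⊗-comm p q) u

    ∩ker-submodule : ∀ {P} α → Submodule P → Submodule (P ∩ker α)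
    resp (∩ker-submodule α S) e (p , k) = resp S e p , λ a → trans (sym (▸-cong α e a)) (k a)
    ⊞-closed (∩ker-submodule α S) (p , k) (q , l) = ⊞-closed S p q ,
      λ a → trans (fn-⊞ (⟦ shift ⟧ α) _ _ a) (trans (+-cong (k a) (l a)) (+-identityˡ 0#))
    ▸-closed (∩ker-submodule α S) p (q , k) = ▸-closed S p q ,
      λ a → trans (▸-comm α p _ a) (▸-zero p k a)

    Covers : (U → Set ℓ) → Expr n → U → Set (c ⊔ ℓ)
    Covers P γ C = ∀ u → P u → γ ▸ u ≗ 𝟘 → u ∈⟨ C ⟩

    -- If u is killed by α β, then β u is killed by α, so β u = h β C for some h;
    -- subtracting h C from u leaves an element killed by β.
    covers-⊗ : ∀ {P} α β {C} → Submodule P → P C →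
      Covers P α (β ▸ C) → Covers P β (α ▸ C) → Covers P (α ⊗ β) C
    covers-⊗ {P} α β {C} S C∈P covα covβ u u∈P αβu with covα (β ▸ u) (▸-closed S β u∈P) αβu
    ... | h , βu≗hβC with covβ (u ⊞ con (- 1#) ▸ h ▸ C)
                        (⊞-closed S u∈P (▸-closed S (con (- 1#)) (▸-closed S h C∈P)))
                        (λ a → trans (fn-⊞ (⟦ shift ⟧ β) _ _ a)
                          (trans (+-cong (trans (βu≗hβC a) (▸-comm h β C a))
                              (trans (fn-⊡ (⟦ shift ⟧ β) _ _ a) (-1*x≈-x _)))
                            (-‿inverseʳ _)))
    ...   | h′ , e = h ⊕ h′ ⊗ α , λ a → trans (sym (trans (+-assoc _ _ _) (trans (+-congˡ (trans (+-congʳ (-1*x≈-x _))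
                       (-‿inverseˡ _))) (+-identityʳ _)))) (trans (+-congʳ (e a)) (+-comm _ _))

    covers-1 : ∀ {P C} → Covers P (con 1#) C
    covers-1 u u∈P z = con 0# , λ a → trans (trans (sym (*-identityˡ _)) (z a)) (sym (zeroˡ _))

    covers-resp : ∀ {P γ C C′} → C ≗ C′ → Covers P γ C → Covers P γ C′
    covers-resp e cov u u∈P z with cov u u∈P z
    ... | h , f = h , λ a → trans (f a) (▸-cong h e a)

    -- Repeated use of `covers-⊗`. Once α is split off, the generator for the tail is `poly α ▸ C`;
    -- since α commutes with the product of the remaining factors, the same hypotheses serve again.
    covers-prod : ∀ {P} αs {C} → Submodule P → P C →
      (∀ {α rest} → Split αs α rest → Covers P (poly α) (prod rest ▸ C)) → Covers P (prod αs) C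
    covers-prod [] S C∈P covs = covers-1
    covers-prod (α ∷ αs) {C} S C∈P covs = covers-⊗ (poly α) (prod αs) S C∈P (covs here)
      (covers-prod αs S (▸-closed S (poly α) C∈P) λ {β} {rest} s →
        covers-resp {γ = poly β} (▸-comm (poly α) (prod rest) C) (covs (there s)))

    Vanishes : (U → Set ℓ) → Expr n → ℕ → Set (c ⊔ ℓ)
    Vanishes P γ e = ∀ {d u} → P u → Supp d u → e ℕ.≤ d → γ ▸ u ≗ 𝟘 → u ≗ 𝟘

    -- `prod αs ▸ u` is killed by α and still has degree at least m + deg α, so it is zero; the
    -- argument then continues with the shorter product.
    vanishes-prod : ∀ {P} m αs → Submodule P → All (λ α → Vanishes P (poly α) (m ℕ.+ deg α)) αs →
      Vanishes P (prod αs) (m ℕ.+ tot αs)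
    vanishes-prod m [] S [] u∈P s e z a = trans (sym (*-identityˡ _)) (z a)
    vanishes-prod {P} m (α ∷ αs) S (van ∷ vans) {d} {u} u∈P s e z =
      vanishes-prod m αs S vans u∈P s (ℕ.≤-trans (ℕ.+-monoʳ-≤ m (ℕ.m≤n+m (tot αs) (deg α))) e)
        (van (▸-closed S (prod αs) u∈P) (deg-lower {p = prod αs} (prod-deg αs) s′) e′ z)
      where
      tot≤d : tot αs ℕ.≤ d
      tot≤d = ℕ.≤-trans (ℕ.m≤n+m (tot αs) (m ℕ.+ deg α)) (ℕ.≤-trans (ℕ.≤-reflexive (ℕ.+-assoc m (deg α) (tot αs))) e)
      s′ : Supp (d ℕ.∸ tot αs ℕ.+ tot αs) u
      s′ = ≡.subst (λ k → Supp k u) (≡.sym (ℕ.m∸n+n≡m tot≤d)) s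
      e′ : m ℕ.+ deg α ℕ.≤ d ℕ.∸ tot αs
      e′ = ℕ.m+n≤o⇒m≤o∸n (m ℕ.+ deg α) (ℕ.≤-trans (ℕ.≤-reflexive (ℕ.+-assoc m (deg α) (tot αs))) e)

    -- P behaves like the inverse system of a graded Gorenstein algebra with socle
    -- degree c′ - 1.
    record Good (P : U → Set ℓ) (c′ : ℕ) : Set (c ⊔ ℓ) where
      field
        vanish : ∀ {d u} → P u → Supp d u → c′ ℕ.≤ d → u ≗ 𝟘
        cyclic : ∀ {e D} → P D → suc e ≡ c′ → Supp e D → IntFn D → ¬ D ≗ 𝟘 → ∀ u → P u → u ∈⟨ D ⟩

    open Good

    good-⊆ : ∀ {P Q c′} → (∀ {u} → P u → Q u) → Good Q c′ → Good P c′
    vanish (good-⊆ sub g) u∈P = vanish g (sub u∈P)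
    cyclic (good-⊆ sub g) D∈P e s i nz u u∈P = cyclic g (sub D∈P) e s i nz u (sub u∈P)

    good-vanishes : ∀ {P α m} → Good (P ∩ker α) m → Vanishes P α m
    good-vanishes g u∈P s e z = vanish g (u∈P , z) s e

    -- The contrapositive of `vanishes-prod`: in degrees this high every factor acts injectively.
    -- Thus a socle generator is seen to survive by counting degrees, without computing any of its
    -- values.
    prod-nonzero : ∀ {P m e D} βs → Submodule P → All (λ α → Good (P ∩ker poly α) (m ℕ.+ deg α)) βs →
      P D → Supp e D → m ℕ.+ tot βs ℕ.≤ e → ¬ D ≗ 𝟘 → ¬ prod βs ▸ D ≗ 𝟘
    prod-nonzero {P} {m} βs S goods D∈P s e nz z =
      nz (vanishes-prod m βs S (All.map (λ {α} → good-vanishes {P} {poly α} {m ℕ.+ deg α}) goods) D∈P s e z)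

    prod-supp : ∀ {e D} βs → Supp (e ℕ.+ tot βs) D → Supp e (prod βs ▸ D)
    prod-supp βs = deg-lower {p = prod βs} (prod-deg βs)

    -- For a factor α, the element `prod rest ▸ D` lies in the kernel of α because the whole product
    -- kills D; it has the socle degree of that kernel, and it is nonzero by `prod-nonzero`. So it
    -- generates the kernel, and `covers-prod` assembles these kernels.
    node : ∀ {P} m αs → Submodule P → (∀ {u} → P u → prod αs ▸ u ≗ 𝟘) →
      All (λ α → Good (P ∩ker poly α) (m ℕ.+ deg α)) αs → Good P (m ℕ.+ tot αs)
    vanish (node {P} m αs S kills goods) u∈P s e =
      vanishes-prod m αs S (All.map (λ {α} → good-vanishes {P} {poly α} {m ℕ.+ deg α}) goods) u∈P s e (kills u∈P)
    cyclic (node {P} m αs S kills goods) {e} {D} D∈P 1+e s i nz u u∈P =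
      covers-prod αs S D∈P cover u u∈P (kills u∈P)
      where
      cover : ∀ {α rest} → Split αs α rest → Covers P (poly α) (prod rest ▸ D)
      cover {α} {rest} sp v v∈P αv with all-split sp goods
      ... | good , goods′ = cyclic good
            (▸-closed S (prod rest) D∈P , λ a → trans (sym (at (prod-split sp) D a)) (kills D∈P a))
            (≡.trans (ℕ.+-comm 1 e′) e′+1) (prod-supp rest (≡.subst (λ k → Supp k D) e≡ s))
            (prod-integral rest i)
            (prod-nonzero rest S goods′ D∈P s
              (≡.subst (m ℕ.+ tot rest ℕ.≤_) (≡.sym e≡) (ℕ.+-monoˡ-≤ (tot rest) m≤e′)) nz)
            v (v∈P , αv)
        where
        -- The socle degree of the kernel of α. As deg α is positive the truncated subtraction is
        -- exact, and m ≤ e′ supplies the degree bound of `prod-nonzero`.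
        e′ : ℕ
        e′ = m ℕ.+ deg α ℕ.∸ 1
        1≤ : 1 ℕ.≤ m ℕ.+ deg α
        1≤ = ℕ.≤-trans (positive α) (ℕ.m≤n+m (deg α) m)
        e′+1 : e′ ℕ.+ 1 ≡ m ℕ.+ deg α
        e′+1 = ℕ.m∸n+n≡m 1≤
        m≤e′ : m ℕ.≤ e′
        m≤e′ = ℕ.m+n≤o⇒m≤o∸n m (ℕ.+-monoʳ-≤ m (positive α))
        e≡ : e ≡ e′ ℕ.+ tot rest
        e≡ = ℕ.suc-injective (≡.trans 1+e (≡.trans (≡.cong (m ℕ.+_) (tot-split sp))
          (≡.trans (≡.sym (ℕ.+-assoc m (deg α) (tot rest))) (≡.cong (ℕ._+ tot rest)
            (≡.trans (≡.sym e′+1) (ℕ.+-comm e′ 1))))))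

    -- When all variables act by zero only the value at the origin is left, so the module is at most
    -- one-dimensional.
    leaf : ∀ {P} → (∀ {u} → P u → ∀ i → var i ▸ u ≗ 𝟘) → Good P 1
    leaf {P} kills = record
      { vanish = λ {d} u∈P s 1≤d a → vanishing u∈P s 1≤d a
      ; cyclic = λ {e} {D} D∈P 1+e s i nz u u∈P → generates D∈P i nz u u∈P
      }
      where
      origin : Vec ℕ n
      origin = Vec.replicate n 0

      raised : ∀ {m} (a : Vec ℕ m) → a ≡ Vec.replicate m 0 ⊎ ∃₂ λ b i → a ≡ b [ i ]%= suc
      raised [] = inj₁ ≡.refl
      raised (suc k ∷ a) = inj₂ (k ∷ a , zero , ≡.refl)
      raised (zero ∷ a) with raised a
      ... | inj₁ e = inj₁ (≡.cong (0 ∷_) e)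
      ... | inj₂ (b , i , e) = inj₂ (0 ∷ b , suc i , ≡.cong (0 ∷_) e)

      sum-origin : ∀ m → Vec.sum (Vec.replicate m 0) ≡ 0
      sum-origin zero    = ≡.refl
      sum-origin (suc m) = sum-origin m

      vanishing : ∀ {d u} → P u → Supp d u → 1 ℕ.≤ d → u ≗ 𝟘
      vanishing u∈P s 1≤d a with raised a
      ... | inj₁ ≡.refl = s _ (λ e → ℕ.1+n≰n (≡.subst (1 ℕ.≤_) (≡.trans (≡.sym e) (sum-origin n)) 1≤d))
      ... | inj₂ (b , i , ≡.refl) = kills u∈P i b

      generates : ∀ {D} → P D → IntFn D → ¬ D ≗ 𝟘 → ∀ u → P u → u ∈⟨ D ⟩
      generates {D} D∈P i nz u u∈P = con (u origin * proj₁ inv) , multiple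
        where
        -- The one place where a value of a generator is inverted; integrality is carried through
        -- the induction for its sake.
        inv : Unit (D origin)
        inv = int-unit (i origin) λ z → nz λ a → case a z
          where
          case : ∀ a → D origin ≈ 0# → D a ≈ 0#
          case a z with raised a
          ... | inj₁ ≡.refl = z
          ... | inj₂ (b , i , ≡.refl) = kills D∈P i b
        multiple : ∀ a → u a ≈ u origin * proj₁ inv * D a
        multiple a with raised a
        ... | inj₁ ≡.refl = sym (trans (*-assoc _ _ _) (trans (*-congˡ (proj₂ inv)) (*-identityʳ _)))
        ... | inj₂ (b , i , ≡.refl) = trans (kills u∈P i b) (sym (trans (*-congˡ (kills D∈P i b)) (zeroʳ _)))

  -- Splitting lists and replacing entries.

  split-append : ∀ {a} {A : Set a} (xs {ys} : List A) {x rest} → Split (xs ++ ys) x rest →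
    (∃ λ xs′ → Split xs x xs′) ⊎ (∃ λ ys′ → Split ys x ys′)
  split-append [] s = inj₂ (_ , s)
  split-append (x ∷ xs) here = inj₁ (_ , here)
  split-append (x ∷ xs) (there s) with split-append xs s
  ... | inj₁ (_ , t) = inj₁ (_ , there t)
  ... | inj₂ t = inj₂ t

  split-replicate : ∀ {a} {A : Set a} k {x y : A} {rest} → Split (replicate k x) y rest → y ≡ x
  split-replicate (suc k) here = ≡.refl
  split-replicate (suc k) (there s) = split-replicate k s

  split-map : ∀ {a b} {A : Set a} {B : Set b} (f : A → B) xs {y rest} → Split (map f xs) y rest →
    ∃₂ λ x xs′ → Split xs x xs′ × y ≡ f x × rest ≡ map f xs′
  split-map f (x ∷ xs) here = _ , _ , here , ≡.refl , ≡.refl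
  split-map f (x ∷ xs) (there s) with split-map f xs s
  ... | _ , _ , t , e , e′ = _ , _ , there t , e , ≡.cong (_ ∷_) e′

  map-split : ∀ {a b} {A : Set a} {B : Set b} (f : A → B) {xs x rest} → Split xs x rest →
    Split (map f xs) (f x) (map f rest)
  map-split f here = here
  map-split f (there s) = there (map-split f s)

  split-++ˡ : ∀ {a} {A : Set a} {xs : List A} {x rest} → Split xs x rest → ∀ ys → Split (xs ++ ys) x (rest ++ ys)
  split-++ˡ here ys = here
  split-++ˡ (there s) ys = there (split-++ˡ s ys)

  split-++ʳ : ∀ {a} {A : Set a} xs {ys : List A} {x rest} → Split ys x rest → Split (xs ++ ys) x (xs ++ rest)
  split-++ʳ [] s = s
  split-++ʳ (x ∷ xs) s = there (split-++ʳ xs s)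

  replaced : ∀ {a} {A : Set a} {xs : List A} {x rest} → Split xs x rest → A → List A
  replaced (here {xs = xs}) y = y ∷ xs
  replaced (there {z} s) y = z ∷ replaced s y

  replaced-++ˡ : ∀ {a} {A : Set a} {xs : List A} {x rest} (s : Split xs x rest) ys y →
    replaced (split-++ˡ s ys) y ≡ replaced s y ++ ys
  replaced-++ˡ here ys y = ≡.refl
  replaced-++ˡ (there s) ys y = ≡.cong (_ ∷_) (replaced-++ˡ s ys y)

  map-replaced : ∀ {a b} {A : Set a} {B : Set b} (f : A → B) {xs : List A} {x rest} (s : Split xs x rest) {y} →
    f y ≡ f x → map f (replaced s y) ≡ map f xs
  map-replaced f (here {xs = xs}) e = ≡.cong (_∷ map f xs) e
  map-replaced f (there s) e = ≡.cong (_ ∷_) (map-replaced f s e)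

  length-replaced : ∀ {a} {A : Set a} {xs : List A} {x rest} (s : Split xs x rest) y →
    length (replaced s y) ≡ length xs
  length-replaced here y = ≡.refl
  length-replaced (there s) y = ≡.cong suc (length-replaced s y)

  all-replaced : ∀ {a p} {A : Set a} {P : A → Set p} {xs : List A} {x rest} (s : Split xs x rest) {y} →
    (P y → P x) → All P (replaced s y) → All P xs
  all-replaced here h (p ∷ ps) = h p ∷ ps
  all-replaced (there s) h (p ∷ ps) = p ∷ all-replaced s h ps

  all-unsplit : ∀ {a p} {A : Set a} {P : A → Set p} {xs : List A} {x rest} → Split xs x rest → All P (x ∷ rest) → All
      P xs
  all-unsplit here ps = ps
  all-unsplit (there s) (p ∷ q ∷ ps) = q ∷ all-unsplit s (p ∷ ps)

  all-from-splits : ∀ {a p} {A : Set a} {P : A → Set p} (xs : List A) →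
    (∀ {x rest} → Split xs x rest → P x) → All P xs
  all-from-splits [] h = []
  all-from-splits (x ∷ xs) h = h here ∷ all-from-splits xs (λ s → h (there s))

  -- Weighted power sums and elimination of variables.

  module Elimination {n : ℕ} (r′ : ℕ) where
    open Core {n}
    open Factor
    open Submodule
    open Good
    private module S = NaturalCoefficients A.commutativeSemiring

    r : ℕ
    r = suc r′

    Y : Fin n → Expr n
    Y i = var i ^ᴬ r

    variable-factor : Fin n → Factor
    variable-factor i = record
      { poly = var i ; deg = 1 ; hasDeg = deg-var i ; integral = λ j a → j _ ; positive = ℕ.≤-refl }

    Y-integral : ∀ i → Integral (Y i)
    Y-integral i = integral-^ {p = var i} (λ j a → j _) r

    difference-factor : Fin n → Fin n → Factor
    difference-factor i l = record
      { poly = Y i ⊟ Y l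
      ; deg = r
      ; hasDeg = deg-⊟ {p = Y i} {Y l} (deg-^ {var i} (deg-var i) r) (deg-^ {var l} (deg-var l) r)
      ; integral = integral-⊟ {p = Y i} {Y l} (Y-integral i) (Y-integral l)
      ; positive = ℕ.s≤s ℕ.z≤n
      }

    differences : Fin n → List (Fin n) → Expr n
    differences i []      = con 1#
    differences i (l ∷ N) = (Y i ⊟ Y l) ⊗ differences i N

    Weighted : Set
    Weighted = List (Fin n × ℕ)

    indices : Weighted → List (Fin n)
    indices = map proj₁

    -- An entry (i , w) has weight w + 1.
    powerSum : ℕ → Weighted → Expr n
    powerSum k []            = con 0#
    powerSum k ((i , w) ∷ L) = con (suc w ×′ 1#) ⊗ Y i ^ᴬ k ⊕ powerSum k L

    -- The weighted sum of p(Yᵢ) over the entries of the list, for p(t) = t^k ∏ (t - Yₗ) with l in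
    -- N. The power sums are the case p(t) = t^k.
    weightedSum : ℕ → List (Fin n) → Weighted → Expr n
    weightedSum k N []            = con 0#
    weightedSum k N ((i , w) ∷ L) = con (suc w ×′ 1#) ⊗ (Y i ^ᴬ k ⊗ differences i N) ⊕ weightedSum k N L

    powerSum-split : ∀ k {L x rest} → Split L x rest → powerSum k L ≋ powerSum k (x ∷ rest)
    powerSum-split k here = A.refl
    powerSum-split k (there {i , w} {rest} {j , v} s) = A.trans
      (A.+-congˡ {con (suc w ×′ 1#) ⊗ Y i ^ᴬ k} (powerSum-split k s))
      (S.solve 3 (λ a b c → a S.:+ (b S.:+ c) S.:= b S.:+ (a S.:+ c)) A.refl
        (con (suc w ×′ 1#) ⊗ Y i ^ᴬ k) (con (suc v ×′ 1#) ⊗ Y j ^ᴬ k) (powerSum k rest))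

    weightedSum-[] : ∀ k L → weightedSum k [] L ≋ powerSum k L
    weightedSum-[] k [] = A.refl
    weightedSum-[] k ((i , w) ∷ L) = A.+-cong (A.*-congˡ {con (suc w ×′ 1#)} (A.*-identityʳ (Y i ^ᴬ k)))
        (weightedSum-[] k L)

    weightedSum-∷ : ∀ k l N L →
      weightedSum k (l ∷ N) L ≋ weightedSum (suc k) N L ⊟ Y l ⊗ weightedSum k N L
    weightedSum-∷ k l N [] = S.solve 2 (λ m y → S.con 0 S.:= S.con 0 S.:+ m S.:* (y S.:* S.con 0)) A.refl -1ᴬ (Y l)
    weightedSum-∷ k l N ((i , w) ∷ L) = A.trans
      (A.+-congˡ {con (suc w ×′ 1#) ⊗ (Y i ^ᴬ k ⊗ differences i (l ∷ N))} (weightedSum-∷ k l N L))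
      (S.solve 8 (λ c yk y m yl δ a b →
         c S.:* (yk S.:* ((y S.:+ m S.:* yl) S.:* δ)) S.:+ (a S.:+ m S.:* (yl S.:* b)) S.:=
         (c S.:* ((y S.:* yk) S.:* δ) S.:+ a) S.:+ m S.:* (yl S.:* (c S.:* (yk S.:* δ) S.:+ b))) A.refl
        (con (suc w ×′ 1#)) (Y i ^ᴬ k) (Y i) -1ᴬ (Y l) (differences i N) (weightedSum (suc k) N L) (weightedSum k N L))

    ⊟-self : ∀ p → p ⊟ p ≋ con 0#
    ⊟-self p = equal λ u a → trans (+-congˡ (-1*x≈-x _)) (trans (-‿inverseʳ _) (sym (zeroˡ _)))

    differences-∈ : ∀ {i N} → i ∈ N → differences i N ≋ con 0#
    differences-∈ {i} {_ ∷ N} (here ≡.refl) = A.trans (A.*-congʳ {differences i N} (⊟-self (Y i)))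
        (A.zeroˡ (differences i N))
    differences-∈ {i} {l ∷ N} (there p) = A.trans (A.*-congˡ {Y i ⊟ Y l} (differences-∈ p)) (A.zeroʳ (Y i ⊟ Y l))

    weightedSum-∈ : ∀ k N L → All (λ (i , w) → i ∈ N) L → weightedSum k N L ≋ con 0#
    weightedSum-∈ k N [] [] = A.refl
    weightedSum-∈ k N ((i , w) ∷ L) (p ∷ ps) = A.trans (A.+-cong
      (A.trans (A.*-congˡ {con (suc w ×′ 1#)} (A.trans (A.*-congˡ {Y i ^ᴬ k} (differences-∈ p)) (A.zeroʳ (Y i ^ᴬ k))))
        (A.zeroʳ (con (suc w ×′ 1#)))) (weightedSum-∈ k N L ps)) (A.+-identityˡ (con 0#))

    Killed : Weighted → U → Set ℓ
    Killed L u = ∀ k → powerSum (suc k) L ▸ u ≗ 𝟘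

    con0-kills : ∀ {p u} → p ≋ con 0# → p ▸ u ≗ 𝟘
    con0-kills {u = u} e a = trans (at e u a) (zeroˡ _)

    -- Expanding the product over N produces only powers with exponent at least k + 1. Keeping the
    -- exponents positive is what puts the extra factor Yⱼ into the eliminant.
    weightedSum-kills : ∀ {L u} → Killed L u → ∀ N k → weightedSum (suc k) N L ▸ u ≗ 𝟘
    weightedSum-kills {L} {u} h [] k a = trans (at (weightedSum-[] (suc k) L) u a) (h k a)
    weightedSum-kills {L} {u} h (l ∷ N) k a = trans (at (weightedSum-∷ (suc k) l N L) u a)
      (trans (+-cong (weightedSum-kills {L} {u} h N (suc k) a)
        (trans (*-congˡ (▸-zero (Y l) (weightedSum-kills {L} {u} h N k) a)) (zeroʳ _))) (+-identityˡ 0#))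

    -- In Σ wᵢ Yᵢ N(Yᵢ) = 0, with N(t) = ∏ (t - Yₗ) over the indices l ≠ j, only the
    -- j-th term survives.
    eliminant : ∀ {L j w rest u} → Killed L u → Split L (j , w) rest →
      (Y j ⊗ differences j (indices rest)) ▸ u ≗ 𝟘
    -- The surviving term carries the weight w + 1, a unit because it is positive.
    eliminant {L} {j} {w} {rest} {u} h s a = unit-cancel (unit-suc w) (trans
      (sym (trans (at (A.+-cong (A.*-congˡ {con (suc w ×′ 1#)} (A.*-congʳ {differences j N} (A.*-identityʳ (Y j))))
             (weightedSum-∈ 1 N rest (All.map⁻ (All.tabulate λ p → p)))) u a)
           (trans (+-congˡ (zeroˡ _)) (+-identityʳ _))))
      (weightedSum-kills {(j , w) ∷ rest} {u} (λ k b → trans (sym (at (powerSum-split (suc k) s) u b)) (h k b)) N 0 a))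
      where
      N : List (Fin n)
      N = indices rest

    Y-zero : ∀ i {u} → var i ▸ u ≗ 𝟘 → Y i ▸ u ≗ 𝟘
    Y-zero i {u} z a = trans (▸-comm (var i) (var i ^ᴬ r′) u a) (▸-zero (var i ^ᴬ r′) z a)

    Y^-zero : ∀ i k {u} → Y i ▸ u ≗ 𝟘 → Y i ^ᴬ suc k ▸ u ≗ 𝟘
    Y^-zero i k {u} z a = trans (▸-comm (Y i) (Y i ^ᴬ k) u a) (▸-zero (Y i ^ᴬ k) z a)

    Y^-cong : ∀ i j k {u} → Y i ▸ u ≗ Y j ▸ u → Y i ^ᴬ k ▸ u ≗ Y j ^ᴬ k ▸ u
    Y^-cong i j zero e a = refl
    Y^-cong i j (suc k) {u} e a = trans (▸-cong (Y i) (Y^-cong i j k e) a) (trans (▸-comm (Y i) (Y j ^ᴬ k) u a)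
      (trans (▸-cong (Y j ^ᴬ k) e a) (▸-comm (Y j ^ᴬ k) (Y j) u a)))

    AllZero : Weighted → U → Set ℓ
    AllZero L u = All (λ (i , w) → var i ▸ u ≗ 𝟘) L

    _∩zero_ : (U → Set ℓ) → Weighted → U → Set ℓ
    (P ∩zero L) u = P u × AllZero L u

    ∩zero-submodule : ∀ {P} L → Submodule P → Submodule (P ∩zero L)
    resp (∩zero-submodule L S) e (p , z) = resp S e p , All.map (λ h a → trans (sym (e _)) (h a)) z
    ⊞-closed (∩zero-submodule L S) (p , y) (q , z) = ⊞-closed S p q ,
      All.zipWith (λ (h , k) a → trans (+-cong (h a) (k a)) (+-identityˡ 0#)) (y , z)
    ▸-closed (∩zero-submodule L S) p (q , z) = ▸-closed S p q ,
      All.map (λ {(i , w)} h a → trans (▸-comm (var i) p _ a) (▸-zero p h a)) z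

    -- The weighted power sums over the indices L kill P; d₀ is the socle degree left
    -- once all of these variables are killed.
    record State (P : U → Set ℓ) (L : Weighted) (d₀ : ℕ) : Set (c ⊔ ℓ) where
      field
        submodule : Submodule P
        killed    : ∀ {u} → P u → Killed L u
        residue   : Good (P ∩zero L) (suc d₀)

    open State

    state-split : ∀ {P L d₀ x rest} → Split L x rest → State P L d₀ → State P (x ∷ rest) d₀
    submodule (state-split s st) = submodule st
    killed (state-split s st) {u} u∈P k a = trans (sym (at (powerSum-split (suc k) s) u a)) (killed st u∈P k a)
    residue (state-split s st) = good-⊆ (λ (p , z) → p , all-unsplit s z) (residue st)

    -- Where xⱼ vanishes the index j may be forgotten; where Yⱼ = Yₗ its weight may be
    -- added to that of l.
    delete : ∀ {P L d₀ j w} → State P ((j , w) ∷ L) d₀ → State (P ∩ker var j) L d₀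
    submodule (delete {j = j} st) = ∩ker-submodule (var j) (submodule st)
    killed (delete {L = L} {j = j} {w} st) {u} (u∈P , z) k a = trans (sym (trans (+-congʳ
      (trans (*-congˡ (Y^-zero j k (Y-zero j z) a)) (zeroʳ _))) (+-identityˡ _))) (killed st u∈P k a)
    residue (delete st) = good-⊆ (λ ((p , z) , zs) → p , (λ a → z a) ∷ zs) (residue st)

    heavier : ∀ {L : Weighted} {l v rest} → Split L (l , v) rest → ℕ → Weighted
    heavier {l = l} {v} s w = replaced s (l , v ℕ.+ suc w)

    powerSum-heavier : ∀ k {L l v rest} (s : Split L (l , v) rest) w →
      powerSum k (heavier s w) ≋ con (suc w ×′ 1#) ⊗ Y l ^ᴬ k ⊕ powerSum k L
    powerSum-heavier k {l = l} {v} {rest} here w = A.trans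
      (A.+-congʳ {powerSum k rest} (A.*-congʳ {Y l ^ᴬ k} weights))
      (S.solve 4 (λ x y a b → ((x S.:+ y) S.:* a) S.:+ b S.:= y S.:* a S.:+ (x S.:* a S.:+ b)) A.refl
        (con (suc v ×′ 1#)) (con (suc w ×′ 1#)) (Y l ^ᴬ k) (powerSum k rest))
      where
      weights : con (suc (v ℕ.+ suc w) ×′ 1#) ≋ con (suc v ×′ 1#) ⊕ con (suc w ×′ 1#)
      weights = equal λ u a → trans (*-congʳ (Mult.×-homo-+ 1# (suc v) (suc w))) (distribʳ _ _ _)
    powerSum-heavier k {l = l} (there {i , v} {xs = xs} s) w = A.trans
      (A.+-congˡ {con (suc v ×′ 1#) ⊗ Y i ^ᴬ k} (powerSum-heavier k s w))
      (S.solve 3 (λ a b c → a S.:+ (b S.:+ c) S.:= b S.:+ (a S.:+ c)) A.refl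
        (con (suc v ×′ 1#) ⊗ Y i ^ᴬ k) (con (suc w ×′ 1#) ⊗ Y l ^ᴬ k) (powerSum k xs))

    tot-replicate : ∀ j k → tot (replicate k (variable-factor j)) ≡ k
    tot-replicate j zero    = ≡.refl
    tot-replicate j (suc k) = ≡.cong suc (tot-replicate j k)

    prod-replicate : ∀ j k → prod (replicate k (variable-factor j)) ≡ var j ^ᴬ k
    prod-replicate j zero    = ≡.refl
    prod-replicate j (suc k) = ≡.cong (var j ⊗_) (prod-replicate j k)

    merge : ∀ {P L d₀ j w l v rest} (s : Split L (l , v) rest) → State P ((j , w) ∷ L) d₀ →
      State (P ∩ker (Y j ⊟ Y l)) (heavier s w) (d₀ ℕ.+ r′)
    submodule (merge {j = j} {l = l} s st) = ∩ker-submodule (Y j ⊟ Y l) (submodule st)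
    killed (merge {L = L} {j = j} {w} {l} s st) {u} (u∈P , z) k a = trans (at (powerSum-heavier (suc k) s w) u a)
      (trans (+-congʳ (*-congˡ (sym (Y^-cong j l (suc k) (⊟-kills⁻¹ (Y j) (Y l) z) a)))) (killed st u∈P k a))
    -- Where the variables of the merged list vanish, xⱼ^r = Yⱼ = Yₗ = 0, so xⱼ survives as a
    -- nilpotent variable. A `node` with r copies of xⱼ therefore raises the residual socle degree
    -- by r - 1.
    residue (merge {P} {L} {d₀} {j} {w} {l} s st) = ≡.subst (Good Q)
      (≡.trans (≡.cong (d₀ ℕ.+_) (tot-replicate j r)) (ℕ.+-suc d₀ r′))
      (node d₀ (replicate r (variable-factor j)) Q-submodule
        (λ {u} ((u∈P , z) , zs) a → trans (reflexive (≡.cong (λ p → (p ▸ u) a) (prod-replicate j r)))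
          (trans (⊟-kills⁻¹ (Y j) (Y l) z a) (Y-zero l (proj₁ (all-split s (all-replaced s (λ h → h) zs))) a)))
        (All.replicate⁺ r (≡.subst (Good (Q ∩ker var j)) (ℕ.+-comm 1 d₀)
          (good-⊆ (λ (((u∈P , z) , zs) , zj) → u∈P , (λ a → zj a) ∷ all-replaced s (λ h → h) zs) (residue st)))))
      where
      Q : U → Set ℓ
      Q = (P ∩ker (Y j ⊟ Y l)) ∩zero heavier s w
      Q-submodule : Submodule Q
      Q-submodule = ∩zero-submodule (heavier s w) (∩ker-submodule (Y j ⊟ Y l) (submodule st))

    -- The sum of r s - 1 over 1 ≤ s ≤ m.
    socle : ℕ → ℕ
    socle zero    = 0
    socle (suc m) = socle m ℕ.+ (r′ ℕ.+ r ℕ.* m)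

    Solved : ℕ → Set _
    Solved m = ∀ {P L d₀} → length L ≡ m → State P L d₀ → Good P (suc d₀ ℕ.+ socle m)

    delete-good : ∀ {m} → Solved m → ∀ {P L d₀ j w} → length L ≡ m → State P ((j , w) ∷ L) d₀ →
      Good (P ∩ker var j) (d₀ ℕ.+ socle m ℕ.+ 1)
    delete-good {m} ih {d₀ = d₀} e st = ≡.subst (Good _) (ℕ.+-comm 1 (d₀ ℕ.+ socle m)) (ih e (delete st))

    merge-good : ∀ {m} → Solved m → ∀ {P L d₀ j w l v rest} → length L ≡ m → Split L (l , v) rest →
      State P ((j , w) ∷ L) d₀ → Good (P ∩ker (Y j ⊟ Y l)) (d₀ ℕ.+ socle m ℕ.+ r)
    merge-good {m} ih {d₀ = d₀} e s st = ≡.subst (Good _) (arith d₀ r′ (socle m))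
      (ih (≡.trans (length-replaced s _) e) (merge s st))
      where
      arith : ∀ a b x → suc (a ℕ.+ b) ℕ.+ x ≡ a ℕ.+ x ℕ.+ suc b
      arith = solve-∀

    differences-factors : Fin n → Weighted → List Factor
    differences-factors j = map (λ x → difference-factor j (proj₁ x))

    tot-differences : ∀ j L → tot (differences-factors j L) ≡ r ℕ.* length L
    tot-differences j []      = ≡.sym (ℕ.*-zeroʳ r)
    tot-differences j (x ∷ L) = ≡.trans (≡.cong (r ℕ.+_) (tot-differences j L)) (≡.sym (ℕ.*-suc r (length L)))

    prod-differences : ∀ j L → prod (differences-factors j L) ≡ differences j (indices L)
    prod-differences j []      = ≡.refl
    prod-differences j (x ∷ L) = ≡.cong (_ ⊗_) (prod-differences j L)

    prod-factors : ∀ j k L → prod (replicate k (variable-factor j) ++ differences-factors j L) ≋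
      var j ^ᴬ k ⊗ differences j (indices L)
    prod-factors j k L = A.trans (prod-++ (replicate k (variable-factor j)) (differences-factors j L))
      (A.reflexive (≡.cong₂ _⊗_ (prod-replicate j k) (prod-differences j L)))

    -- The eliminant of the first index has r factors xⱼ and m differences, and on the kernel of
    -- each only m indices are left. For both kinds the bound exceeds the degree of the factor by
    -- the same constant d₀ + socle m: merging raises the residue by r - 1, just as its factor has
    -- degree r instead of 1. So `node` applies.
    solved : ∀ m → Solved m
    solved zero {L = []} {d₀} e st = ≡.subst (Good _) (≡.sym (ℕ.+-identityʳ (suc d₀)))
      (good-⊆ (λ p → p , []) (residue st))
    solved (suc m) {P} {(j , w) ∷ L} {d₀} e st = ≡.subst (Good P)
      (≡.trans (≡.cong (d₀ ℕ.+ socle m ℕ.+_) (≡.trans (tot-++ (replicate r (variable-factor j)) _)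
        (≡.cong₂ ℕ._+_ (tot-replicate j r) (≡.trans (tot-differences j L) (≡.cong (r ℕ.*_) e′)))))
        (arith d₀ (socle m) r′ (r ℕ.* m)))
      (node (d₀ ℕ.+ socle m) (replicate r (variable-factor j) ++ differences-factors j L) (submodule st)
        (λ {u} u∈P a → trans (at (prod-factors j r L) u a)
            (eliminant {(j , w) ∷ L} {j} {w} {L} {u} (killed st u∈P) here a))
        (All.++⁺ (All.replicate⁺ r (delete-good (solved m) e′ st))
          (All.map⁺ (all-from-splits L λ s → merge-good (solved m) e′ s st))))
      where
      e′ : length L ≡ m
      e′ = ℕ.suc-injective e
      arith : ∀ a b x y → a ℕ.+ b ℕ.+ (suc x ℕ.+ y) ≡ suc a ℕ.+ (b ℕ.+ (x ℕ.+ y))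
      arith = solve-∀

  -- Additional annihilators Fⱼ for the indices j in J.

  module Flags {n : ℕ} (r′ : ℕ) where
    open Core {n}
    open Elimination {n} r′
    open Factor
    open Submodule
    open Good
    open State
    private module S = NaturalCoefficients A.commutativeSemiring

    Flagged : Set
    Flagged = List (Fin n × Bool)

    unflag : Flagged → Weighted
    unflag = map λ (j , b) → j , 0

    -- This is Fⱼ when N lists the indices before j outside J. Likewise `cofactor` is the factor at
    -- j of f_J when its list consists of all indices after j.
    numerator : Fin n → List (Fin n) → Expr n
    numerator j N = var j ^ᴬ r′ ⊗ differences j N

    cofactor : Fin n → List (Fin n) → Expr n
    cofactor j N = var j ⊗ differences j N

    -- N collects the unflagged indices passed so far, which are the ones that enter the numerators
    -- of later flagged indices; flagged indices are dropped.
    Annihilated : List (Fin n) → Flagged → U → Set ℓ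
    Annihilated N []                u = ⊤
    Annihilated N ((j , false) ∷ L) u = Annihilated (N ++ j ∷ []) L u
    Annihilated N ((j , true) ∷ L)  u = (numerator j N ▸ u ≗ 𝟘) × Annihilated N L u

    generator : Flagged → Expr n
    generator []                = con 1#
    generator ((j , false) ∷ L) = generator L
    generator ((j , true) ∷ L)  = generator L ⊗ cofactor j (map proj₁ L)

    differences-++ : ∀ j N N′ → differences j (N ++ N′) ≋ differences j N ⊗ differences j N′
    differences-++ j []      N′ = A.sym (A.*-identityˡ (differences j N′))
    differences-++ j (l ∷ N) N′ = A.trans (A.*-congˡ {Y j ⊟ Y l} (differences-++ j N N′))
      (A.sym (A.*-assoc (Y j ⊟ Y l) (differences j N) (differences j N′)))

    differences-split : ∀ j {N l rest} → Split N l rest → differences j N ≋ (Y j ⊟ Y l) ⊗ differences j rest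
    differences-split j here = A.refl
    differences-split j (there {i} {rest} {l} s) = A.trans (A.*-congˡ {Y j ⊟ Y i} (differences-split j s))
      (S.solve 3 (λ a b c → a S.:* (b S.:* c) S.:= b S.:* (a S.:* c)) A.refl (Y j ⊟ Y i) (Y j ⊟ Y l)
          (differences j rest))

    numerator-cofactor : ∀ j N N′ → numerator j N ⊗ cofactor j N′ ≋ Y j ⊗ differences j (N ++ N′)
    numerator-cofactor j N N′ = A.trans
      (S.solve 4 (λ x xr a b → (xr S.:* a) S.:* (x S.:* b) S.:= (x S.:* xr) S.:* (a S.:* b)) A.refl
        (var j) (var j ^ᴬ r′) (differences j N) (differences j N′))
      (A.*-congˡ {Y j} (A.sym (differences-++ j N N′)))

    annihilated-resp : ∀ N L {u v} → u ≗ v → Annihilated N L u → Annihilated N L v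
    annihilated-resp N [] e ann = tt
    annihilated-resp N ((j , false) ∷ L) e ann = annihilated-resp (N ++ j ∷ []) L e ann
    annihilated-resp N ((j , true) ∷ L) e (z , ann) =
      (λ a → trans (sym (▸-cong (numerator j N) e a)) (z a)) , annihilated-resp N L e ann

    annihilated-⊞ : ∀ N L {u v} → Annihilated N L u → Annihilated N L v → Annihilated N L (u ⊞ v)
    annihilated-⊞ N [] _ _ = tt
    annihilated-⊞ N ((j , false) ∷ L) p q = annihilated-⊞ (N ++ j ∷ []) L p q
    annihilated-⊞ N ((j , true) ∷ L) (y , p) (z , q) =
      (λ a → trans (fn-⊞ (⟦ shift ⟧ (numerator j N)) _ _ a) (trans (+-cong (y a) (z a)) (+-identityˡ 0#))) ,
      annihilated-⊞ N L p q

    annihilated-▸ : ∀ N L p {u} → Annihilated N L u → Annihilated N L (p ▸ u)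
    annihilated-▸ N [] p _ = tt
    annihilated-▸ N ((j , false) ∷ L) p ann = annihilated-▸ (N ++ j ∷ []) L p ann
    annihilated-▸ N ((j , true) ∷ L) p {u} (z , ann) =
      (λ a → trans (▸-comm (numerator j N) p u a) (▸-zero p z a)) , annihilated-▸ N L p ann

    annihilated-submodule : ∀ {P} N L → Submodule P → Submodule (λ u → P u × Annihilated N L u)
    resp (annihilated-submodule N L S) e (p , ann) = resp S e p , annihilated-resp N L e ann
    ⊞-closed (annihilated-submodule N L S) (p , x) (q , y) = ⊞-closed S p q , annihilated-⊞ N L x y
    ▸-closed (annihilated-submodule N L S) p (q , ann) = ▸-closed S p q , annihilated-▸ N L p ann

    Eliminated : List (Fin n) → Flagged → U → Set ℓ
    Eliminated N L C = ∀ {j rest} → Split (map proj₁ L) j rest → (Y j ⊗ differences j (N ++ rest)) ▸ C ≗ 𝟘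

    -- Dropping j takes the factor Yᵢ - Yⱼ out of the eliminant of i. The cofactor of j contains Yⱼ
    -- - Yᵢ and so restores it up to sign.
    eliminated-cofactor : ∀ N j L {C} → Eliminated N ((j , true) ∷ L) C →
      Eliminated N L (cofactor j (map proj₁ L) ▸ C)
    eliminated-cofactor N j L {C} el {i} {rest} s a = trans (at identity C a)
      (trans (▸-zero (-1ᴬ ⊗ (var j ⊗ differences j rest)) (el (there s)) a) refl)
      where
      identity : (Y i ⊗ differences i (N ++ rest)) ⊗ cofactor j (map proj₁ L) ≋
        (-1ᴬ ⊗ (var j ⊗ differences j rest)) ⊗ (Y i ⊗ differences i (N ++ j ∷ rest))
      identity = A.trans
        (A.*-cong (A.*-congˡ {Y i} (differences-++ i N rest)) (A.*-congˡ {var j} (differences-split j s)))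
        (A.trans
          (A.trans (A.*-congˡ {Y i ⊗ (differences i N ⊗ differences i rest)} (A.*-congˡ {var j}
            (A.*-congʳ {differences j rest} antisymmetry)))
            (S.solve 7 (λ y a b x z m e → (y S.:* (a S.:* b)) S.:* (x S.:* ((m S.:* z) S.:* e)) S.:=
                         (m S.:* (x S.:* e)) S.:* (y S.:* (a S.:* (z S.:* b)))) A.refl
              (Y i) (differences i N) (differences i rest) (var j) (Y i ⊟ Y j) -1ᴬ (differences j rest)))
          (A.*-congˡ { -1ᴬ ⊗ (var j ⊗ differences j rest)} (A.*-congˡ {Y i} (A.sym (differences-++ i N (j ∷ rest))))))
        where
        antisymmetry : Y j ⊟ Y i ≋ -1ᴬ ⊗ (Y i ⊟ Y j)
        antisymmetry = equal λ u b → trans (+-congˡ (-1*x≈-x _))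
          (trans (+-comm _ _) (sym (trans (-1*x≈-x _) (trans (-‿cong (+-congˡ (-1*x≈-x _)))
            (trans (sym (-‿+-comm _ _)) (+-congˡ (-‿involutive _)))))))

    -- For a flagged j, numerator times cofactor is the eliminant of j among the indices still
    -- present. After the cofactor has been applied, `eliminated-cofactor` allows j to be dropped.
    annihilated-generator : ∀ N L {C} → Eliminated N L C → Annihilated N L (generator L ▸ C)
    annihilated-generator N [] el = tt
    annihilated-generator N ((j , false) ∷ L) {C} el = annihilated-generator (N ++ j ∷ []) L λ {i} {rest} s →
      ≡.subst (λ M → (Y i ⊗ differences i M) ▸ C ≗ 𝟘) (≡.sym (List.++-assoc N (j ∷ []) rest)) (el (there s))
    annihilated-generator N ((j , true) ∷ L) {C} el =
      (λ a → trans (▸-comm (numerator j N) (generator L) _ a) (▸-zero (generator L)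
        (λ b → trans (at (numerator-cofactor j N (map proj₁ L)) C b) (el here b)) a)) ,
      annihilated-generator N L (eliminated-cofactor N j L {C} el)

    state-eliminated : ∀ {P L₁ d₀ D} L → State P (L₁ ++ unflag L) d₀ → P D → Eliminated (indices L₁) L D
    state-eliminated {L₁ = L₁} {D = D} L st D∈P s with split-map proj₁ L s
    ... | (j , b) , L′ , t , ≡.refl , ≡.refl = ≡.subst (λ M → (Y j ⊗ differences j M) ▸ D ≗ 𝟘)
      (≡.trans (List.map-++ proj₁ L₁ (unflag L′)) (≡.cong (indices L₁ ++_) (≡.sym (List.map-∘ L′))))
      (eliminant {L₁ ++ unflag L} {j} {0} {L₁ ++ unflag L′} {D} (killed st D∈P)
        (split-++ʳ L₁ (map-split (λ (j , b) → j , 0) t)))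

    -- The first flagged j satisfies numerator · cofactor = Yⱼ ∏ (Yⱼ - Yₗ), the product over
    -- all other alive l.  Each factor α of its numerator leads to a state with one variable
    -- fewer, generated by the product D′ of the remaining factors applied to D; by degree D′
    -- does not vanish.
    cyclic-flagged : ∀ L {P} L₁ {d₀ D e} → State P (L₁ ++ unflag L) d₀ → P D → Supp e D →
      e ≡ d₀ ℕ.+ socle (length L₁ ℕ.+ length L) → IntFn D → ¬ D ≗ 𝟘 →
      ∀ u → P u → Annihilated (indices L₁) L u → u ∈⟨ generator L ▸ D ⟩
    -- With no index left to examine, D generates all of P by `solved`.
    cyclic-flagged [] {P} L₁ {d₀} {D} st D∈P s e≡ i nz u u∈P ann
      with cyclic (solved (length L₁ ℕ.+ 0) (List.length-++ L₁) st) D∈P (≡.cong suc e≡) s i nz u u∈P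
    ... | h , e = h , λ a → trans (e a) (▸-cong h (λ b → sym (*-identityˡ _)) a)
    -- An unflagged index joins L₁, the alive indices to which later numerators refer.
    cyclic-flagged ((j , false) ∷ L) {P} L₁ {d₀} st D∈P s e≡ i nz u u∈P ann =
      cyclic-flagged L (L₁ ++ (j , 0) ∷ [])
        (≡.subst (λ M → State P M d₀) (≡.sym (List.++-assoc L₁ ((j , 0) ∷ []) (unflag L))) st)
        D∈P s (≡.trans e≡ (≡.cong (λ k → d₀ ℕ.+ socle k) (≡.trans (≡.sym (ℕ.+-assoc (length L₁) 1 (length L)))
          (≡.cong (ℕ._+ length L) (≡.sym (List.length-++ L₁))))))
        i nz u u∈P (≡.subst (λ M → Annihilated M L u) (≡.sym (List.map-++ proj₁ L₁ ((j , 0) ∷ []))) ann)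
    cyclic-flagged ((j , true) ∷ L) {P} L₁ {d₀} {D} {e} st D∈P s e≡ i nz u u∈P (z , ann) =
      covers-prod αs (annihilated-submodule N L (submodule st))
        (▸-closed (submodule st) (generator ((j , true) ∷ L)) D∈P ,
         proj₂ (annihilated-generator N ((j , true) ∷ L) {D} (state-eliminated {L₁ = L₁} ((j , true) ∷ L) st D∈P)))
        cover u (u∈P , ann) (λ a → trans (at (prod-factors j r′ L₁) u a) (z a))
      where
      N : List (Fin n)
      N = indices L₁
      st′ : State P ((j , 0) ∷ L₁ ++ unflag L) d₀
      st′ = state-split (split-++ʳ L₁ here) st
      m : ℕ
      m = length L₁ ℕ.+ length L
      length-m : length (L₁ ++ unflag L) ≡ m
      length-m = ≡.trans (List.length-++ L₁) (≡.cong (length L₁ ℕ.+_) (List.length-map _ L))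
      -- The factors of the numerator and of the cofactor. Together they make up the eliminant of j,
      -- of degree r + r m.
      αs βs : List Factor
      αs = replicate r′ (variable-factor j) ++ differences-factors j L₁
      βs = variable-factor j ∷ differences-factors j (unflag L)
      C : U
      C = generator ((j , true) ∷ L) ▸ D
      P̃ : U → Set ℓ
      P̃ u = P u × Annihilated N L u
      GoodFactor : Factor → Set (c ⊔ ℓ)
      GoodFactor α = Good (P ∩ker poly α) (d₀ ℕ.+ socle m ℕ.+ deg α)
      goodα : All GoodFactor αs
      goodα = All.++⁺ (All.replicate⁺ r′ (delete-good (solved m) length-m st′))
        (All.map⁺ (all-from-splits L₁ λ s → merge-good (solved m) length-m (split-++ˡ s (unflag L)) st′))
      goodβ : All GoodFactor βs
      goodβ = delete-good (solved m) length-m st′ ∷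
        All.map⁺ (all-from-splits (unflag L) λ s → merge-good (solved m) length-m (split-++ʳ L₁ s) st′)
      tot-αβ : tot αs ℕ.+ tot βs ≡ r ℕ.+ r ℕ.* m
      tot-αβ = ≡.trans (≡.cong₂ (λ x y → x ℕ.+ suc y)
          (≡.trans (tot-++ (replicate r′ (variable-factor j)) (differences-factors j L₁))
            (≡.cong₂ ℕ._+_ (tot-replicate j r′) (tot-differences j L₁)))
          (≡.trans (tot-differences j (unflag L)) (≡.cong (r ℕ.*_) (List.length-map _ L))))
        (arith r′ (length L₁) (length L))
        where
        arith : ∀ r x y → (r ℕ.+ suc r ℕ.* x) ℕ.+ suc (suc r ℕ.* y) ≡ suc r ℕ.+ suc r ℕ.* (x ℕ.+ y)
        arith = solve-∀
      prod-αβ : ∀ {α rest} → Split αs α rest → poly α ⊗ prod (rest ++ βs) ≋ Y j ⊗ differences j (N ++ map proj₁ L)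
      prod-αβ {α} {rest} sp = A.trans (A.*-congˡ {poly α} (prod-++ rest βs))
        (A.trans (A.sym (A.*-assoc (poly α) (prod rest) (prod βs)))
          (A.trans (A.*-cong (A.trans (A.sym (prod-split sp)) (prod-factors j r′ L₁))
            (A.*-congˡ {var j} (A.reflexive (≡.trans (prod-differences j (unflag L))
              (≡.cong (differences j) (≡.sym (List.map-∘ L)))))))
          (numerator-cofactor j N (map proj₁ L))))
      eliminated : (Y j ⊗ differences j (N ++ map proj₁ L)) ▸ D ≗ 𝟘
      eliminated = state-eliminated {L₁ = L₁} ((j , true) ∷ L) st D∈P here
      -- k is deg α - 1 and at the same time the growth of the residual socle degree: 0 when xⱼ is
      -- deleted, r - 1 when two indices merge.
      module Child {α rest} (sp : Split αs α rest) k (deg-α : deg α ≡ suc k) where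
        D′ : U
        D′ = prod (rest ++ βs) ▸ D
        D′∈ : (P ∩ker poly α) D′
        D′∈ = ▸-closed (submodule st) (prod (rest ++ βs)) D∈P , λ a → trans (at (prod-αβ sp) D a) (eliminated a)
        e≡′ : e ≡ d₀ ℕ.+ socle m ℕ.+ k ℕ.+ tot (rest ++ βs)
        e≡′ = ≡.trans e≡ (≡.trans (≡.cong (λ x → d₀ ℕ.+ socle x) (ℕ.+-suc (length L₁) (length L)))
          (≡.trans (≡.cong (λ x → d₀ ℕ.+ (socle m ℕ.+ x)) remaining) (arith d₀ (socle m) k (tot (rest ++ βs)))))
          where
          arith : ∀ a b c d → a ℕ.+ (b ℕ.+ (c ℕ.+ d)) ≡ a ℕ.+ b ℕ.+ c ℕ.+ d
          arith = solve-∀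
          remaining : r′ ℕ.+ r ℕ.* m ≡ k ℕ.+ tot (rest ++ βs)
          remaining = ℕ.suc-injective (≡.trans (≡.sym tot-αβ) (≡.trans (≡.cong (ℕ._+ tot βs) (tot-split sp))
            (≡.trans (ℕ.+-assoc (deg α) (tot rest) (tot βs)) (≡.cong₂ ℕ._+_ deg-α (≡.sym (tot-++ rest βs))))))
        supp′ : Supp (d₀ ℕ.+ socle m ℕ.+ k) D′
        supp′ = prod-supp (rest ++ βs) (≡.subst (λ x → Supp x D) e≡′ s)
        nonzero′ : ¬ D′ ≗ 𝟘
        nonzero′ = prod-nonzero (rest ++ βs) (submodule st) (All.++⁺ (proj₂ (all-split sp goodα)) goodβ) D∈P s
          (≡.subst (d₀ ℕ.+ socle m ℕ.+ tot (rest ++ βs) ℕ.≤_) (≡.sym e≡′)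
            (ℕ.+-monoˡ-≤ (tot (rest ++ βs)) (ℕ.m≤m+n (d₀ ℕ.+ socle m) k))) nz
        -- Rewrites the generator obtained for the kernel of α into the form that `covers-prod` asks
        -- for.
        generated : generator L ▸ D′ ≗ prod rest ▸ C
        generated a = trans (▸-cong (generator L) (at (prod-++ rest βs) D) a)
          (trans (▸-comm (generator L) (prod rest) (prod βs ▸ D) a)
            (▸-cong (prod rest) (▸-cong (generator L) λ b →
              reflexive (≡.cong (λ p → (p ▸ D) b) (≡.cong (var j ⊗_) (≡.trans (prod-differences j (unflag L))
                (≡.cong (differences j) (≡.sym (List.map-∘ L))))))) a))
        regenerate : ∀ {v} → v ∈⟨ generator L ▸ D′ ⟩ → v ∈⟨ prod rest ▸ C ⟩
        regenerate (h , v≗) = h , λ a → trans (v≗ a) (▸-cong h generated a)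
      cover : ∀ {α rest} → Split αs α rest → Covers P̃ (poly α) (prod rest ▸ C)
      cover {α} {rest} sp v (v∈P , ann) αv with split-append (replicate r′ (variable-factor j)) sp
      cover {α} {rest} sp v (v∈P , ann) αv | inj₁ (_ , t) with split-replicate r′ t
      ... | ≡.refl = regenerate (cyclic-flagged L L₁ (delete st′) D′∈ supp′ (ℕ.+-identityʳ _)
              (prod-integral (rest ++ βs) i) nonzero′ v (v∈P , αv) ann)
        where
        open Child sp 0 ≡.refl
      cover {α} {rest} sp v (v∈P , ann) αv | inj₂ (_ , t) with split-map (λ x → difference-factor j (proj₁ x)) L₁ t
      ... | (l , w) , _ , t′ , ≡.refl , _ = regenerate (cyclic-flagged L (heavier t′ 0)
              (≡.subst (λ M → State (P ∩ker poly α) M (d₀ ℕ.+ r′)) (replaced-++ˡ t′ (unflag L) _)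
                (merge (split-++ˡ t′ (unflag L)) st′))
              D′∈ supp′ degree (prod-integral (rest ++ βs) i) nonzero′ v (v∈P , αv)
              (≡.subst (λ M → Annihilated M L v) (≡.sym (map-replaced proj₁ t′ ≡.refl)) ann))
        where
        open Child sp r′ ≡.refl
        degree : d₀ ℕ.+ socle m ℕ.+ r′ ≡ d₀ ℕ.+ r′ ℕ.+ socle (length (heavier t′ 0) ℕ.+ length L)
        degree = ≡.trans (arith d₀ (socle m) r′) (≡.cong (λ x → d₀ ℕ.+ r′ ℕ.+ socle (x ℕ.+ length L))
          (≡.sym (length-replaced t′ _)))
          where
          arith : ∀ a b c → a ℕ.+ b ℕ.+ c ≡ a ℕ.+ c ℕ.+ b
          arith = solve-∀

  -- Elements of superspace as operators.

  open Defs.Superspace K public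
    renaming (_≈_ to _≈Ω_; _+_ to _+Ω_; _*_ to _*Ω_; _-_ to _-Ω_; _^_ to _^Ω_; x to xΩ; θ to θΩ; d to dΩ; δ to δΩ; ∏
        to ∏Ω; ∑ to ∑Ω)

  foldr-allFin : ∀ {a} {A : Set a} {m} (G : Fin (suc m) → A → A) h →
    foldr G h (allFin (suc m)) ≡ G zero (foldr (λ i → G (suc i)) h (allFin m))
  foldr-allFin {m = m} G h = ≡.cong (G zero) (≡.trans (≡.cong (foldr G h) (≡.sym (List.map-tabulate id suc)))
    (List.foldr-map G suc h (allFin m)))

  module _ {I : Set} where
    powers : ∀ {m} → (Fin m → Lin I I) → Vec ℕ m → Lin I I
    powers X []      = idL
    powers X (k ∷ a) = fold (powers (X ∘ suc) a) (X zero ⊚_) k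

    wedge : ∀ {m} → (Fin m → Lin I I) → Subset m → Lin I I
    wedge Θ []            = idL
    wedge Θ (inside ∷ J)  = Θ zero ⊚ wedge (Θ ∘ suc) J
    wedge Θ (outside ∷ J) = wedge (Θ ∘ suc) J

    monomial : ∀ {n} → (X Θ : Fin n → Lin I I) → Monomial n → Lin I I
    monomial X Θ (a , J) = powers X a ⊚ wedge Θ J

    apply : ∀ {n} → (X Θ : Fin n → Lin I I) → Ω n → Lin I I
    apply X Θ []            = zeroL
    apply X Θ ((k , m) ∷ f) = addL (scaleL k (monomial X Θ m)) (apply X Θ f)

  module _ {n : ℕ} {I : Set} (π : Ω n → Fn I)
    (π-0 : π 0Ω ≗ 𝟘) (π-+ : ∀ f g → π (f +Ω g) ≗ π f ⊞ π g) (π-· : ∀ k f → π (k · f) ≗ k ⊡ π f) where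

    π-fold : (X′ : Ω n → Ω n) (X : Lin I I) → (∀ f → π (X′ f) ≗ fn X (π f)) →
      ∀ k h (T : Lin I I) {F} → π h ≗ fn T F → π (fold h X′ k) ≗ fn (fold T (X ⊚_) k) F
    π-fold X′ X e zero    h T p i = p i
    π-fold X′ X e (suc k) h T p i = trans (e _ i) (fncong X (π-fold X′ X e k h T p) i)

    π-powers : ∀ {m} (X′ : Fin m → Ω n → Ω n) (X : Fin m → Lin I I) → (∀ i f → π (X′ i f) ≗ fn (X i) (π f)) →
      ∀ a h → π (foldr (λ i h′ → fold h′ (X′ i) (lookup a i)) h (allFin m)) ≗ fn (powers X a) (π h)
    π-powers X′ X e []      h i = refl
    π-powers X′ X e (k ∷ a) h i = trans
      (reflexive (≡.cong (λ f → π f i) (foldr-allFin (λ i h′ → fold h′ (X′ i) (lookup (k ∷ a) i)) h)))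
      (π-fold (X′ zero) (X zero) (e zero) k _ (powers (X ∘ suc) a) (π-powers (X′ ∘ suc) (X ∘ suc) (e ∘ suc) a h) i)

    π-wedge : ∀ {m} (Θ′ : Fin m → Ω n → Ω n) (Θ : Fin m → Lin I I) → (∀ i f → π (Θ′ i f) ≗ fn (Θ i) (π f)) →
      ∀ J h → π (foldr (λ i → if lookup J i then Θ′ i else id) h (allFin m)) ≗ fn (wedge Θ J) (π h)
    π-wedge Θ′ Θ e []            h i = refl
    π-wedge Θ′ Θ e (outside ∷ J) h i = trans
      (reflexive (≡.cong (λ f → π f i) (foldr-allFin (λ i → if lookup (outside ∷ J) i then Θ′ i else id) h)))
      (π-wedge (Θ′ ∘ suc) (Θ ∘ suc) (e ∘ suc) J h i)
    π-wedge Θ′ Θ e (inside ∷ J)  h i = trans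
      (reflexive (≡.cong (λ f → π f i) (foldr-allFin (λ i → if lookup (inside ∷ J) i then Θ′ i else id) h)))
      (trans (e zero _ i) (fncong (Θ zero) (π-wedge (Θ′ ∘ suc) (Θ ∘ suc) (e ∘ suc) J h) i))

    -- Stated for any linear π, so that one induction serves contraction, multiplication, the group
    -- action and the action of Ω on other modules.
    interpret : (X′ Θ′ : Fin n → Ω n → Ω n) (X Θ : Fin n → Lin I I) →
      (∀ i f → π (X′ i f) ≗ fn (X i) (π f)) → (∀ i f → π (Θ′ i f) ≗ fn (Θ i) (π f)) →
      ∀ f g → π (operator X′ Θ′ f g) ≗ fn (apply X Θ f) (π g)
    interpret X′ Θ′ X Θ eX eΘ [] g i = π-0 i
    interpret X′ Θ′ X Θ eX eΘ ((k , a , J) ∷ f) g i = trans (π-+ _ _ i) (+-cong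
      (trans (π-· k _ i) (*-congˡ (trans (π-powers X′ X eX a _ i)
        (fncong (powers X a) (π-wedge Θ′ Θ eΘ J g) i))))
      (interpret X′ Θ′ X Θ eX eΘ f g i))

  apply-+ : ∀ {n I} (X Θ : Fin n → Lin I I) f g F → fn (apply X Θ (f +Ω g)) F ≗ fn (apply X Θ f) F ⊞ fn (apply X Θ g) F
  apply-+ X Θ [] g F i = sym (+-identityˡ _)
  apply-+ X Θ (_ ∷ f) g F i = trans (+-congˡ (apply-+ X Θ f g F i)) (sym (+-assoc _ _ _))

  apply-· : ∀ {n I} (X Θ : Fin n → Lin I I) k f F → fn (apply X Θ (k · f)) F ≗ k ⊡ fn (apply X Θ f) F
  apply-· X Θ k [] F i = sym (zeroʳ k)
  apply-· X Θ k (_ ∷ f) F i = trans (+-cong (*-assoc _ _ _) (apply-· X Θ k f F i)) (sym (distribˡ _ _ _))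

  extend : ∀ {n} → (Monomial n → Carrier) → Ω n → Carrier
  extend φ []            = 0#
  extend φ ((k , m) ∷ f) = k * φ m + extend φ f

  apply-extend : ∀ {n I} (X Θ : Fin n → Lin I I) f F i →
    fn (apply X Θ f) F i ≡ extend (λ m → fn (monomial X Θ m) F i) f
  apply-extend X Θ [] F i = ≡.refl
  apply-extend X Θ ((k , m) ∷ f) F i = ≡.cong (_ +_) (apply-extend X Θ f F i)

  extend-+ : ∀ {n} (φ : Monomial n → Carrier) f g → extend φ (f +Ω g) ≈ extend φ f + extend φ g
  extend-+ φ [] g = sym (+-identityˡ _)
  extend-+ φ (_ ∷ f) g = trans (+-congˡ (extend-+ φ f g)) (sym (+-assoc _ _ _))

  extend-· : ∀ {n} (φ : Monomial n → Carrier) k f → extend φ (k · f) ≈ k * extend φ f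
  extend-· φ k [] = sym (zeroʳ k)
  extend-· φ k (_ ∷ f) = trans (+-cong (*-assoc _ _ _) (extend-· φ k f)) (sym (distribˡ _ _ _))

  coeff-+ : ∀ {n} (m : Monomial n) f g → coeff m (f +Ω g) ≈ coeff m f + coeff m g
  coeff-+ m [] g = sym (+-identityˡ _)
  coeff-+ m (_ ∷ f) g = trans (+-congˡ (coeff-+ m f g)) (sym (+-assoc _ _ _))

  coeff-· : ∀ {n} (m : Monomial n) k f → coeff m (k · f) ≈ k * coeff m f
  coeff-· m k [] = sym (zeroʳ k)
  coeff-· m k ((l , m′) ∷ f) = trans (+-cong (scaled (does (m ≟ᵐ m′))) (coeff-· m k f)) (sym (distribˡ _ _ _))
    where
    scaled : ∀ b → (if b then k * l else 0#) ≈ k * (if b then l else 0#)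
    scaled true  = refl
    scaled false = sym (zeroʳ k)

  coeff-≡ : ∀ {n} (m : Monomial n) k f → coeff m ((k , m) ∷ f) ≈ k + coeff m f
  coeff-≡ m k f = +-congʳ (reflexive (≡.cong (if_then k else 0#) (dec-true (m ≟ᵐ m) ≡.refl)))

  coeff-≢ : ∀ {n} (m m′ : Monomial n) k f → m ≢ m′ → coeff m ((k , m′) ∷ f) ≈ coeff m f
  coeff-≢ m m′ k f m≢m′ = trans (+-congʳ (reflexive (≡.cong (if_then k else 0#) (dec-false (m ≟ᵐ m′) m≢m′))))
      (+-identityˡ _)

  remove : ∀ {n} → Monomial n → Ω n → Ω n
  remove m [] = []
  remove m ((k , m′) ∷ f) = if does (m ≟ᵐ m′) then remove m f else (k , m′) ∷ remove m f

  length-remove : ∀ {n} (m : Monomial n) f → length (remove m f) ℕ.≤ length f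
  length-remove m [] = ℕ.z≤n
  length-remove m ((k , m′) ∷ f) with m ≟ᵐ m′
  ... | yes _ = ℕ.m≤n⇒m≤1+n (length-remove m f)
  ... | no _  = ℕ.s≤s (length-remove m f)

  coeff-remove-≢ : ∀ {n} (m m′ : Monomial n) f → m′ ≢ m → coeff m′ (remove m f) ≈ coeff m′ f
  coeff-remove-≢ m m′ [] m′≢m = refl
  coeff-remove-≢ m m′ ((k , m″) ∷ f) m′≢m with m ≟ᵐ m″
  ... | no _ = +-congˡ (coeff-remove-≢ m m′ f m′≢m)
  ... | yes ≡.refl = trans (coeff-remove-≢ m m′ f m′≢m) (sym (coeff-≢ m′ m k f m′≢m))

  coeff-remove : ∀ {n} (m : Monomial n) f → coeff m (remove m f) ≈ 0#
  coeff-remove m [] = refl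
  coeff-remove m ((k , m′) ∷ f) with m ≟ᵐ m′
  ... | yes _    = coeff-remove m f
  ... | no m≢m′  = trans (coeff-≢ m m′ k (remove m f) m≢m′) (coeff-remove m f)

  extend-remove : ∀ {n} (φ : Monomial n → Carrier) m f → extend φ f ≈ coeff m f * φ m + extend φ (remove m f)
  extend-remove φ m [] = sym (trans (+-congʳ (zeroˡ _)) (+-identityˡ 0#))
  extend-remove φ m ((k , m′) ∷ f) with m ≟ᵐ m′
  ... | yes ≡.refl = trans (+-congˡ (extend-remove φ m f))
      (trans (sym (+-assoc _ _ _)) (+-congʳ (sym (distribʳ _ _ _))))
  ... | no _ = trans (+-congˡ (extend-remove φ m f)) (trans (sym (+-assoc _ _ _)) (trans (+-congʳ (+-comm _ _))
    (trans (+-assoc _ _ _) (+-congʳ (*-congʳ (sym (+-identityˡ _)))))))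

  -- Terms with the same monomial may stand apart in the list and cancel only together, so the first
  -- monomial is removed throughout. The bound k on the length makes this recursion terminate.
  extend-zero : ∀ {n} (φ : Monomial n → Carrier) k f → length f ℕ.≤ k → f ≈Ω 0Ω → extend φ f ≈ 0#
  extend-zero φ k [] _ _ = refl
  extend-zero φ (suc k) ((l , m) ∷ f) (ℕ.s≤s f≤k) z = trans (extend-remove φ m ((l , m) ∷ f))
    (trans (+-cong (trans (*-congʳ (z m)) (zeroˡ _)) rest) (+-identityˡ 0#))
    where
    zeros : remove m ((l , m) ∷ f) ≈Ω 0Ω
    zeros m′ with m′ ≟ᵐ m
    ... | yes ≡.refl = coeff-remove m ((l , m) ∷ f)
    ... | no m′≢m    = trans (coeff-remove-≢ m m′ ((l , m) ∷ f) m′≢m) (z m′)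
    same : remove m ((l , m) ∷ f) ≡ remove m f
    same = ≡.cong (if_then remove m f else (l , m) ∷ remove m f) (dec-true (m ≟ᵐ m) ≡.refl)
    rest : extend φ (remove m ((l , m) ∷ f)) ≈ 0#
    rest = trans (reflexive (≡.cong (extend φ) same))
      (extend-zero φ k (remove m f) (ℕ.≤-trans (length-remove m f) f≤k) (≡.subst (_≈Ω 0Ω) same zeros))

  extend-resp : ∀ {n} (φ : Monomial n → Carrier) {f g} → f ≈Ω g → extend φ f ≈ extend φ g
  extend-resp φ {f} {g} e = cancelʳ (- 1# * extend φ g) (extend φ g) (trans
    (sym (trans (extend-+ φ f (- 1# · g)) (+-congˡ (extend-· φ (- 1#) g))))
    (trans (extend-zero φ _ (f +Ω - 1# · g) ℕ.≤-refl λ m → trans (coeff-+ m f (- 1# · g))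
      (trans (+-cong (e m) (trans (coeff-· m (- 1#) g) (-1*x≈-x _))) (-‿inverseʳ _)))
      (sym (trans (+-congˡ (-1*x≈-x _)) (-‿inverseʳ _)))))

  apply-resp : ∀ {n I} (X Θ : Fin n → Lin I I) {f g} → f ≈Ω g → ∀ F → fn (apply X Θ f) F ≗ fn (apply X Θ g) F
  apply-resp X Θ {f} {g} e F i = trans (reflexive (apply-extend X Θ f F i))
    (trans (extend-resp (λ m → fn (monomial X Θ m) F i) {f} {g} e) (reflexive (≡.sym (apply-extend X Θ g F i))))

  module _ {I J : Set} (T : Lin I J) where
    Intertwines : Lin I I → Lin J J → Set (c ⊔ ℓ)
    Intertwines S S′ = ∀ F → fn T (fn S F) ≗ fn S′ (fn T F)

    intertwine-fold : ∀ S S′ {R R′} → Intertwines S S′ → Intertwines R R′ → ∀ k →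
      Intertwines (fold R (S ⊚_) k) (fold R′ (S′ ⊚_) k)
    intertwine-fold S S′ e p zero    F i = p F i
    intertwine-fold S S′ e p (suc k) F i = trans (e _ i) (fncong S′ (intertwine-fold S S′ e p k F) i)

    intertwine-powers : ∀ {m} (X : Fin m → Lin I I) (X′ : Fin m → Lin J J) → (∀ i → Intertwines (X i) (X′ i)) →
      ∀ a → Intertwines (powers X a) (powers X′ a)
    intertwine-powers X X′ e []      F i = refl
    intertwine-powers X X′ e (k ∷ a) =
      intertwine-fold (X zero) (X′ zero) (e zero) (intertwine-powers (X ∘ suc) (X′ ∘ suc) (e ∘ suc) a) k

    intertwine-wedge : ∀ {m} (X : Fin m → Lin I I) (X′ : Fin m → Lin J J) → (∀ i → Intertwines (X i) (X′ i)) →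
      ∀ B → Intertwines (wedge X B) (wedge X′ B)
    intertwine-wedge X X′ e [] F i = refl
    intertwine-wedge X X′ e (inside ∷ B) F i =
      trans (e zero _ i) (fncong (X′ zero) (intertwine-wedge (X ∘ suc) (X′ ∘ suc) (e ∘ suc) B F) i)
    intertwine-wedge X X′ e (outside ∷ B) F i = intertwine-wedge (X ∘ suc) (X′ ∘ suc) (e ∘ suc) B F i

    intertwine-apply : ∀ {n} (X Θ : Fin n → Lin I I) (X′ Θ′ : Fin n → Lin J J) →
      (∀ i → Intertwines (X i) (X′ i)) → (∀ i → Intertwines (Θ i) (Θ′ i)) →
      ∀ f → Intertwines (apply X Θ f) (apply X′ Θ′ f)
    intertwine-apply X Θ X′ Θ′ eX eΘ [] F i = fn-𝟘 T i
    intertwine-apply X Θ X′ Θ′ eX eΘ ((k , a , B) ∷ f) F i = trans (fn-⊞ T _ _ i) (+-cong (trans (fn-⊡ T k _ i)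
      (*-congˡ (trans (intertwine-powers X X′ eX a _ i) (fncong (powers X′ a) (intertwine-wedge Θ Θ′ eΘ B F) i))))
      (intertwine-apply X Θ X′ Θ′ eX eΘ f F i))

  -- Signs, and the basic operators in coordinates.

  parity : ∀ {n} → Subset n → Carrier
  parity []            = 1#
  parity (inside ∷ J)  = - parity J
  parity (outside ∷ J) = parity J

  flip : ∀ {n} → Fin n → Subset n → Subset n
  flip i J = J [ i ]%= not

  neg-* : ∀ a b → - a * - b ≈ a * b
  neg-* a b = trans (sym (-‿distribˡ-* _ _)) (trans (-‿cong (sym (-‿distribʳ-* _ _))) (-‿involutive _))

  parity-flip : ∀ {n} (i : Fin n) J → parity (flip i J) ≈ - parity J
  parity-flip zero    (inside ∷ J)  = sym (-‿involutive _)
  parity-flip zero    (outside ∷ J) = refl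
  parity-flip (suc i) (inside ∷ J)  = -‿cong (parity-flip i J)
  parity-flip (suc i) (outside ∷ J) = parity-flip i J

  parity-square : ∀ {n} (J : Subset n) → parity J * parity J ≈ 1#
  parity-square []            = *-identityˡ 1#
  parity-square (inside ∷ J)  = trans (neg-* _ _) (parity-square J)
  parity-square (outside ∷ J) = parity-square J

  sign-flip-self : ∀ {n} (i : Fin n) J → sign i (flip i J) ≈ sign i J
  sign-flip-self zero    (b ∷ J)       = refl
  sign-flip-self (suc i) (inside ∷ J)  = -‿cong (sign-flip-self i J)
  sign-flip-self (suc i) (outside ∷ J) = sign-flip-self i J

  sign-square : ∀ {n} (i : Fin n) J → sign i J * sign i J ≈ 1#
  sign-square zero    (b ∷ J)       = *-identityˡ 1#
  sign-square (suc i) (inside ∷ J)  = trans (neg-* _ _) (sign-square i J)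
  sign-square (suc i) (outside ∷ J) = sign-square i J

  -- The smaller of the two indices counts in the sign of the larger one and not conversely, so
  -- reversing the order changes exactly one of the two signs.
  sign-exchange : ∀ {n} {i j : Fin n} → i ≢ j → ∀ J →
    sign i J * sign j (flip i J) ≈ - (sign j J * sign i (flip j J))
  sign-exchange {i = zero}  {zero}  i≢j J = ⊥-elim (i≢j ≡.refl)
  sign-exchange {i = zero}  {suc j} i≢j (inside ∷ J)  = trans (*-identityˡ _)
    (sym (trans (-‿cong (*-identityʳ _)) (-‿involutive _)))
  sign-exchange {i = zero}  {suc j} i≢j (outside ∷ J) = trans (*-identityˡ _) (-‿cong (sym (*-identityʳ _)))
  sign-exchange {i = suc i} {zero}  i≢j (inside ∷ J)  = trans (*-identityʳ _) (-‿cong (sym (*-identityˡ _)))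
  sign-exchange {i = suc i} {zero}  i≢j (outside ∷ J) = trans (*-identityʳ _)
    (sym (trans (-‿cong (*-identityˡ _)) (-‿involutive _)))
  sign-exchange {i = suc i} {suc j} i≢j (inside ∷ J)  = trans (neg-* _ _)
    (trans (sign-exchange (i≢j ∘ ≡.cong suc) J) (-‿cong (sym (neg-* _ _))))
  sign-exchange {i = suc i} {suc j} i≢j (outside ∷ J) = sign-exchange (i≢j ∘ ≡.cong suc) J

  lookup-flip : ∀ {n} (i : Fin n) (J : Subset n) → lookup (flip i J) i ≡ not (lookup J i)
  lookup-flip i J = Vec.lookup∘updateAt i J

  lookup-flip′ : ∀ {n} {i j : Fin n} → j ≢ i → (J : Subset n) → lookup (flip i J) j ≡ lookup J j
  lookup-flip′ {i = i} {j} j≢i J = Vec.lookup∘updateAt′ j i j≢i J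

  flip-flip : ∀ {n} (i : Fin n) (J : Subset n) → flip i (flip i J) ≡ J
  flip-flip i J = ≡.trans (Vec.updateAt-updateAt i J) (Vec.updateAt-id-local i J (Bool.not-involutive _))

  flip-comm : ∀ {n} (i j : Fin n) (J : Subset n) → flip i (flip j J) ≡ flip j (flip i J)
  flip-comm i j J with i Fin.≟ j
  ... | yes ≡.refl = ≡.refl
  ... | no i≢j = Vec.updateAt-commutes i j i≢j J

  flip≡≔ : ∀ {n} (i : Fin n) (J : Subset n) {b} → lookup J i ≡ not b → J [ i ]%= not ≡ J Vec.[ i ]≔ b
  flip≡≔ i J e = Vec.updateAt-cong-local i J (≡.trans (≡.cong not e) (Bool.not-involutive _))

  when : Bool → Carrier → Carrier
  when b k = if b then k else 0#

  when-cong : ∀ b {k l} → k ≈ l → when b k ≈ when b l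
  when-cong true  e = e
  when-cong false e = refl

  when-+ : ∀ b k l → when b (k + l) ≈ when b k + when b l
  when-+ true  k l = refl
  when-+ false k l = sym (+-identityˡ 0#)

  when-* : ∀ b k l → when b (k * l) ≈ k * when b l
  when-* true  k l = refl
  when-* false k l = sym (zeroʳ k)

  when-comm : ∀ b b′ k → when b (when b′ k) ≈ when b′ (when b k)
  when-comm true  b′    k = refl
  when-comm false true  k = refl
  when-comm false false k = refl

  when-neg : ∀ b k → when b (- k) ≈ - when b k
  when-neg true  k = refl
  when-neg false k = sym -0#≈0#

  is : Bool → Bool → Bool
  is true  b = b
  is false b = not b

  is-not : ∀ b b′ → is b (not b′) ≡ not (is b b′)
  is-not true  b′ = ≡.refl
  is-not false b′ = ≡.refl

  Anticommute : {I : Set} → Lin I I → Lin I I → Set (c ⊔ ℓ)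
  Anticommute S T = ∀ F i → fn S (fn T F) i ≈ - fn T (fn S F) i

  module _ {n : ℕ} where
    Dual : Set c
    Dual = Fn (Monomial n)

    -- In coordinates multiplied by a!, these are ∂ᵢ and multiplication by xᵢ. At exponent 0 the
    -- truncated predecessor is harmless because the factor in front of it is 0.
    lower raise : Fin n → Lin (Monomial n) (Monomial n)
    fn (lower i) F (a , J) = F (a [ i ]%= suc , J)
    fncong (lower i) p _ = p _
    fn-⊞ (lower i) F G _ = refl
    fn-⊡ (lower i) k F _ = refl
    fn (raise i) F (a , J) = (lookup a i ×′ 1#) * F (a [ i ]%= ℕ.pred , J)
    fncong (raise i) p _ = *-congˡ (p _)
    fn-⊞ (raise i) F G _ = distribˡ _ _ _
    fn-⊡ (raise i) k F _ = *-swap _ _ _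

    -- The operators θᵢ (b = true) and ∂ᶿᵢ (b = false).
    toggle : Bool → Fin n → Lin (Monomial n) (Monomial n)
    fn (toggle b i) F (a , J) = when (is b (lookup J i)) (sign i J * F (a , flip i J))
    fncong (toggle b i) p (a , J) = when-cong (is b (lookup J i)) (*-congˡ (p _))
    fn-⊞ (toggle b i) F G (a , J) = trans (when-cong (is b (lookup J i)) (distribˡ _ _ _))
        (when-+ (is b (lookup J i)) _ _)
    fn-⊡ (toggle b i) k F (a , J) = trans (when-cong (is b (lookup J i)) (*-swap _ _ _))
        (when-* (is b (lookup J i)) _ _)

    involute : Lin (Monomial n) (Monomial n)
    fn involute F (a , J) = parity J * F (a , J)
    fncong involute p _ = *-congˡ (p _)
    fn-⊞ involute F G _ = distribˡ _ _ _
    fn-⊡ involute k F _ = *-swap _ _ _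

    lower-comm : ∀ i j → Commute (lower i) (lower j)
    lower-comm i j F (a , J) with i Fin.≟ j
    ... | yes ≡.refl = refl
    ... | no i≢j = reflexive (≡.cong (λ b → F (b , J)) (≡.sym (Vec.updateAt-commutes i j i≢j a)))

    raise-comm : ∀ i j → Commute (raise i) (raise j)
    raise-comm i j F (a , J) with i Fin.≟ j
    ... | yes ≡.refl = refl
    ... | no i≢j = trans (*-congˡ (*-congʳ (reflexive (≡.cong (_×′ 1#) (Vec.lookup∘updateAt′ j i (i≢j ∘ ≡.sym) a)))))
      (trans (*-swap _ _ _) (*-cong refl (*-cong
        (reflexive (≡.cong (_×′ 1#) (≡.sym (Vec.lookup∘updateAt′ i j i≢j a))))
        (reflexive (≡.cong (λ b → F (b , J)) (≡.sym (Vec.updateAt-commutes i j i≢j a)))))))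

    raise-toggle : ∀ i b j → Commute (raise i) (toggle b j)
    raise-toggle i b j F (a , J) = trans (sym (when-* (is b (lookup J j)) _ _))
        (when-cong (is b (lookup J j)) (*-swap _ _ _))

    raise-involute : ∀ i → Commute (raise i) involute
    raise-involute i F _ = *-swap _ _ _

    toggle-involute : ∀ b i → Anticommute (toggle b i) involute
    toggle-involute b i F (a , J) = trans (when-cong (is b (lookup J i))
        (trans (*-swap _ _ _) (trans (*-congʳ (parity-flip i J)) (sym (-‿distribˡ-* _ _)))))
      (trans (when-neg (is b (lookup J i)) _) (-‿cong (when-* (is b (lookup J i)) _ _)))

    toggle-anti : ∀ b b′ {i j} → i ≢ j → Anticommute (toggle b i) (toggle b′ j)
    toggle-anti b b′ {i} {j} i≢j F (a , J) = begin
      when bi (sign i J * when (is b′ (lookup (flip i J) j)) (sign j (flip i J) * F (a , flip j (flip i J))))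
        ≈⟨ when-cong bi (*-congˡ (reflexive (≡.cong₂ (λ x y → when (is b′ x) (sign j (flip i J) * F (a , y)))
             (lookup-flip′ (i≢j ∘ ≡.sym) J) (flip-comm j i J)))) ⟩
      when bi (sign i J * when bj (sign j (flip i J) * G))
        ≈⟨ when-cong bi (trans (sym (when-* bj _ _)) (when-cong bj (trans (sym (*-assoc _ _ _))
             (trans (*-congʳ (sign-exchange i≢j J)) (trans (sym (-‿distribˡ-* _ _)) (-‿cong (*-assoc _ _ _))))))) ⟩
      when bi (when bj (- (sign j J * (sign i (flip j J) * G))))
        ≈⟨ trans (when-comm bi bj _) (when-cong bj (when-neg bi _)) ⟩
      when bj (- when bi (sign j J * (sign i (flip j J) * G)))
        ≈⟨ trans (when-neg bj _) (-‿cong (when-cong bj (when-* bi _ _))) ⟩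
      - when bj (sign j J * when bi (sign i (flip j J) * G))
        ≈⟨ -‿cong (when-cong bj (*-congˡ (reflexive (≡.cong (λ x → when (is b x) (sign i (flip j J) * G))
             (≡.sym (lookup-flip′ i≢j J)))))) ⟩
      - when bj (sign j J * when (is b (lookup (flip j J) i)) (sign i (flip j J) * G)) ∎
      where
      open SetoidReasoning setoid
      bi bj : Bool
      bi = is b (lookup J i)
      bj = is b′ (lookup J j)
      G : Carrier
      G = F (a , flip i (flip j J))

    toggle-square : ∀ b i F → fn (toggle b i) (fn (toggle b i) F) ≗ 𝟘
    toggle-square b i F (a , J) = trans (when-cong (is b (lookup J i)) (*-congˡ (reflexive
        (≡.cong (λ x → when x (sign i (flip i J) * F (a , flip i (flip i J))))
          (≡.trans (≡.cong (is b) (lookup-flip i J)) (is-not b (lookup J i))))))) (cancel (is b (lookup J i)))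
      where
      cancel : ∀ x {k l} → when x (k * when (not x) l) ≈ 0#
      cancel true  = zeroʳ _
      cancel false = refl

    toggle-anti-self : ∀ b i j → Anticommute (toggle b i) (toggle b j)
    toggle-anti-self b i j with i Fin.≟ j
    ... | yes ≡.refl = λ F m → trans (toggle-square b i F m) (trans (sym -0#≈0#) (-‿cong (sym (toggle-square b i F m))))
    ... | no i≢j = toggle-anti b b i≢j

    -- Of the two summands exactly one survives, according to whether i lies in J. This Clifford
    -- relation is the source of the extra term in the Leibniz rules.
    toggle-toggle : ∀ i F → fn (toggle false i) (fn (toggle true i) F) ⊞ fn (toggle true i) (fn (toggle false i) F) ≗ F
    toggle-toggle i F (a , J) = trans (+-cong
        (when-cong (not x) (*-congˡ (reflexive (≡.cong₂ (λ y z → when y (sign i (flip i J) * F (a , z)))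
          (lookup-flip i J) (flip-flip i J)))))
        (when-cong x (*-congˡ (reflexive (≡.cong₂ (λ y z → when (not y) (sign i (flip i J) * F (a , z)))
          (lookup-flip i J) (flip-flip i J))))))
      (trans (combine x (*-congˡ (*-congʳ (sign-flip-self i J))))
        (trans (sym (*-assoc _ _ _)) (trans (*-congʳ (sign-square i J)) (*-identityˡ _))))
      where
      x : Bool
      x = lookup J i
      combine : ∀ x {k l l′} → k * l ≈ l′ → when (not x) (k * when (not x) l) + when x (k * when (not (not x)) l) ≈ l′
      combine true  e = trans (+-identityˡ _) e
      combine false e = trans (+-identityʳ _) e

    involute-involute : ∀ F → fn involute (fn involute F) ≗ F
    involute-involute F (a , J) = trans (sym (*-assoc _ _ _)) (trans (*-congʳ (parity-square J)) (*-identityˡ _))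

  -- Passage to coordinates multiplied by factorials.

  factorial : ∀ {n} → Vec ℕ n → Carrier
  factorial []      = 1#
  factorial (k ∷ a) = ((k !) ×′ 1#) * factorial a

  factorial-suc : ∀ {n} (a : Vec ℕ n) i → factorial (a [ i ]%= suc) ≈ (suc (lookup a i) ×′ 1#) * factorial a
  factorial-suc (k ∷ a) zero    = trans (*-congʳ (Mult.×1-homo-* (suc k) (k !))) (*-assoc _ _ _)
  factorial-suc (k ∷ a) (suc i) = trans (*-congˡ (factorial-suc a i)) (*-swap _ _ _)

  factorial-unit : ∀ {n} (a : Vec ℕ n) → Unit (factorial a)
  factorial-unit []      = 1# , *-identityˡ 1#
  factorial-unit (k ∷ a) = unit-* (unit-! k) (factorial-unit a)
    where
    unit-! : ∀ k → Unit ((k !) ×′ 1#)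
    unit-! k with k ! | ℕ.1≤n! k
    ... | suc m | _ = unit-suc m

  -- The factor a! turns ∂ᵢ into a mere shift of exponents.
  hat : ∀ {n} → Ω n → Dual
  hat f (a , J) = factorial a * coeff (a , J) f

  hat-0 : ∀ {n} → hat {n} 0Ω ≗ 𝟘
  hat-0 (a , J) = zeroʳ (factorial a)

  hat-+ : ∀ {n} (f g : Ω n) → hat (f +Ω g) ≗ hat f ⊞ hat g
  hat-+ f g (a , J) = trans (*-congˡ (coeff-+ (a , J) f g)) (distribˡ _ _ _)

  hat-· : ∀ {n} k (f : Ω n) → hat (k · f) ≗ k ⊡ hat f
  hat-· k f (a , J) = trans (*-congˡ (coeff-· (a , J) k f)) (*-swap _ _ _)

  hat-resp : ∀ {n} {f g : Ω n} → f ≈Ω g → hat f ≗ hat g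
  hat-resp e (a , J) = *-congˡ (e (a , J))

  hat-injective : ∀ {n} {f g : Ω n} → hat f ≗ hat g → f ≈Ω g
  hat-injective {f = f} {g} e (a , J) = cancelʳ (- coeff (a , J) g) _ (trans
    (unit-cancel (factorial-unit a) (trans (distribˡ _ _ _) (trans (+-cong (e (a , J)) (sym (-‿distribʳ-* _ _)))
      (-‿inverseʳ _))))
    (sym (-‿inverseʳ _)))

  δ-basis : ∀ {n} → Monomial n → Dual
  δ-basis m = hat ((1# , m) ∷ [])

  coeff-single : ∀ {n} (m : Monomial n) k → coeff m ((k , m) ∷ []) ≈ k
  coeff-single m k = trans (coeff-≡ m k []) (+-identityʳ k)

  hat-single-≢ : ∀ {n} a J (m′ : Monomial n) k → (a , J) ≢ m′ → hat ((k , m′) ∷ []) (a , J) ≈ 0#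
  hat-single-≢ a J m′ k h = trans (*-congˡ (coeff-≢ (a , J) m′ k [] h)) (zeroʳ _)

  hat-∷ : ∀ {n} k (m : Monomial n) f → hat ((k , m) ∷ f) ≗ k ⊡ δ-basis m ⊞ hat f
  hat-∷ k m f (a , J) = trans (*-congˡ (+-congʳ (scaled (does ((a , J) ≟ᵐ m)))))
      (trans (distribˡ _ _ _) (+-congʳ (*-swap _ _ _)))
    where
    scaled : ∀ b → (if b then k else 0#) ≈ k * ((if b then 1# else 0#) + 0#)
    scaled true  = sym (trans (*-congˡ (+-identityʳ 1#)) (*-identityʳ k))
    scaled false = sym (trans (*-congˡ (+-identityʳ 0#)) (zeroʳ k))

  hat-linear : ∀ {n} (φ : Monomial n → Ω n) (T : Lin (Monomial n) (Monomial n)) →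
    (∀ m → hat (φ m) ≗ fn T (δ-basis m)) → ∀ f → hat (linear φ f) ≗ fn T (hat f)
  hat-linear φ T e [] m = trans (hat-0 m) (sym (fn-zero T hat-0 m))
  hat-linear φ T e ((k , m) ∷ f) m′ = trans (hat-+ (k · φ m) (linear φ f) m′) (trans
    (+-cong (trans (hat-· k (φ m) m′) (*-congˡ (e m m′))) (hat-linear φ T e f m′))
    (sym (trans (fncong T (hat-∷ k m f) m′) (trans (fn-⊞ T _ _ m′) (+-congʳ (fn-⊡ T k _ m′))))))

  pred-suc : ∀ {n} (a : Vec ℕ n) i {k} → lookup a i ≡ suc k → (a [ i ]%= ℕ.pred) [ i ]%= suc ≡ a
  pred-suc a i e = ≡.trans (Vec.updateAt-updateAt i a)
    (Vec.updateAt-id-local i a (≡.trans (≡.cong (λ k → suc (ℕ.pred k)) e) (≡.sym e)))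

  suc-pred : ∀ {n} (a : Vec ℕ n) i → (a [ i ]%= suc) [ i ]%= ℕ.pred ≡ a
  suc-pred a i = ≡.trans (Vec.updateAt-updateAt i a) (Vec.updateAt-id-local i a ≡.refl)

  hat-∂ : ∀ {n} (i : Fin n) f → hat (∂ i f) ≗ fn (lower i) (hat f)
  hat-∂ i = hat-linear (λ (a , J) → (lookup a i ×′ 1# , a [ i ]%= ℕ.pred , J) ∷ []) (lower i) basis
    where
    basis : ∀ m → hat ((lookup (proj₁ m) i ×′ 1# , proj₁ m [ i ]%= ℕ.pred , proj₂ m) ∷ []) ≗ fn (lower i) (δ-basis m)
    basis (a , J) (b , B) with (b [ i ]%= suc , B) ≟ᵐ (a , J)
    ... | yes ≡.refl = trans
      (*-congˡ (trans (reflexive (≡.cong (λ c → coeff (b , B) ((k , c , B) ∷ [])) (suc-pred b i)))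
          (coeff-single (b , B) k)))
      (trans (*-congˡ (reflexive (≡.cong (_×′ 1#) (Vec.lookup∘updateAt i b)))) (trans (*-comm _ _)
        (trans (sym (factorial-suc b i)) (sym (trans (*-congˡ (+-identityʳ 1#)) (*-identityʳ _))))))
      where
      k : Carrier
      k = lookup (b [ i ]%= suc) i ×′ 1#
    ... | no ¬p with lookup a i in eq
    -- At exponent 0 the truncated predecessor names a wrong monomial, but its coefficient is 0.
    ...   | zero  = trans (hat-∷ 0# (a [ i ]%= ℕ.pred , J) [] (b , B))
                      (trans (+-cong (zeroˡ _) (zeroʳ _)) (sym (trans (*-congˡ (+-identityʳ 0#))
                          (trans (zeroʳ _) (sym (+-identityʳ 0#))))))
    ...   | suc k = trans (hat-single-≢ b B (a [ i ]%= ℕ.pred , J) _ λ e → ¬p (≡.cong₂ _,_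
                      (≡.trans (≡.cong (_[ i ]%= suc) (,-injectiveˡ e)) (pred-suc a i eq)) (,-injectiveʳ e)))
                      (sym (trans (*-congˡ (+-identityʳ 0#)) (zeroʳ _)))

  hat-mulˣ : ∀ {n} (i : Fin n) f → hat (mulˣ i f) ≗ fn (raise i) (hat f)
  hat-mulˣ i = hat-linear (λ (a , J) → (1# , a [ i ]%= suc , J) ∷ []) (raise i) basis
    where
    basis : ∀ m → δ-basis (proj₁ m [ i ]%= suc , proj₂ m) ≗ fn (raise i) (δ-basis m)
    basis (a , J) (b , B) with (b , B) ≟ᵐ (a [ i ]%= suc , J)
    ... | yes ≡.refl = trans (*-congˡ (+-identityʳ 1#)) (trans (*-identityʳ _) (trans (factorial-suc a i)
      (*-cong (reflexive (≡.cong (_×′ 1#) (≡.sym (Vec.lookup∘updateAt i a))))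
        (trans (sym (trans (*-congˡ (coeff-single (a , B) 1#)) (*-identityʳ _)))
          (reflexive (≡.cong (λ c → δ-basis (a , B) (c , B)) (≡.sym (suc-pred a i))))))))
    ... | no ¬p with lookup b i in eq
    ...   | zero  = trans (*-congˡ (+-identityʳ 0#)) (trans (zeroʳ _) (sym (zeroˡ _)))
    ...   | suc k = trans (*-congˡ (+-identityʳ 0#)) (trans (zeroʳ _) (sym (trans (*-congˡ
                      (hat-single-≢ (b [ i ]%= ℕ.pred) B (a , J) 1# λ e → ¬p (≡.cong₂ _,_
                        (≡.trans (≡.sym (pred-suc b i eq)) (≡.cong (_[ i ]%= suc) (,-injectiveˡ e))) (,-injectiveʳ e))))
                      (zeroʳ _))))

  -- The image of a monomial under θᵢ (b true) or ∂ᶿᵢ (b false), written with `flip` so that both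
  -- operators share their proofs.
  toggled : ∀ {n} → Bool → Fin n → Monomial n → Ω n
  toggled b i (a , J) = if is (not b) (lookup J i) then (sign i J , a , flip i J) ∷ [] else []

  hat-toggled : ∀ {n} b (i : Fin n) m → hat (toggled b i m) ≗ fn (toggle b i) (δ-basis m)
  hat-toggled b i (a , J) (c , B) with (c , flip i B) ≟ᵐ (a , J)
  ... | yes ≡.refl = trans (reflexive (≡.cong (λ x → hat (if x then (sign i J , c , flip i J) ∷ [] else []) (c , B))
      (≡.trans (≡.cong (is (not b)) (lookup-flip i B)) (is-not-not b (lookup B i))))) (value (is b (lookup B i)))
    where
    is-not-not : ∀ b x → is (not b) (not x) ≡ is b x
    is-not-not true  x = Bool.not-involutive x
    is-not-not false x = ≡.refl
    value : ∀ x → hat (if x then (sign i J , c , flip i J) ∷ [] else []) (c , B) ≈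
                  when x (sign i B * (factorial c * (1# + 0#)))
    value false = hat-0 (c , B)
    value true = trans (*-congˡ (trans (reflexive
        (≡.cong (λ D → coeff (c , B) ((sign i J , c , D) ∷ [])) (flip-flip i B)))
      (trans (coeff-single (c , B) (sign i J)) (sign-flip-self i B)))) (trans (*-comm _ _)
      (*-congˡ (sym (trans (*-congˡ (+-identityʳ 1#)) (*-identityʳ _)))))
  ... | no ¬p = trans (value (is (not b) (lookup J i))) (sym (trans (when-cong (is b (lookup B i))
        (trans (*-congˡ (trans (*-congˡ (+-identityʳ 0#)) (zeroʳ _))) (zeroʳ _))) (when-0 (is b (lookup B i)))))
    where
    when-0 : ∀ x → when x 0# ≈ 0#
    when-0 true  = refl
    when-0 false = refl
    value : ∀ x → hat (if x then (sign i J , a , flip i J) ∷ [] else []) (c , B) ≈ 0#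
    value false = hat-0 (c , B)
    value true  = hat-single-≢ c B (a , flip i J) (sign i J) λ e → ¬p (≡.cong₂ _,_ (,-injectiveˡ e)
      (≡.trans (≡.cong (flip i) (,-injectiveʳ e)) (flip-flip i J)))

  ∂ᶿ-basis : ∀ {n} (i : Fin n) a (J : Subset n) →
    (if lookup J i then (sign i J , a , J Vec.[ i ]≔ outside) ∷ [] else []) ≡ toggled false i (a , J)
  ∂ᶿ-basis i a J with lookup J i in eq
  ... | true  = ≡.cong (λ D → (sign i J , a , D) ∷ []) (≡.sym (flip≡≔ i J eq))
  ... | false = ≡.refl

  mulᶿ-basis : ∀ {n} (i : Fin n) a (J : Subset n) →
    (if lookup J i then [] else (sign i J , a , J Vec.[ i ]≔ inside) ∷ []) ≡ toggled true i (a , J)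
  mulᶿ-basis i a J with lookup J i in eq
  ... | true  = ≡.refl
  ... | false = ≡.cong (λ D → (sign i J , a , D) ∷ []) (≡.sym (flip≡≔ i J eq))

  ∂ᶿ-∷ : ∀ {n} (i : Fin n) k a (J : Subset n) f → ∂ᶿ i ((k , a , J) ∷ f) ≡ k · toggled false i (a , J) +Ω ∂ᶿ i f
  ∂ᶿ-∷ i k a J f = ≡.cong (λ g → k · g +Ω ∂ᶿ i f) (∂ᶿ-basis i a J)

  mulᶿ-∷ : ∀ {n} (i : Fin n) k a (J : Subset n) f → mulᶿ i ((k , a , J) ∷ f) ≡ k · toggled true i (a , J) +Ω mulᶿ i f
  mulᶿ-∷ i k a J f = ≡.cong (λ g → k · g +Ω mulᶿ i f) (mulᶿ-basis i a J)

  hat-∂ᶿ : ∀ {n} (i : Fin n) f → hat (∂ᶿ i f) ≗ fn (toggle false i) (hat f)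
  hat-∂ᶿ i = hat-linear _ (toggle false i) λ (a , J) m →
    trans (reflexive (≡.cong (λ f → hat f m) (∂ᶿ-basis i a J))) (hat-toggled false i (a , J) m)

  hat-mulᶿ : ∀ {n} (i : Fin n) f → hat (mulᶿ i f) ≗ fn (toggle true i) (hat f)
  hat-mulᶿ i = hat-linear _ (toggle true i) λ (a , J) m →
    trans (reflexive (≡.cong (λ f → hat f m) (mulᶿ-basis i a J))) (hat-toggled true i (a , J) m)

  hat-⊙ : ∀ {n} (f g : Ω n) → hat (f ⊙ g) ≗ fn (apply lower (toggle false) f) (hat g)
  hat-⊙ = interpret hat hat-0 hat-+ hat-· ∂ ∂ᶿ lower (toggle false) hat-∂ hat-∂ᶿ

  hat-* : ∀ {n} (f g : Ω n) → hat (f *Ω g) ≗ fn (apply raise (toggle true) f) (hat g)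
  hat-* = interpret hat hat-0 hat-+ hat-· mulˣ mulᶿ raise (toggle true) hat-mulˣ hat-mulᶿ

  -- Modules over superspace, and moving operators past its elements.

  powers-suc : ∀ {m I} (X : Fin m → Lin I I) → (∀ i j → Commute (X i) (X j)) → ∀ i a F →
    fn (powers X (a [ i ]%= suc)) F ≗ fn (X i) (fn (powers X a) F)
  powers-suc X comm zero    (k ∷ a) F m = refl
  powers-suc X comm (suc i) (k ∷ a) F = onto k
    where
    onto : ∀ k → fn (fold (powers (X ∘ suc) (a [ i ]%= suc)) (X zero ⊚_) k) F ≗
                 fn (X (suc i)) (fn (fold (powers (X ∘ suc) a) (X zero ⊚_) k) F)
    onto zero    m = powers-suc (X ∘ suc) (λ i j → comm (suc i) (suc j)) i a F m
    onto (suc k) m = trans (fncong (X zero) (onto k) m) (comm zero (suc i) _ m)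

  record Exterior {m I} (Θ : Fin m → Lin I I) : Set (c ⊔ ℓ) where
    field
      anti   : ∀ i j → Anticommute (Θ i) (Θ j)
      square : ∀ i F → fn (Θ i) (fn (Θ i) F) ≗ 𝟘

  exterior-suc : ∀ {m I} {Θ : Fin (suc m) → Lin I I} → Exterior Θ → Exterior (Θ ∘ suc)
  exterior-suc e = record { anti = λ i j → Exterior.anti e (suc i) (suc j) ; square = λ i → Exterior.square e (suc i) }

  fn-neg : ∀ {I J} (T : Lin I J) F → fn T (λ i → - F i) ≗ λ j → - fn T F j
  fn-neg T F j = trans (fncong T (λ i → sym (-1*x≈-x (F i))) j) (trans (fn-⊡ T (- 1#) F j) (-1*x≈-x _))

  fn-when : ∀ {I J} (T : Lin I J) b F → fn T (λ i → when b (F i)) ≗ λ j → when b (fn T F j)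
  fn-when T true  F j = refl
  fn-when T false F j = fn-𝟘 T j

  -- Passing the smaller elements of J produces the sign. If i already lies in J, this brings Θᵢ
  -- next to its copy, where the square vanishes.
  wedge-insert : ∀ {m I} {Θ : Fin m → Lin I I} → Exterior Θ → ∀ i J F x →
    fn (Θ i) (fn (wedge Θ J) F) x ≈ when (not (lookup J i)) (sign i J * fn (wedge Θ (flip i J)) F x)
  wedge-insert ext zero (inside ∷ J)  F x = Exterior.square ext zero _ x
  wedge-insert ext zero (outside ∷ J) F x = sym (*-identityˡ _)
  wedge-insert ext (suc i) (outside ∷ J) F x = wedge-insert (exterior-suc ext) i J F x
  wedge-insert {Θ = Θ} ext (suc i) (inside ∷ J)  F x = trans (Exterior.anti ext (suc i) zero _ x)
    (trans (-‿cong (trans (fncong (Θ zero) (wedge-insert (exterior-suc ext) i J F) x) (trans (fn-when (Θ zero) b _ x)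
        (when-cong b (fn-⊡ (Θ zero) _ _ x)))))
      (trans (sym (when-neg b _)) (when-cong b (-‿distribˡ-* _ _))))
    where
    b : Bool
    b = not (lookup J i)

  -- The relations of Ω, which make `apply X Θ` an action of the algebra. Instances are derivatives,
  -- multiplications, multiplications moved by a group element, shifts with the θ acting by zero,
  -- and values at a point.
  record Generators {n I} (X Θ : Fin n → Lin I I) : Set (c ⊔ ℓ) where
    field
      commute  : ∀ i j → Commute (X i) (X j)
      mixed    : ∀ i j → Commute (Θ i) (X j)
      exterior : Exterior Θ

  module _ {n I} {X Θ : Fin n → Lin I I} (gens : Generators X Θ) where
    open Generators gens

    apply-mulˣ : ∀ i f F → fn (apply X Θ (mulˣ i f)) F ≗ fn (X i) (fn (apply X Θ f) F)
    apply-mulˣ i [] F m = sym (fn-𝟘 (X i) m)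
    apply-mulˣ i ((k , a , J) ∷ f) F m = trans (+-cong
      (trans (*-cong (*-identityʳ k) (powers-suc X commute i a _ m)) (sym (fn-⊡ (X i) k _ m)))
      (apply-mulˣ i f F m)) (sym (fn-⊞ (X i) _ _ m))

    apply-toggled : ∀ i k a J F → fn (apply X Θ (k · toggled true i (a , J))) F ≗
      fn (Θ i) (k ⊡ fn (monomial X Θ (a , J)) F)
    apply-toggled i k a J F m = trans (value (not (lookup J i))) (sym (trans (fn-⊡ (Θ i) k _ m)
      (*-congˡ (trans (intertwine-powers (Θ i) X X (mixed i) a _ m)
        (trans (fncong (powers X a) (wedge-insert exterior i J F) m)
            (trans (fn-when (powers X a) (not (lookup J i)) _ m)
          (when-cong (not (lookup J i)) (fn-⊡ (powers X a) _ _ m))))))))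
      where
      value : ∀ b → fn (apply X Θ (k · (if b then (sign i J , a , flip i J) ∷ [] else []))) F m ≈
        k * when b (sign i J * fn (powers X a) (fn (wedge Θ (flip i J)) F) m)
      value false = sym (zeroʳ k)
      value true  = trans (+-identityʳ _) (*-assoc _ _ _)

    apply-mulᶿ : ∀ i f F → fn (apply X Θ (mulᶿ i f)) F ≗ fn (Θ i) (fn (apply X Θ f) F)
    apply-mulᶿ i [] F m = sym (fn-𝟘 (Θ i) m)
    apply-mulᶿ i ((k , a , J) ∷ f) F m = trans (reflexive (≡.cong (λ g → fn (apply X Θ g) F m) (mulᶿ-∷ i k a J f)))
      (trans (apply-+ X Θ (k · toggled true i (a , J)) (mulᶿ i f) F m) (trans (+-cong
      (apply-toggled i k a J F m) (apply-mulᶿ i f F m)) (sym (fn-⊞ (Θ i) _ _ m))))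

    apply-* : ∀ f g F → fn (apply X Θ (f *Ω g)) F ≗ fn (apply X Θ f) (fn (apply X Θ g) F)
    apply-* f g F = interpret (λ f → fn (apply X Θ f) F) (λ i → refl) (λ f g → apply-+ X Θ f g F)
      (λ k f → apply-· X Θ k f F) mulˣ mulᶿ X Θ (λ i f → apply-mulˣ i f F) (λ i f → apply-mulᶿ i f F) f g

  powers-0 : ∀ {m I} (X : Fin m → Lin I I) F → fn (powers X (Vec.replicate m 0)) F ≗ F
  powers-0 {zero}  X F i = refl
  powers-0 {suc m} X F i = powers-0 (X ∘ suc) F i

  wedge-⊥ : ∀ {m I} (Θ : Fin m → Lin I I) F → fn (wedge Θ ⊥) F ≗ F
  wedge-⊥ {zero}  Θ F i = refl
  wedge-⊥ {suc m} Θ F i = wedge-⊥ (Θ ∘ suc) F i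

  apply-1 : ∀ {n I} (X Θ : Fin n → Lin I I) F → fn (apply X Θ 1Ω) F ≗ F
  apply-1 {n} X Θ F i = trans (+-identityʳ _) (trans (*-identityˡ _)
    (trans (fncong (powers X (Vec.replicate n 0)) (wedge-⊥ Θ F) i) (powers-0 X F i)))

  -- A Leibniz rule: moving R past f leaves the contraction ∂ᶿᵢ f.
  module _ {I} (R α : Lin I I) where
    wedge-contract : ∀ {m} (Θ : Fin m → Lin I I) i →
      (∀ F → fn (Θ i) (fn R F) ≗ fn R (fn (Θ i) F) ⊞ fn α F) → (∀ k → k ≢ i → Commute (Θ k) R) →
      (∀ k → Anticommute (Θ k) α) → ∀ J F x →
      fn (wedge Θ J) (fn R F) x ≈
      fn R (fn (wedge Θ J) F) x + when (lookup J i) (sign i J * fn α (fn (wedge Θ (flip i J)) F) x)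
    wedge-contract Θ zero same elsewhere anti (b ∷ J) F x with b
    ... | false = trans tail (sym (+-identityʳ _))
      where
      tail : fn (wedge (Θ ∘ suc) J) (fn R F) x ≈ fn R (fn (wedge (Θ ∘ suc) J) F) x
      tail = sym (intertwine-wedge R (Θ ∘ suc) (Θ ∘ suc) (λ i F j → sym (elsewhere (suc i) (λ ()) F j)) J F x)
    ... | true = trans (fncong (Θ zero) (λ y → sym (intertwine-wedge R (Θ ∘ suc) (Θ ∘ suc)
          (λ i F j → sym (elsewhere (suc i) (λ ()) F j)) J F y)) x)
      (trans (same _ x) (+-congˡ (sym (*-identityˡ _))))
    wedge-contract Θ (suc i) same elsewhere anti (b ∷ J) F x
      with wedge-contract (Θ ∘ suc) i same (λ k k≢i → elsewhere (suc k) (k≢i ∘ Fin.suc-injective))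
          (λ k → anti (suc k)) J F | b
    ... | rec | false = rec x
    ... | rec | true = trans (fncong (Θ zero) rec x) (trans (fn-⊞ (Θ zero) _ _ x) (+-cong (elsewhere zero (λ ()) _ x)
      (trans (fn-when (Θ zero) (lookup J i) _ x) (when-cong (lookup J i) (trans (fn-⊡ (Θ zero) _ _ x)
        (trans (*-congˡ (anti zero _ x)) (trans (sym (-‿distribʳ-* _ _)) (-‿distribˡ-* _ _))))))))

    -- Used twice, with α the parity involution: once for R right multiplication by θᵢ among
    -- contractions, once for R a rescaled contraction among multiplications moved by a group
    -- element.
    apply-contract : ∀ {n} (X Θ : Fin n → Lin I I) i → (∀ k → Commute R (X k)) → (∀ k → Commute α (X k)) →
      (∀ F → fn (Θ i) (fn R F) ≗ fn R (fn (Θ i) F) ⊞ fn α F) → (∀ k → k ≢ i → Commute (Θ k) R) →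
      (∀ k → Anticommute (Θ k) α) → ∀ f F →
      fn (apply X Θ f) (fn R F) ≗ fn R (fn (apply X Θ f) F) ⊞ fn α (fn (apply X Θ (∂ᶿ i f)) F)
    apply-contract X Θ i RX αX same elsewhere anti [] F x =
      sym (trans (+-cong (fn-𝟘 R x) (fn-𝟘 α x)) (+-identityˡ 0#))
    apply-contract X Θ i RX αX same elsewhere anti ((k , a , J) ∷ f) F x = trans
      (+-cong (trans (*-congˡ (trans (fncong (powers X a) (wedge-contract Θ i same elsewhere anti J F) x)
          (trans (fn-⊞ (powers X a) _ _ x) (+-cong (sym (intertwine-powers R X X RX a _ x))
            (trans (fn-when (powers X a) b _ x) (when-cong b (trans (fn-⊡ (powers X a) _ _ x)
              (*-congˡ (sym (intertwine-powers α X X αX a _ x))))))))))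
          (distribˡ k _ _))
        (apply-contract X Θ i RX αX same elsewhere anti f F x))
      (trans (+-interchange _ _ _ _) (+-cong
        (trans (+-congʳ (sym (fn-⊡ R k _ x))) (sym (fn-⊞ R _ _ x)))
        (sym (trans (reflexive (≡.cong (λ g → fn α (fn (apply X Θ g) F) x) (∂ᶿ-∷ i k a J f)))
          (trans (fncong α (apply-+ X Θ (k · toggled false i (a , J)) (∂ᶿ i f) F) x) (trans (fn-⊞ α _ _ x)
            (+-congʳ (value (lookup J i)))))))))
      where
      b : Bool
      b = lookup J i
      value : ∀ b → fn α (fn (apply X Θ (k · (if b then (sign i J , a , flip i J) ∷ [] else []))) F) x ≈
        k * when b (sign i J * fn α (fn (powers X a) (fn (wedge Θ (flip i J)) F)) x)
      value false = trans (fn-𝟘 α x) (sym (zeroʳ k))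
      value true  = trans (fncong α (λ y → trans (+-identityʳ _) (*-assoc k _ _)) x)
        (trans (fn-⊡ α k _ x) (*-congˡ (fn-⊡ α _ _ x)))

  -- Elements of the ideal need not be homogeneous in the θ, so the sign from moving the parity
  -- involution past f varies from term to term.
  conjugate : ∀ {n} → Ω n → Ω n
  conjugate = map λ (k , a , J) → parity J * k , a , J

  module _ {I} (α : Lin I I) (involutive : ∀ F → fn α (fn α F) ≗ F) where
    wedge-conjugate : ∀ {m} (Θ : Fin m → Lin I I) → (∀ k → Anticommute (Θ k) α) → ∀ J F →
      fn (wedge Θ J) (fn α F) ≗ parity J ⊡ fn α (fn (wedge Θ J) F)
    wedge-conjugate Θ anti []            F x = sym (*-identityˡ _)
    wedge-conjugate Θ anti (outside ∷ J) F x = wedge-conjugate (Θ ∘ suc) (anti ∘ suc) J F x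
    wedge-conjugate Θ anti (inside ∷ J)  F x = trans (fncong (Θ zero) (wedge-conjugate (Θ ∘ suc) (anti ∘ suc) J F) x)
      (trans (fn-⊡ (Θ zero) _ _ x) (trans (*-congˡ (anti zero _ x))
          (trans (sym (-‿distribʳ-* _ _)) (-‿distribˡ-* _ _))))

    apply-conjugate : ∀ {n} (X Θ : Fin n → Lin I I) → (∀ k → Commute α (X k)) →
      (∀ k → Anticommute (Θ k) α) → ∀ f F →
      fn (apply X Θ f) (fn α F) ≗ fn α (fn (apply X Θ (conjugate f)) F)
    apply-conjugate X Θ αX anti [] F x = sym (fn-𝟘 α x)
    apply-conjugate X Θ αX anti ((k , a , J) ∷ f) F x = trans
      (+-cong (trans (*-congˡ (trans (fncong (powers X a) (wedge-conjugate Θ anti J F) x)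
          (trans (fn-⊡ (powers X a) _ _ x) (*-congˡ (sym (intertwine-powers α X X αX a _ x))))))
          (trans (sym (*-assoc _ _ _)) (trans (*-congʳ (*-comm _ _)) (sym (fn-⊡ α _ _ x)))))
        (apply-conjugate X Θ αX anti f F x))
      (sym (fn-⊞ α _ _ x))

  open CMSum +-commutativeMonoid public using (sum; sum-cong-≋; ∑-distrib-+; sum-permute)

  fn-sum : ∀ {m I J} (T : Lin I J) (F : Fin m → Fn I) → fn T (λ x → sum (λ i → F i x)) ≗ λ y → sum (λ i → fn T (F i) y)
  fn-sum {zero}  T F y = fn-𝟘 T y
  fn-sum {suc m} T F y = trans (fn-⊞ T _ _ y) (+-congˡ (fn-sum T (F ∘ suc) y))

  sumL : ∀ {m I J} → (Fin m → Lin I J) → Lin I J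
  sumL {zero}  T = zeroL
  sumL {suc m} T = addL (T zero) (sumL (T ∘ suc))

  fn-sumL : ∀ {m I J} (T : Fin m → Lin I J) F → fn (sumL T) F ≗ λ x → sum (λ i → fn (T i) F x)
  fn-sumL {zero}  T F x = refl
  fn-sumL {suc m} T F x = +-congˡ (fn-sumL (T ∘ suc) F x)

  sum-zero : ∀ {m} (F : Fin m → Carrier) → (∀ i → F i ≈ 0#) → sum F ≈ 0#
  sum-zero {zero}  F z = refl
  sum-zero {suc m} F z = trans (+-cong (z zero) (sum-zero (F ∘ suc) (z ∘ suc))) (+-identityˡ 0#)

  π-∑ : ∀ {n I} (π : Ω n → Fn I) → π 0Ω ≗ 𝟘 → (∀ f g → π (f +Ω g) ≗ π f ⊞ π g) →
    (F : Fin n → Ω n) → π (∑Ω F) ≗ λ x → sum (λ i → π (F i) x)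
  π-∑ {n} π π-0 π-+ F = go F
    where
    go : ∀ {m} (F : Fin m → Ω n) → π (foldr (λ i → F i +Ω_) 0Ω (allFin m)) ≗ λ x → sum (λ i → π (F i) x)
    go {zero}  F x = π-0 x
    go {suc m} F x = trans (reflexive (≡.cong (λ f → π f x) (foldr-allFin (λ i → F i +Ω_) 0Ω)))
      (trans (π-+ _ _ x) (+-congˡ (go (F ∘ suc) x)))

  iterate : {I : Set} → Lin I I → ℕ → Lin I I
  iterate T m = fold idL (T ⊚_) m

  π-iterate : ∀ {n I} (π : Ω n → Fn I) (X′ : Ω n → Ω n) (X : Lin I I) → (∀ f → π (X′ f) ≗ fn X (π f)) →
    ∀ m f → π (fold f X′ m) ≗ fn (iterate X m) (π f)
  π-iterate π X′ X e zero    f i = refl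
  π-iterate π X′ X e (suc m) f i = trans (e _ i) (fncong X (π-iterate π X′ X e m f) i)

  lower-gens : ∀ {n} → Generators {n} lower (toggle false)
  lower-gens = record
    { commute = lower-comm
    ; mixed = λ i j F m → refl
    ; exterior = record { anti = toggle-anti-self false ; square = toggle-square false }
    }

  raise-gens : ∀ {n} → Generators {n} raise (toggle true)
  raise-gens = record
    { commute = raise-comm
    ; mixed = λ i j F m → sym (raise-toggle j true i F m)
    ; exterior = record { anti = toggle-anti-self true ; square = toggle-square true }
    }

  infixr 7 _⊛_ _✶_
  _⊛_ _✶_ : ∀ {n} → Ω n → Dual {n} → Dual {n}
  f ⊛ F = fn (apply lower (toggle false) f) F
  f ✶ F = fn (apply raise (toggle true) f) F

  𝟙 : ∀ {n} → Dual {n}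
  𝟙 = hat 1Ω

  subset-cases : ∀ {n} (J : Subset n) → J ≡ ⊥ ⊎ ∃₂ λ i B → lookup B i ≡ false × J ≡ flip i B × Subset.∣ J ∣ ≡ suc
      Subset.∣ B ∣
  subset-cases [] = inj₁ ≡.refl
  subset-cases (inside ∷ J) = inj₂ (zero , outside ∷ J , ≡.refl , ≡.refl , ≡.refl)
  subset-cases (outside ∷ J) with subset-cases J
  ... | inj₁ e = inj₁ (≡.cong (outside ∷_) e)
  ... | inj₂ (i , B , e , e′ , e″) = inj₂ (suc i , outside ∷ B , e , ≡.cong (outside ∷_) e′ , e″)

  exponent-cases : ∀ {n} (a : Vec ℕ n) → a ≡ Vec.replicate n 0 ⊎ ∃₂ λ b i → a ≡ b [ i ]%= suc × Vec.sum a ≡ suc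
      (Vec.sum b)
  exponent-cases [] = inj₁ ≡.refl
  exponent-cases (suc k ∷ a) = inj₂ (k ∷ a , zero , ≡.refl , ≡.refl)
  exponent-cases (zero ∷ a) with exponent-cases a
  ... | inj₁ e = inj₁ (≡.cong (0 ∷_) e)
  ... | inj₂ (b , i , e , e′) = inj₂ (0 ∷ b , suc i , ≡.cong (0 ∷_) e , e′)

  wedge-𝟙 : ∀ {n} (J : Subset n) → fn (wedge (toggle true) J) 𝟙 ≗ δ-basis (Vec.replicate n 0 , J)
  wedge-𝟙 {n} J = go Subset.∣ J ∣ J ≡.refl
    where
    go : ∀ k (J : Subset n) → Subset.∣ J ∣ ≡ k → fn (wedge (toggle true) J) 𝟙 ≗ δ-basis (Vec.replicate n 0 , J)
    go k J e x with subset-cases J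
    go k J e x | inj₁ ≡.refl = wedge-⊥ (toggle true) 𝟙 x
    go zero J e x | inj₂ (_ , _ , _ , _ , e″) with () ← ≡.trans (≡.sym e) e″
    go (suc k) J e x | inj₂ (i , B , Bi , ≡.refl , e″) = trans
      (trans (sym (*-identityˡ _)) (*-congʳ (sym (sign-square i B))))
      (trans (*-assoc _ _ _) (trans (*-congˡ (trans
        (trans (reflexive (≡.cong (λ b → when (not b) (sign i B * fn (wedge (toggle true) (flip i B)) 𝟙 x)) (≡.sym Bi)))
          (sym (wedge-insert (Generators.exterior raise-gens) i B 𝟙 x)))
        (trans (fncong (toggle true i) (go k B (ℕ.suc-injective (≡.trans (≡.sym e″) e))) x)
          (trans (sym (hat-toggled true i (Vec.replicate n 0 , B) x))
            (trans (reflexive (≡.cong (λ b → hat (if not b then (sign i B , Vec.replicate n 0 , flip i B) ∷ [] else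
                []) x) Bi))
              (trans (hat-∷ (sign i B) (Vec.replicate n 0 , flip i B) [] x)
                  (trans (+-congˡ (hat-0 x)) (+-identityʳ _))))))))
      (trans (sym (*-assoc _ _ _)) (trans (*-congʳ (sign-square i B)) (*-identityˡ _)))))

  monomial-𝟙 : ∀ {n} (m : Monomial n) → fn (monomial raise (toggle true) m) 𝟙 ≗ δ-basis m
  monomial-𝟙 {n} (a , J) = go (Vec.sum a) a ≡.refl
    where
    go : ∀ k a → Vec.sum a ≡ k → fn (powers raise a) (fn (wedge (toggle true) J) 𝟙) ≗ δ-basis (a , J)
    go k a e x with exponent-cases a
    go k a e x | inj₁ ≡.refl = trans (powers-0 raise _ x) (wedge-𝟙 J x)
    go zero a e x | inj₂ (_ , _ , _ , e′) with () ← ≡.trans (≡.sym e) e′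
    go (suc k) a e x | inj₂ (b , i , ≡.refl , e′) = trans (powers-suc raise raise-comm i b _ x)
      (trans (fncong (raise i) (go k b (ℕ.suc-injective (≡.trans (≡.sym e′) e))) x)
        (trans (sym (hat-mulˣ i ((1# , b , J) ∷ []) x)) (trans (hat-∷ (1# * 1#) (b [ i ]%= suc , J) [] x)
          (trans (+-cong (trans (*-congʳ (*-identityˡ 1#)) (*-identityˡ _)) (hat-0 x)) (+-identityʳ _)))))

  -- Recovers f from its action on 1, which allows right multiplication and the group action to be
  -- computed by commuting operators.
  ✶-𝟙 : ∀ {n} (f : Ω n) → f ✶ 𝟙 ≗ hat f
  ✶-𝟙 [] x = sym (hat-0 x)
  ✶-𝟙 ((k , m) ∷ f) x = trans (+-cong (*-congˡ (monomial-𝟙 m x)) (✶-𝟙 f x)) (sym (hat-∷ k m f x))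

  involute-𝟙 : ∀ {n} → fn involute (𝟙 {n}) ≗ 𝟙
  involute-𝟙 {n} (a , J) with (a , J) ≟ᵐ (Vec.replicate n 0 , ⊥)
  ... | yes ≡.refl = trans (*-congʳ (parity-⊥ n)) (*-identityˡ _)
    where
    parity-⊥ : ∀ n → parity (⊥ {n}) ≈ 1#
    parity-⊥ zero    = refl
    parity-⊥ (suc n) = parity-⊥ n
  ... | no _ = trans (*-congˡ (trans (*-congˡ (+-identityʳ 0#)) (zeroʳ _)))
                 (trans (zeroʳ _) (sym (trans (*-congˡ (+-identityʳ 0#)) (zeroʳ _))))

  neg-swap : ∀ {a b} → a ≈ - b → b ≈ - a
  neg-swap e = trans (sym (-‿involutive _)) (-‿cong (sym e))

  -- Euler operators and inverse systems.

  module _ {n : ℕ} where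
    -- Right multiplication by θᵢ; involute accounts for moving θᵢ to the front.
    rightMul : Fin n → Lin (Monomial n) (Monomial n)
    rightMul i = toggle true i ⊚ involute

    -- Two sign changes cancel, one from anticommuting with θᵢ and one from the parity involution.
    rightMul-toggle : ∀ b i k → Anticommute (toggle b k) (toggle true i) → Commute (toggle b k) (rightMul i)
    rightMul-toggle b i k anti F x = trans (anti (fn involute F) x)
      (trans (-‿cong (trans (fncong (toggle true i) (toggle-involute b k F) x)
          (fn-neg (toggle true i) (fn involute (fn (toggle b k) F)) x)))
        (-‿involutive _))

    hat-*θ : ∀ i (g : Ω n) → hat (g *Ω θΩ i) ≗ fn (rightMul i) (hat g)
    hat-*θ i g x = trans (hat-* g (θΩ i) x) (trans
      (fncong (apply raise (toggle true) g) (λ y → trans (hat-mulᶿ i 1Ω y)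
        -- The involution fixes 1, so θᵢ can be read as right multiplication applied to 1, which
        -- then commutes past g.
        (fncong (toggle true i) (λ z → sym (involute-𝟙 z)) y)) x)
      (trans (sym (intertwine-apply (rightMul i) raise (toggle true) raise (toggle true)
          (λ j F y → trans (fncong (toggle true i) (λ z → sym (raise-involute j F z)) y)
            (sym (raise-toggle j true i (fn involute F) y)))
          (λ k F y → sym (rightMul-toggle true i k (toggle-anti-self true k i) F y)) g 𝟙 x))
        (fncong (rightMul i) (✶-𝟙 g) x)))

    euler : ℕ → Lin (Monomial n) (Monomial n)
    euler j = sumL λ i → rightMul i ⊚ iterate (lower i) j

    fn-euler : ∀ j F → fn (euler j) F ≗ λ x → sum (λ i → fn (rightMul i) (fn (iterate (lower i) j) F) x)
    fn-euler j F x = fn-sumL (λ i → rightMul i ⊚ iterate (lower i) j) F x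

    hat-d : ∀ j (g : Ω n) → hat (dΩ j g) ≗ fn (euler j) (hat g)
    hat-d j g x = trans (π-∑ hat hat-0 hat-+ (λ i → fold g (∂ i) j *Ω θΩ i) x)
      (trans (sum-cong-≋ λ i → trans (hat-*θ i (fold g (∂ i) j) x)
        (fncong (rightMul i) (π-iterate hat (∂ i) (lower i) (hat-∂ i) j g) x)) (sym (fn-euler j (hat g) x)))

    derive : ℕ → Ω n → Ω n
    derive j f = ∑Ω λ i → fold (∂ᶿ i f) (mulˣ i) j

    apply-∑iterate : ∀ {I} {X Θ : Fin n → Lin I I} → Generators X Θ → ∀ j (B : Fin n → Ω n) F →
      fn (apply X Θ (∑Ω λ i → fold (B i) (mulˣ i) j)) F ≗
      λ x → sum (λ i → fn (iterate (X i) j) (fn (apply X Θ (B i)) F) x)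
    apply-∑iterate {X = X} {Θ} gens j B F x = trans
      (π-∑ (λ f → fn (apply X Θ f) F) (λ _ → refl) (λ f g → apply-+ X Θ f g F) (λ i → fold (B i) (mulˣ i) j) x)
      (sum-cong-≋ λ i → π-iterate (λ f → fn (apply X Θ f) F) (mulˣ i) (X i) (λ f → apply-mulˣ gens i f F) j (B i) x)

    ⊛-lower : ∀ (i : Fin n) (f : Ω n) F → f ⊛ fn (lower i) F ≗ fn (lower i) (f ⊛ F)
    ⊛-lower i f F x = sym (intertwine-apply (lower i) lower (toggle false) lower (toggle false)
      (λ j → lower-comm i j) (λ j F y → refl) f F x)

    ⊛-iterate : ∀ (i : Fin n) j (f : Ω n) F → f ⊛ fn (iterate (lower i) j) F ≗ fn (iterate (lower i) j) (f ⊛ F)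
    ⊛-iterate i zero    f F x = refl
    ⊛-iterate i (suc j) f F x = trans (⊛-lower i f _ x) (fncong (lower i) (⊛-iterate i j f F) x)

    ⊛-rightMul : ∀ (i : Fin n) (f : Ω n) F → f ⊛ fn (rightMul i) F ≗ fn (rightMul i) (f ⊛ F) ⊞ fn involute (∂ᶿ i f ⊛ F)
    ⊛-rightMul i f F = apply-contract (rightMul i) involute lower (toggle false) i
      (λ k F x → refl) (λ k F x → refl)
      same
      (λ k k≢i → rightMul-toggle false i k (toggle-anti false true k≢i))
      (λ k → toggle-involute false k) f F

      where
      same : ∀ F → fn (toggle false i) (fn (rightMul i) F) ≗ fn (rightMul i) (fn (toggle false i) F) ⊞ fn involute F
      same F x = trans (sym (trans (+-assoc p q (- q)) (trans (+-congˡ (-‿inverseʳ q)) (+-identityʳ p))))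
        (trans (+-congʳ (toggle-toggle i (fn involute F) x)) (trans (+-comm _ _) (+-congʳ (sym
          (trans (fncong (toggle true i) {G = λ y → - fn (toggle false i) (fn involute F) y}
              (λ y → neg-swap (toggle-involute false i F y)) x)
            (fn-neg (toggle true i) (fn (toggle false i) (fn involute F)) x))))))
        where
        p q : Carrier
        p = fn (toggle false i) (fn (rightMul i) F) x
        q = fn (toggle true i) (fn (toggle false i) (fn involute F)) x

    ⊛-euler : ∀ j (f : Ω n) F → f ⊛ fn (euler j) F ≗ fn (euler j) (f ⊛ F) ⊞ fn involute (derive j f ⊛ F)
    ⊛-euler j f F x = trans (fncong (apply lower (toggle false) f) (fn-euler j F) x)
      (trans (fn-sum (apply lower (toggle false) f) (λ i → fn (rightMul i ⊚ iterate (lower i) j) F) x)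
      (trans (sum-cong-≋ λ i → trans (⊛-rightMul i f (fn (iterate (lower i) j) F) x) (+-cong
          (fncong (rightMul i) {f ⊛ fn (iterate (lower i) j) F} {fn (iterate (lower i) j) (f ⊛ F)} (⊛-iterate i j f F)
              x)
          (fncong involute {∂ᶿ i f ⊛ fn (iterate (lower i) j) F} {fn (iterate (lower i) j) (∂ᶿ i f ⊛ F)}
            (⊛-iterate i j (∂ᶿ i f) F) x)))
        (trans (∑-distrib-+ (λ i → fn (rightMul i) (fn (iterate (lower i) j) (f ⊛ F)) x)
            (λ i → fn involute (fn (iterate (lower i) j) (∂ᶿ i f ⊛ F)) x))
          (+-cong (sym (fn-euler j (f ⊛ F) x)) (sym (trans
            (fncong involute (apply-∑iterate lower-gens j (λ i → ∂ᶿ i f) F) x)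
            (fn-sum involute (λ i → fn (iterate (lower i) j) (∂ᶿ i f ⊛ F)) x)))))))

    module _ {p} {P : Pred (Ω n) p} where

      perp-generators : ∀ {g} → (Ideal P ^⊥) g → ∀ {f} → P f → ∀ h → f ⊛ h ⊛ hat g ≗ 𝟘
      perp-generators {g} g∈ {f} f∈P h x = trans (sym (apply-* lower-gens f h (hat g) x))
        (trans (sym (hat-⊙ (f *Ω h) g x)) (trans (hat-resp {f = (f *Ω h) ⊙ g} {0Ω} (g∈ (*-closedʳ h (gen f∈P))) x)
            (hat-0 x)))

      -- The element h between f and g absorbs right multiples of a generator; left multiples merely
      -- apply one more operator to zero.
      generators-perp : ∀ {g} → (∀ {f} → P f → ∀ h → f ⊛ h ⊛ hat g ≗ 𝟘) → (Ideal P ^⊥) g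
      generators-perp {g} kills {f} f∈ = hat-injective {f = f ⊙ g} {0Ω} λ x → trans (hat-⊙ f g x)
        (trans (fncong (apply lower (toggle false) f) (λ y → sym (apply-1 lower (toggle false) (hat g) y)) x)
          (trans (ideal-kills f∈ 1Ω x) (sym (hat-0 x))))
        where
        ideal-kills : ∀ {f} → Ideal P f → ∀ h → f ⊛ h ⊛ hat g ≗ 𝟘
        ideal-kills (gen f∈P) h x = kills f∈P h x
        ideal-kills 0-closed h x = refl
        ideal-kills (+-closed {f} {f′} p q) h x = trans (apply-+ lower (toggle false) f f′ _ x)
          (trans (+-cong (ideal-kills p h x) (ideal-kills q h x)) (+-identityˡ 0#))
        ideal-kills (*-closedˡ h′ {f} p) h x = trans (apply-* lower-gens h′ f _ x)
          (fn-zero (apply lower (toggle false) h′) (ideal-kills p h) x)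
        ideal-kills (*-closedʳ h′ {f} p) h x = trans (apply-* lower-gens f h′ _ x)
          (trans (fncong (apply lower (toggle false) f) (λ y → sym (apply-* lower-gens h′ h (hat g) y)) x)
            (ideal-kills p (h′ *Ω h) x))
        ideal-kills (≈-closed {f} {f′} e p) h x = trans (sym (apply-resp lower (toggle false) {f} {f′} e _ x))
            (ideal-kills p h x)

      perp-hat : ∀ {g} → (Ideal P ^⊥) g → ∀ {f} → Ideal P f → f ⊛ hat g ≗ 𝟘
      perp-hat {g} g∈ {f} f∈ x = trans (sym (hat-⊙ f g x)) (trans (hat-resp {f = f ⊙ g} {0Ω} (g∈ f∈) x) (hat-0 x))

      hat-perp : ∀ {g} → (∀ {f} → Ideal P f → f ⊛ hat g ≗ 𝟘) → (Ideal P ^⊥) g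
      hat-perp {g} kills {f} f∈ = hat-injective {f = f ⊙ g} {0Ω} λ x →
        trans (hat-⊙ f g x) (trans (kills f∈ x) (sym (hat-0 x)))

      perp-subspace : IsSubspace (Ideal P ^⊥)
      perp-subspace = record
        { respects-≈ = λ {g} {g′} e g∈ → hat-perp {g′} λ {f} f∈ x →
            trans (sym (fncong (apply lower (toggle false) f) (hat-resp {f = g} {g′} e) x)) (perp-hat {g} g∈ f∈ x)
        ; 0∈V = hat-perp {0Ω} λ {f} f∈ → fn-zero (apply lower (toggle false) f) hat-0
        ; +∈V = λ {g} {g′} p q → hat-perp {g +Ω g′} λ {f} f∈ x → trans
            (fncong (apply lower (toggle false) f) (hat-+ g g′) x) (trans (fn-⊞ (apply lower (toggle false) f) _ _ x)
              (trans (+-cong (perp-hat {g} p f∈ x) (perp-hat {g′} q f∈ x)) (+-identityˡ 0#)))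
        ; ·∈V = λ k {g} p → hat-perp {k · g} λ {f} f∈ x → trans
            (fncong (apply lower (toggle false) f) (hat-· k g) x) (trans (fn-⊡ (apply lower (toggle false) f) _ _ x)
              (trans (*-congˡ (perp-hat {g} p f∈ x)) (zeroʳ k)))
        }

      perp-∂ : ∀ i {g} → (Ideal P ^⊥) g → (Ideal P ^⊥) (∂ i g)
      perp-∂ i {g} g∈ = hat-perp {∂ i g} λ {f} f∈ x → trans
          (fncong (apply lower (toggle false) f) {hat (∂ i g)} {fn (lower i) (hat g)} (hat-∂ i g) x)
        (trans (⊛-lower i f (hat g) x) (perp-hat {g} g∈ f∈ (proj₁ x [ i ]%= suc , proj₂ x)))

      -- Applying `⊛-euler` for h and then for f leaves three terms: d_j of f h g, the contraction
      -- of f applied to h g, and f applied to an involuted element. Moving the involution past f in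
      -- the last one replaces f by its conjugate, so each term involves a generator acting on a
      -- multiple of g.
      perp-d : ∀ j → (∀ {f} → P f → P (derive j f)) → (∀ {f} → P f → P (conjugate f)) →
        ∀ {g} → (Ideal P ^⊥) g → (Ideal P ^⊥) (dΩ j g)
      perp-d j derives conjugates {g} g∈ = generators-perp {dΩ j g} λ {f} f∈P h x → trans
        (fncong (apply lower (toggle false) f) (λ y → trans (fncong (apply lower (toggle false) h) (hat-d j g) y)
          (⊛-euler j h (hat g) y)) x)
        (trans (fn-⊞ (apply lower (toggle false) f) _ _ x) (trans (+-cong
          (trans (⊛-euler j f (h ⊛ hat g) x) (trans (+-cong
            (fn-zero (euler j) (perp-generators {g} g∈ f∈P h) x)
            (fn-zero involute (perp-generators {g} g∈ (derives f∈P) h) x)) (+-identityˡ 0#)))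
          (trans (apply-conjugate involute involute-involute lower (toggle false) (λ k F y → refl)
              (λ k → toggle-involute false k) f (derive j h ⊛ hat g) x)
            (fn-zero involute (perp-generators {g} g∈ (conjugates f∈P) (derive j h)) x))) (+-identityˡ 0#)))

  scale-commute : ∀ {I} k l {S T : Lin I I} → Commute S T → Commute (scaleL k S) (scaleL l T)
  scale-commute k l {S} {T} comm F x = trans (*-congˡ (fn-⊡ S l _ x)) (trans (*-swap _ _ _)
    (*-congˡ (trans (*-congˡ (comm F x)) (sym (fn-⊡ T k _ x)))))

  scale-anticommute : ∀ {I} k l {S T : Lin I I} → Anticommute S T → Anticommute (scaleL k S) (scaleL l T)
  scale-anticommute k l {S} {T} anti F x = trans (*-congˡ (fn-⊡ S l _ x)) (trans (*-swap _ _ _)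
    (trans (*-congˡ (trans (*-congˡ (anti F x)) (trans (sym (-‿distribʳ-* _ _)) (-‿cong (sym (fn-⊡ T k _ x))))))
      (sym (-‿distribʳ-* _ _))))

  iterate-scale : ∀ {I} k (T : Lin I I) j F → fn (iterate (scaleL k T) j) F ≗ k ^ j ⊡ fn (iterate T j) F
  iterate-scale k T zero    F x = sym (*-identityˡ _)
  iterate-scale k T (suc j) F x = trans (*-congˡ (trans (fncong T (iterate-scale k T j F) x) (fn-⊡ T _ _ x)))
    (sym (*-assoc _ _ _))

  hat-origin : ∀ {n} (f : Ω n) → hat f (Vec.replicate n 0 , ⊥) ≈ constantTerm f
  hat-origin {n} f = trans (*-congʳ (factorial-0 n)) (*-identityˡ _)
    where
    factorial-0 : ∀ n → factorial (Vec.replicate n 0) ≈ 1#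
    factorial-0 zero    = refl
    factorial-0 (suc n) = trans (*-congʳ (+-identityʳ 1#)) (trans (*-identityˡ _) (factorial-0 n))

  raise-origin : ∀ {n} (i : Fin n) F J → fn (raise i) F (Vec.replicate n 0 , J) ≈ 0#
  raise-origin {n} i F J = trans (*-congʳ (reflexive (≡.cong (_×′ 1#) (Vec.lookup-replicate i 0)))) (zeroˡ _)

  -- Invariants of the wreath product.

  module Invariance {n : ℕ} (r′ : ℕ) (ζ : Carrier) (root : ζ ^ suc r′ ≈ 1#) where

    private
      r : ℕ
      r = suc r′

    root-power : ∀ m k → r ∣ k → (ζ ^ m) ^ k ≈ 1#
    root-power m k (divides q ≡.refl) = begin
      (ζ ^ m) ^ (q ℕ.* r) ≈⟨ Exp.^-assocʳ ζ m (q ℕ.* r) ⟩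
      ζ ^ (m ℕ.* (q ℕ.* r)) ≈⟨ reflexive (≡.cong (ζ ^_) (≡.trans (≡.sym (ℕ.*-assoc m q r)) (ℕ.*-comm (m ℕ.* q) r))) ⟩
      ζ ^ (r ℕ.* (m ℕ.* q)) ≈⟨ Exp.^-assocʳ ζ r (m ℕ.* q) ⟨
      (ζ ^ r) ^ (m ℕ.* q) ≈⟨ Exp.^-congˡ (m ℕ.* q) root ⟩
      1# ^ (m ℕ.* q) ≈⟨ one-power (m ℕ.* q) ⟩
      1# ∎
      where
      open SetoidReasoning setoid
      one-power : ∀ k → 1# ^ k ≈ 1#
      one-power zero    = refl
      one-power (suc k) = trans (*-identityˡ _) (one-power k)

    module Act (σ : Wreath r n) where
      perm : Fin n → Fin n
      perm i = proj₂ σ ⟨$⟩ʳ i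

      scalar : Fin n → Carrier
      scalar i = ζ ^ (r ℕ.∸ toℕ (proj₁ σ (perm i)))

      scalar-power : ∀ i k → r ∣ k → scalar i ^ k ≈ 1#
      scalar-power i = root-power (r ℕ.∸ toℕ (proj₁ σ (perm i)))

      X Θ : Fin n → Lin (Monomial n) (Monomial n)
      X i = scaleL (scalar i) (raise (perm i))
      Θ i = scaleL (scalar i) (toggle true (perm i))

      gens : Generators X Θ
      gens = record
        { commute = λ i j → scale-commute (scalar i) (scalar j) {raise (perm i)} {raise (perm j)}
            (raise-comm (perm i) (perm j))
        ; mixed = λ i j → scale-commute (scalar i) (scalar j) {toggle true (perm i)} {raise (perm j)}
            (Generators.mixed raise-gens (perm i) (perm j))
        ; exterior = record
          { anti = λ i j → scale-anticommute (scalar i) (scalar j) {toggle true (perm i)} {toggle true (perm j)}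
              (toggle-anti-self true (perm i) (perm j))
          ; square = λ i F x → trans (*-congˡ (trans (fn-⊡ (toggle true (perm i)) (scalar i)
              (fn (toggle true (perm i)) F) x)
              (trans (*-congˡ (toggle-square true (perm i) F x)) (zeroʳ _)))) (zeroʳ _)
          }
        }

      hat-act : ∀ f → hat (act r ζ σ f) ≗ fn (apply X Θ f) 𝟙
      hat-act f = interpret hat hat-0 hat-+ hat-·
        (λ i h → (scalar i · xΩ (perm i)) *Ω h) (λ i h → (scalar i · θΩ (perm i)) *Ω h) X Θ
        (λ i h x → trans (hat-* (scalar i · xΩ (perm i)) h x)
            (trans (apply-· raise (toggle true) (scalar i) (xΩ (perm i)) (hat h) x)
          (*-congˡ (trans (apply-mulˣ raise-gens (perm i) 1Ω (hat h) x)
            (fncong (raise (perm i)) (apply-1 raise (toggle true) (hat h)) x)))))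
        (λ i h x → trans (hat-* (scalar i · θΩ (perm i)) h x)
            (trans (apply-· raise (toggle true) (scalar i) (θΩ (perm i)) (hat h) x)
          (*-congˡ (trans (apply-mulᶿ raise-gens (perm i) 1Ω (hat h) x)
            (fncong (toggle true (perm i)) (apply-1 raise (toggle true) (hat h)) x)))))
        f 1Ω

      perm-injective : ∀ {i k} → perm i ≡ perm k → i ≡ k
      perm-injective {i} {k} e = ≡.trans (≡.sym (Perm.inverseˡ (proj₂ σ)))
        (≡.trans (≡.cong (proj₂ σ ⟨$⟩ˡ_) e) (Perm.inverseˡ (proj₂ σ)))

      -- The group element carries the i-th summand to the one at `perm i`: the scalar coming from
      -- xᵢ^j cancels the scalar `s i` coming from `B i`.
      symmetric-sum : ∀ j (B : Fin n → Ω n) (G : Fin n → Dual) (s : Fin n → Carrier) → (∀ i → hat (B i) ≗ G i) →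
        (∀ i → fn (apply X Θ (B i)) 𝟙 ≗ s i ⊡ G (perm i)) → (∀ i → scalar i ^ j * s i ≈ 1#) →
        act r ζ σ (∑Ω λ i → fold (B i) (mulˣ i) j) ≈Ω (∑Ω λ i → fold (B i) (mulˣ i) j)
      symmetric-sum j B G s hB aB one = hat-injective {f = act r ζ σ E} {E} λ x → trans (hat-act E x)
        (trans (apply-∑iterate gens j B 𝟙 x)
          (trans (sum-cong-≋ λ i → summand i x)
            (trans (sym (sum-permute (λ i → fn (iterate (raise i) j) (G i) x) (proj₂ σ)))
              (sym (trans (π-∑ hat hat-0 hat-+ (λ i → fold (B i) (mulˣ i) j) x) (sum-cong-≋ λ i →
                trans (π-iterate hat (mulˣ i) (raise i) (hat-mulˣ i) j (B i) x)
                  (fncong (iterate (raise i) j) (hB i) x)))))))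
        where
        E : Ω n
        E = ∑Ω λ i → fold (B i) (mulˣ i) j
        summand : ∀ i x → fn (iterate (X i) j) (fn (apply X Θ (B i)) 𝟙) x ≈ fn (iterate (raise (perm i)) j)
            (G (perm i)) x
        summand i x = trans (fncong (iterate (X i) j) (aB i) x) (trans (fn-⊡ (iterate (X i) j) (s i) (G (perm i)) x)
          (trans (*-congˡ (iterate-scale (scalar i) (raise (perm i)) j (G (perm i)) x))
            (trans (sym (*-assoc _ _ _)) (trans (*-congʳ (trans (*-comm _ _) (one i))) (*-identityˡ _)))))

      -- Let R be the contraction at `perm i`, rescaled by `scalar i ^ r′`, which is the inverse of
      -- `scalar i`, and preceded by the involution. Since R kills 1, the Leibniz rule for f applied
      -- to R 1 expresses the image of ∂ᶿᵢ f through R and the image of f, which is f itself.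
      act-∂ᶿ : ∀ {f} → act r ζ σ f ≈Ω f → ∀ i →
        fn (apply X Θ (∂ᶿ i f)) 𝟙 ≗ scalar i ^ r′ ⊡ fn (toggle false (perm i)) (hat f)
      act-∂ᶿ {f} inv i x = begin
        g x ≈⟨ involute-involute g x ⟨
        fn involute (fn involute g) x ≈⟨ fncong involute involuted x ⟩
        fn involute (fn involute (fn T (hat f))) x ≈⟨ involute-involute (fn T (hat f)) x ⟩
        fn T (hat f) x ∎
        where
        open SetoidReasoning setoid
        T R : Lin (Monomial n) (Monomial n)
        T = scaleL (scalar i ^ r′) (toggle false (perm i))
        R = T ⊚ involute
        g : Dual
        g = fn (apply X Θ (∂ᶿ i f)) 𝟙
        A : Dual
        A = fn (apply X Θ f) 𝟙
        A≗ : A ≗ hat f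
        A≗ x = trans (sym (hat-act f x)) (hat-resp {f = act r ζ σ f} {f} inv x)
        scalar-inverse : scalar i * scalar i ^ r′ ≈ 1#
        scalar-inverse = scalar-power i r (divides 1 (≡.sym (ℕ.*-identityˡ r)))
        T-involute : ∀ F x → fn T (fn involute F) x ≈ - fn involute (fn T F) x
        T-involute F x = trans (*-congˡ (toggle-involute false (perm i) F x)) (trans (sym (-‿distribʳ-* _ _))
          (-‿cong (sym (fn-⊡ involute (scalar i ^ r′) (fn (toggle false (perm i)) F) x))))
        Θ-involute : ∀ k → Anticommute (Θ k) involute
        Θ-involute k F x = trans (*-congˡ (toggle-involute true (perm k) F x)) (trans (sym (-‿distribʳ-* _ _))
          (-‿cong (sym (fn-⊡ involute (scalar k) (fn (toggle true (perm k)) F) x))))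
        ΘTΘ : ∀ F → fn (Θ i) (fn T F) ⊞ fn T (fn (Θ i) F) ≗ F
        ΘTΘ F x = trans (+-cong
            (trans (*-congˡ (fn-⊡ (toggle true (perm i)) (scalar i ^ r′) (fn (toggle false (perm i)) F) x))
                (sym (*-assoc _ _ _)))
            (trans (*-congˡ (fn-⊡ (toggle false (perm i)) (scalar i) (fn (toggle true (perm i)) F) x))
                (trans (sym (*-assoc _ _ _)) (*-congʳ (*-comm _ _)))))
          (trans (sym (distribˡ _ _ _)) (trans (*-cong scalar-inverse (trans (+-comm _ _) (toggle-toggle (perm i) F x)))
            (*-identityˡ _)))
        same : ∀ F → fn (Θ i) (fn R F) ≗ fn R (fn (Θ i) F) ⊞ fn involute F
        same F x = trans (sym (trans (+-assoc _ _ _) (trans (+-congˡ (-‿inverseʳ q)) (+-identityʳ _))))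
          (trans (+-congʳ (ΘTΘ (fn involute F) x)) (trans (+-comm _ _) (+-congʳ (sym
            (trans (fncong T {G = λ y → - fn (Θ i) (fn involute F) y} (λ y → neg-swap (Θ-involute i F y)) x)
              (fn-neg T (fn (Θ i) (fn involute F)) x))))))
          where
          q : Carrier
          q = fn T (fn (Θ i) (fn involute F)) x
        elsewhere : ∀ k → k ≢ i → Commute (Θ k) R
        elsewhere k k≢i F x = trans (ΘT (fn involute F) x) (trans (-‿cong (trans (fncong T (Θ-involute k F) x)
          (fn-neg T (fn involute (fn (Θ k) F)) x))) (-‿involutive _))
          where
          ΘT : ∀ F x → fn (Θ k) (fn T F) x ≈ - fn T (fn (Θ k) F) x
          ΘT = scale-anticommute (scalar k) (scalar i ^ r′) {toggle true (perm k)} {toggle false (perm i)}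
            (toggle-anti true false (k≢i ∘ perm-injective))
        R-X : ∀ k → Commute R (X k)
        R-X k F x = trans (fncong T (λ y → fn-⊡ involute (scalar k) (fn (raise (perm k)) F) y) x)
          (trans (*-congˡ (trans (fn-⊡ (toggle false (perm i)) (scalar k) (fn involute (fn (raise (perm k)) F)) x)
              (*-congˡ
            (trans (fncong (toggle false (perm i)) (λ y → sym (raise-involute (perm k) F y)) x)
              (sym (raise-toggle (perm k) false (perm i) (fn involute F) x))))))
            (trans (*-swap _ _ _) (*-congˡ (sym (fn-⊡ (raise (perm k)) (scalar i ^ r′)
                (fn (toggle false (perm i)) (fn involute F)) x)))))
        involute-X : ∀ k → Commute involute (X k)
        involute-X k F x = trans (fn-⊡ involute (scalar k) (fn (raise (perm k)) F) x)
            (*-congˡ (sym (raise-involute (perm k) F x)))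
        contract-𝟙 : fn R 𝟙 ≗ 𝟘
        contract-𝟙 x = trans (*-congˡ (trans (fncong (toggle false (perm i)) involute-𝟙 x)
          (trans (sym (hat-∂ᶿ (perm i) 1Ω x)) (trans (reflexive
              (≡.cong (λ f → hat f x) (∂ᶿ-∷ (perm i) 1# (Vec.replicate n 0) ⊥ [])))
            (trans (reflexive (≡.cong (λ b → hat (1# · (if b then
                (sign (perm i) ⊥ , Vec.replicate n 0 , flip (perm i) ⊥) ∷ [] else [])
               +Ω []) x) (Vec.lookup-replicate (perm i) outside))) (hat-0 x)))))) (zeroʳ _)
        involuted : fn involute g ≗ fn involute (fn T (hat f))
        involuted y = begin
          fn involute g y ≈⟨ trans (+-congʳ (-‿inverseˡ (fn R A y))) (+-identityˡ _) ⟨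
          - fn R A y + fn R A y + fn involute g y ≈⟨ +-assoc _ _ _ ⟩
          - fn R A y + (fn R A y + fn involute g y)
            ≈⟨ +-congˡ (apply-contract R involute X Θ i R-X involute-X same elsewhere Θ-involute f 𝟙 y) ⟨
          - fn R A y + fn (apply X Θ f) (fn R 𝟙) y ≈⟨ +-congˡ (fn-zero (apply X Θ f) contract-𝟙 y) ⟩
          - fn R A y + 0# ≈⟨ +-identityʳ _ ⟩
          - fn R A y ≈⟨ -‿cong (fncong R A≗ y) ⟩
          - fn R (hat f) y ≈⟨ neg-swap (T-involute (hat f) y) ⟨
          fn involute (fn T (hat f)) y ∎

      conjugate-invariant : ∀ {f} → act r ζ σ f ≈Ω f → act r ζ σ (conjugate f) ≈Ω conjugate f
      conjugate-invariant {f} inv = hat-injective {f = act r ζ σ (conjugate f)} {conjugate f} λ x →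
        trans (hat-act (conjugate f) x) (trans
          (conjugated X Θ (λ k F y → trans (fn-⊡ involute (scalar k) (fn (raise (perm k)) F) y)
              (*-congˡ (sym (raise-involute (perm k) F y))))
            (λ k F y → trans (*-congˡ (toggle-involute true (perm k) F y)) (trans (sym (-‿distribʳ-* _ _))
              (-‿cong (sym (fn-⊡ involute (scalar k) (fn (toggle true (perm k)) F) y))))) x)
          (trans (fncong involute (λ y → trans (sym (hat-act f y)) (hat-resp {f = act r ζ σ f} {f} inv y)) x)
            (sym (trans (sym (✶-𝟙 (conjugate f) x)) (trans
              (conjugated raise (toggle true) (λ k F y → sym (raise-involute k F y)) (toggle-involute true) x)
              (fncong involute (✶-𝟙 f) x))))))
        where
        conjugated : ∀ X Θ → (∀ k → Commute involute (X k)) → (∀ k → Anticommute (Θ k) involute) →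
          fn (apply X Θ (conjugate f)) 𝟙 ≗ fn involute (fn (apply X Θ f) 𝟙)
        conjugated X Θ cX aΘ x = trans (sym (involute-involute (fn (apply X Θ (conjugate f)) 𝟙) x)) (fncong involute
          (λ y → trans (sym (apply-conjugate involute involute-involute X Θ cX aΘ f 𝟙 y))
            (fncong (apply X Θ f) involute-𝟙 y)) x)

    Generating : Pred (Ω n) ℓ
    Generating f = Invariant r ζ f × (constantTerm f ≈ 0#)

    conjugate-generating : ∀ {f} → Generating f → Generating (conjugate f)
    conjugate-generating {f} (inv , z) = (λ σ → Act.conjugate-invariant σ {f} (inv σ)) ,
      trans (constant f) (trans (*-congˡ z) (zeroʳ _))
      where
      constant : ∀ f → constantTerm (conjugate f) ≈ parity (⊥ {n}) * constantTerm f
      constant [] = sym (zeroʳ _)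
      constant ((k , m) ∷ f) with (Vec.replicate n 0 , ⊥) ≟ᵐ m
      ... | yes ≡.refl = trans (+-congˡ (constant f)) (sym (distribˡ _ _ _))
      ... | no _ = trans (+-congˡ (constant f)) (sym (trans (distribˡ _ _ _) (+-congʳ (zeroʳ _))))

    ∑iterate-constant : ∀ (B : Fin n → Ω n) j → constantTerm (∑Ω λ i → fold (B i) (mulˣ i) (suc j)) ≈ 0#
    ∑iterate-constant B j = trans (sym (hat-origin (∑Ω λ i → fold (B i) (mulˣ i) (suc j))))
      (trans (π-∑ hat hat-0 hat-+ (λ i → fold (B i) (mulˣ i) (suc j)) (Vec.replicate n 0 , ⊥))
        (sum-zero {n} _ λ i → trans (hat-mulˣ i (fold (B i) (mulˣ i) j) (Vec.replicate n 0 , ⊥))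
            (raise-origin i (hat (fold (B i) (mulˣ i) j)) ⊥)))

    -- The power of xᵢ contributes `scalar i` to the k r + 1 and the contraction contributes
    -- `scalar i ^ r′`; the exponents add up to a multiple of r. This is where j ≡ 1 mod r enters.
    derive-generating : ∀ k {f} → Generating f → Generating (derive (k ℕ.* r ℕ.+ 1) f)
    derive-generating k {f} (inv , z) =
      (λ σ → let open Act σ in symmetric-sum (k ℕ.* r ℕ.+ 1) (λ i → ∂ᶿ i f) (λ i → fn (toggle false i) (hat f))
         (λ i → scalar i ^ r′) (λ i → hat-∂ᶿ i f) (act-∂ᶿ {f} (inv σ))
         λ i → trans (sym (Exp.^-homo-* (scalar i) (k ℕ.* r ℕ.+ 1) r′))
           (scalar-power i (k ℕ.* r ℕ.+ 1 ℕ.+ r′) (divides (suc k)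
               (≡.trans (ℕ.+-assoc (k ℕ.* r) 1 r′) (ℕ.+-comm (k ℕ.* r) r))))) ,
      ≡.subst (λ j → constantTerm (derive j f) ≈ 0#) (ℕ.+-comm 1 (k ℕ.* r)) (∑iterate-constant (λ i → ∂ᶿ i f) (k ℕ.* r))

    powerSumΩ : ℕ → Ω n
    powerSumΩ m = ∑Ω λ i → fold 1Ω (mulˣ i) m

    powerSumᶿ : ℕ → Ω n
    powerSumᶿ m = ∑Ω λ i → fold (θΩ i) (mulˣ i) m

    powerSumΩ-generating : ∀ k → Generating (powerSumΩ (suc k ℕ.* r))
    powerSumΩ-generating k =
      (λ σ → let open Act σ in symmetric-sum (suc k ℕ.* r) (λ i → 1Ω) (λ i → 𝟙) (λ i → 1#) (λ i x → refl)
        (λ i x → trans (apply-1 X Θ 𝟙 x) (sym (*-identityˡ _)))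
        λ i → trans (*-identityʳ _) (scalar-power i (suc k ℕ.* r) (divides (suc k) ≡.refl))) ,
      ∑iterate-constant (λ i → 1Ω) (r′ ℕ.+ k ℕ.* r)

    powerSumᶿ-generating : ∀ k → Generating (powerSumᶿ (r′ ℕ.+ k ℕ.* r))
    powerSumᶿ-generating k =
      (λ σ → let open Act σ in symmetric-sum (r′ ℕ.+ k ℕ.* r) θΩ (λ i → fn (toggle true i) 𝟙) scalar
          (λ i → hat-mulᶿ i 1Ω)
        (λ i x → trans (apply-mulᶿ gens i 1Ω 𝟙 x) (fncong (Θ i) (apply-1 X Θ 𝟙) x))
        λ i → trans (*-comm _ _) (scalar-power i (r ℕ.+ k ℕ.* r) (divides (suc k) ≡.refl))) ,
      -- For r = 1 and k = 0 the power of xᵢ is 1, so the constant term has to vanish on account of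
      -- θᵢ.
      trans (sym (hat-origin (powerSumᶿ (r′ ℕ.+ k ℕ.* r))))
        (trans (π-∑ hat hat-0 hat-+ (λ i → fold (θΩ i) (mulˣ i) (r′ ℕ.+ k ℕ.* r)) (Vec.replicate n 0 , ⊥))
          (sum-zero {n} _ λ i → trans (π-iterate hat (mulˣ i) (raise i) (hat-mulˣ i) (r′ ℕ.+ k ℕ.* r) (θΩ i) _)
            (trans (iterate-⊥ (λ a → trans (hat-mulᶿ i 1Ω (a , ⊥))
                (reflexive (≡.cong (λ b → when b (sign i ⊥ * 𝟙 (a , flip i ⊥))) (Vec.lookup-replicate i outside))))
              (r′ ℕ.+ k ℕ.* r) i _) refl)))
      where
      iterate-⊥ : ∀ {F : Dual {n}} → (∀ a → F (a , ⊥) ≈ 0#) → ∀ m i a → fn (iterate (raise i) m) F (a , ⊥) ≈ 0#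
      iterate-⊥ z zero    i a = z a
      iterate-⊥ z (suc m) i a = trans (*-congˡ (iterate-⊥ z m i (a [ i ]%= ℕ.pred))) (zeroʳ _)

  -- The adjacent transpositions of n positions.
  data Adj : ℕ → Set where
    swap : ∀ {m} → Adj (suc (suc m))
    skip : ∀ {m} → Adj m → Adj (suc m)

  transpose : ∀ {n} → Adj n → Fin n → Fin n
  transpose swap     zero          = suc zero
  transpose swap     (suc zero)    = zero
  transpose swap     (suc (suc i)) = suc (suc i)
  transpose (skip k) zero          = zero
  transpose (skip k) (suc i)       = suc (transpose k i)

  transposeᵛ : ∀ {a} {A : Set a} {n} → Adj n → Vec A n → Vec A n
  transposeᵛ swap     (x ∷ y ∷ a) = y ∷ x ∷ a
  transposeᵛ (skip k) (x ∷ a)     = x ∷ transposeᵛ k a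

  -- Vandermonde products over a commutative ring.

  module Vandermonde {c′ ℓ′} (R : CommutativeRing c′ ℓ′) where
    private
      module R = CommutativeRing R
      module Exp′ = CSExp R.commutativeSemiring
      open NaturalCoefficients R.commutativeSemiring

    ∏ᴿ : ∀ {n} → (Fin n → R.Carrier) → R.Carrier
    ∏ᴿ {zero}  F = R.1#
    ∏ᴿ {suc n} F = F zero R.* ∏ᴿ (F ∘ suc)

    ∏-cong : ∀ {n} {F G : Fin n → R.Carrier} → (∀ i → F i R.≈ G i) → ∏ᴿ F R.≈ ∏ᴿ G
    ∏-cong {zero}  e = R.refl
    ∏-cong {suc n} e = R.*-cong (e zero) (∏-cong (e ∘ suc))

    ∏-1 : ∀ {n} (F : Fin n → R.Carrier) → (∀ i → F i R.≈ R.1#) → ∏ᴿ F R.≈ R.1#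
    ∏-1 {zero}  F e = R.refl
    ∏-1 {suc n} F e = R.trans (R.*-cong (e zero) (∏-1 (F ∘ suc) (e ∘ suc))) (R.*-identityˡ R.1#)

    ∏-single : ∀ {n} (F : Fin n → R.Carrier) j → (∀ i → i ≢ j → F i R.≈ R.1#) → ∏ᴿ F R.≈ F j
    ∏-single {suc n} F zero e = R.trans (R.*-congˡ (∏-1 (F ∘ suc) (λ i → e (suc i) λ ()))) (R.*-identityʳ _)
    ∏-single {suc n} F (suc j) e = R.trans (R.*-cong (e zero λ ()) (∏-single (F ∘ suc) j λ i i≢j →
      e (suc i) (i≢j ∘ Fin.suc-injective))) (R.*-identityˡ _)

    ∏-* : ∀ {n} (F G : Fin n → R.Carrier) → ∏ᴿ (λ i → F i R.* G i) R.≈ ∏ᴿ F R.* ∏ᴿ G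
    ∏-* {zero}  F G = R.sym (R.*-identityˡ R.1#)
    ∏-* {suc n} F G = R.trans (R.*-congˡ (∏-* (F ∘ suc) (G ∘ suc)))
      (solve 4 (λ a b c d → (a :* b) :* (c :* d) := (a :* c) :* (b :* d)) R.refl _ _ _ _)

    ∏-transpose : ∀ {n} (k : Adj n) (F : Fin n → R.Carrier) → ∏ᴿ (F ∘ transpose k) R.≈ ∏ᴿ F
    ∏-transpose swap     F = solve 3 (λ a b c → a :* (b :* c) := b :* (a :* c)) R.refl _ _ _
    ∏-transpose (skip k) F = R.*-congˡ (∏-transpose k (F ∘ suc))

    vandermonde : ∀ {n} → (Fin n → R.Carrier) → R.Carrier
    vandermonde {zero}  y = R.1#
    vandermonde {suc n} y = ∏ᴿ (λ j → y zero R.- y (suc j)) R.* vandermonde (y ∘ suc)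

    vandermonde-cong : ∀ {n} {y z : Fin n → R.Carrier} → (∀ i → y i R.≈ z i) → vandermonde y R.≈ vandermonde z
    vandermonde-cong {zero}  e = R.refl
    vandermonde-cong {suc n} e = R.*-cong (∏-cong λ j → R.+-cong (e zero) (R.-‿cong (e (suc j))))
        (vandermonde-cong (e ∘ suc))

    private
      negate-difference : ∀ a b → b R.- a R.≈ R.- R.1# R.* (a R.- b)
      negate-difference a b = R.sym (R.trans (RingProperties.-1*x≈-x R.ring _)
        (R.trans (R.sym (RingProperties.-‿+-comm R.ring a (R.- b)))
          (R.trans (R.+-congˡ (RingProperties.-‿involutive R.ring b)) (R.+-comm _ _))))

    -- Exchanging the first two entries negates their difference and swaps their products of
    -- differences with the later entries.
    vandermonde-transpose : ∀ {n} (k : Adj n) (y : Fin n → R.Carrier) →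
      vandermonde (y ∘ transpose k) R.≈ R.- R.1# R.* vandermonde y
    vandermonde-transpose swap y = R.trans (R.*-congʳ (R.*-congʳ (negate-difference (y zero) (y (suc zero)))))
      (solve 5 (λ m d a b c → ((m :* d) :* b) :* (a :* c) := m :* ((d :* a) :* (b :* c))) R.refl
        (R.- R.1#) (y zero R.- y (suc zero)) (∏ᴿ λ j → y zero R.- y (suc (suc j)))
        (∏ᴿ λ j → y (suc zero) R.- y (suc (suc j))) (vandermonde λ j → y (suc (suc j))))
    vandermonde-transpose (skip k) y = R.trans (R.*-cong (∏-transpose k (λ j → y zero R.- y (suc j)))
        (vandermonde-transpose k (y ∘ suc)))
      (solve 3 (λ a m b → a :* (m :* b) := m :* (a :* b)) R.refl _ _ _)

    differences-product : ∀ {n} → (Fin n → R.Carrier) → R.Carrier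
    differences-product y = ∏ᴿ λ i → ∏ᴿ λ j → if does (i Fin.<? j) then y i R.- y j else R.1#

    differences-vandermonde : ∀ {n} (y : Fin n → R.Carrier) → differences-product y R.≈ vandermonde y
    differences-vandermonde {zero}  y = R.refl
    differences-vandermonde {suc n} y = R.*-cong (R.*-identityˡ _)
      (R.trans (∏-cong {n} λ i → R.*-identityˡ _) (differences-vandermonde (y ∘ suc)))

    discriminant : ∀ {n} → ℕ → (Fin n → R.Carrier) → R.Carrier
    discriminant r′ y = ∏ᴿ (λ i → y i Exp′.^ r′) R.* differences-product (λ i → y i Exp′.^ suc r′)

    discriminant-vandermonde : ∀ {n} r′ (y : Fin n → R.Carrier) →
      discriminant r′ y R.≈ ∏ᴿ (λ i → y i Exp′.^ r′) R.* vandermonde (λ i → y i Exp′.^ suc r′)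
    discriminant-vandermonde r′ y = R.*-congˡ (differences-vandermonde (λ i → y i Exp′.^ suc r′))

    discriminant-transpose : ∀ {n} r′ (k : Adj n) (y : Fin n → R.Carrier) →
      discriminant r′ (y ∘ transpose k) R.≈ R.- R.1# R.* discriminant r′ y
    discriminant-transpose r′ k y = R.trans (discriminant-vandermonde r′ (y ∘ transpose k))
      (R.trans (R.*-cong (∏-transpose k (λ i → y i Exp′.^ r′)) (vandermonde-transpose k (λ i → y i Exp′.^ suc r′)))
        (R.trans (solve 3 (λ a m b → a :* (m :* b) := m :* (a :* b)) R.refl _ _ _)
          (R.*-congˡ (R.sym (discriminant-vandermonde r′ y)))))

    -- The differences involve only r-th powers, on which the scaling is trivial; only the prefactor
    -- changes.
    discriminant-scale : ∀ {n} r′ (s y : Fin n → R.Carrier) → (∀ i → s i Exp′.^ suc r′ R.≈ R.1#) →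
      discriminant r′ (λ i → s i R.* y i) R.≈ ∏ᴿ (λ i → s i Exp′.^ r′) R.* discriminant r′ y
    discriminant-scale r′ s y e = R.trans (discriminant-vandermonde r′ (λ i → s i R.* y i))
      (R.trans (R.*-cong
        (R.trans (∏-cong λ i → Exp′.^-distrib-* (s i) (y i) r′) (∏-* (λ i → s i Exp′.^ r′) (λ i → y i Exp′.^ r′)))
        (vandermonde-cong λ i → R.trans (Exp′.^-distrib-* (s i) (y i) (suc r′))
            (R.trans (R.*-congʳ (e i)) (R.*-identityˡ _))))
        (R.trans (R.*-assoc _ _ _) (R.*-congˡ (R.sym (discriminant-vandermonde r′ y)))))

  -- A polynomial expression for δ.

  substitute : ∀ {n m} → (Fin n → Expr m) → Expr n → Expr m
  substitute σ (con k) = con k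
  substitute σ (var i) = σ i
  substitute σ (p ⊕ q) = substitute σ p ⊕ substitute σ q
  substitute σ (p ⊗ q) = substitute σ p ⊗ substitute σ q

  ⟦substitute⟧ : ∀ {n m I} (X : Fin m → Lin I I) (σ : Fin n → Expr m) p F →
    fn (⟦ X ⟧ (substitute σ p)) F ≗ fn (⟦ (λ i → ⟦ X ⟧ (σ i)) ⟧ p) F
  ⟦substitute⟧ X σ (con k) F x = refl
  ⟦substitute⟧ X σ (var i) F x = refl
  ⟦substitute⟧ X σ (p ⊕ q) F x = +-cong (⟦substitute⟧ X σ p F x) (⟦substitute⟧ X σ q F x)
  ⟦substitute⟧ X σ (p ⊗ q) F x = trans (⟦substitute⟧ X σ p _ x)
      (fncong (⟦ (λ i → ⟦ X ⟧ (σ i)) ⟧ p) (⟦substitute⟧ X σ q F) x)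

  infixr 8 _^ᴱ_
  _^ᴱ_ : ∀ {n} → Expr n → ℕ → Expr n
  p ^ᴱ zero  = con 1#
  p ^ᴱ suc k = p ⊗ p ^ᴱ k

  ∏ᴱ : ∀ {m n} → (Fin m → Expr n) → Expr n
  ∏ᴱ {zero}  F = con 1#
  ∏ᴱ {suc m} F = F zero ⊗ ∏ᴱ (F ∘ suc)

  infixl 6 _⊝_
  _⊝_ : ∀ {n} → Expr n → Expr n → Expr n
  p ⊝ q = p ⊕ con (- 1#) ⊗ q

  discriminantᴱ : ∀ {m n} → ℕ → (Fin m → Expr n) → Expr n
  discriminantᴱ r′ y = ∏ᴱ (λ i → y i ^ᴱ r′) ⊗
    ∏ᴱ λ i → ∏ᴱ λ j → if does (i Fin.<? j) then y i ^ᴱ suc r′ ⊝ y j ^ᴱ suc r′ else con 1#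

  -- Quantified over all modules because δ is needed both as a multiplication operator and through
  -- its value at a point.
  record Represents {n} (p : Expr n) (f : Ω n) : Set (Level.suc 0ℓ ⊔ c ⊔ ℓ) where
    field
      represents : ∀ {I} {X Θ : Fin n → Lin I I} → Generators X Θ → ∀ F → fn (apply X Θ f) F ≗ fn (⟦ X ⟧ p) F

  open Represents public

  module _ {n : ℕ} where
    represents-1 : Represents {n} (con 1#) 1Ω
    represents represents-1 {X = X} {Θ} gens F x = trans (apply-1 X Θ F x) (sym (*-identityˡ _))

    represents-x : ∀ (i : Fin n) → Represents (var i) (xΩ i)
    represents (represents-x i) {X = X} {Θ} gens F x = trans (apply-mulˣ gens i 1Ω F x) (fncong (X i) (apply-1 X Θ F) x)

    represents-* : ∀ {p q f g} → Represents {n} p f → Represents q g → Represents (p ⊗ q) (f *Ω g)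
    represents (represents-* {p} {f = f} {g} rp rq) {X = X} gens F x = trans (apply-* gens f g F x)
      (trans (represents rp gens _ x) (fncong (⟦ X ⟧ p) (represents rq gens F) x))

    represents-- : ∀ {p q f g} → Represents {n} p f → Represents q g → Represents (p ⊝ q) (f -Ω g)
    represents (represents-- {f = f} {g} rp rq) {X = X} {Θ} gens F x = trans (apply-+ X Θ f (- 1# · g) F x)
      (+-cong (represents rp gens F x) (trans (apply-· X Θ (- 1#) g F x) (*-congˡ (represents rq gens F x))))

    represents-^ : ∀ {p f} → Represents {n} p f → ∀ k → Represents (p ^ᴱ k) (f ^Ω k)
    represents-^ rp zero = represents-1
    represents-^ {p} {f} rp (suc k) = represents-* {p} {p ^ᴱ k} {f} {f ^Ω k} rp (represents-^ {p} {f} rp k)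

    represents-∏ : ∀ {m} (F : Fin m → Expr n) (G : Fin m → Ω n) → (∀ i → Represents (F i) (G i)) →
      Represents (∏ᴱ F) (foldr (λ i → G i *Ω_) 1Ω (allFin m))
    represents-∏ {zero}  F G e = represents-1
    represents-∏ {suc m} F G e = ≡.subst (Represents (∏ᴱ F)) (≡.sym (foldr-allFin (λ i → G i *Ω_) 1Ω))
      (represents-* {F zero} {∏ᴱ (F ∘ suc)} {G zero} {foldr (λ i → G (suc i) *Ω_) 1Ω (allFin m)}
        (e zero) (represents-∏ (F ∘ suc) (G ∘ suc) (e ∘ suc)))

    represents-if : ∀ b {p q f g} → Represents {n} p f → Represents q g →
      Represents (if b then p else q) (if b then f else g)
    represents-if true  rp rq = rp
    represents-if false rp rq = rq

    represents-δ : ∀ r′ → Represents (discriminantᴱ r′ var) (δΩ n (suc r′))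
    represents-δ r′ = represents-*
      {∏ᴱ λ i → var i ^ᴱ r′} {∏ᴱ λ i → ∏ᴱ λ j → if does (i Fin.<? j) then var i ^ᴱ suc r′ ⊝ var j ^ᴱ suc r′ else con 1#}
      {∏Ω λ i → xΩ i ^Ω r′} {∏Ω λ i → ∏Ω λ j → if does (i Fin.<? j) then xΩ i ^Ω suc r′ -Ω xΩ j ^Ω suc r′ else 1Ω}
      (represents-∏ (λ i → var i ^ᴱ r′) (λ i → xΩ i ^Ω r′) λ i → represents-^ {var i} {xΩ i} (represents-x i) r′)
      (represents-∏ _ row λ i → represents-∏ _ (entry i) λ j → represents-if (does (i Fin.<? j))
        {var i ^ᴱ suc r′ ⊝ var j ^ᴱ suc r′} {con 1#} {xΩ i ^Ω suc r′ -Ω xΩ j ^Ω suc r′} {1Ω}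
        (represents-- {var i ^ᴱ suc r′} {var j ^ᴱ suc r′} {xΩ i ^Ω suc r′} {xΩ j ^Ω suc r′}
          (represents-^ {var i} {xΩ i} (represents-x i) (suc r′))
              (represents-^ {var j} {xΩ j} (represents-x j) (suc r′)))
        represents-1)
      where
      entry : Fin n → Fin n → Ω n
      entry i j = if does (i Fin.<? j) then xΩ i ^Ω suc r′ -Ω xΩ j ^Ω suc r′ else 1Ω
      row : Fin n → Ω n
      row i = ∏Ω (entry i)

  substitute-^ : ∀ {n m} (σ : Fin n → Expr m) p k → substitute σ (p ^ᴱ k) ≡ substitute σ p ^ᴱ k
  substitute-^ σ p zero    = ≡.refl
  substitute-^ σ p (suc k) = ≡.cong (substitute σ p ⊗_) (substitute-^ σ p k)

  substitute-∏ : ∀ {n m l} (σ : Fin n → Expr m) (F : Fin l → Expr n) {G : Fin l → Expr m} →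
    (∀ i → substitute σ (F i) ≡ G i) → substitute σ (∏ᴱ F) ≡ ∏ᴱ G
  substitute-∏ {l = zero}  σ F e = ≡.refl
  substitute-∏ {l = suc l} σ F e = ≡.cong₂ _⊗_ (e zero) (substitute-∏ σ (F ∘ suc) (e ∘ suc))

  substitute-discriminant : ∀ {n m} r′ (σ : Fin n → Expr m) →
    substitute σ (discriminantᴱ r′ var) ≡ discriminantᴱ r′ σ
  substitute-discriminant r′ σ = ≡.cong₂ _⊗_ (substitute-∏ σ _ λ i → substitute-^ σ (var i) r′)
    (substitute-∏ σ _ λ i → substitute-∏ σ _ λ j → conditional (does (i Fin.<? j)) i j)
    where
    conditional : ∀ b i j → substitute σ (if b then var i ^ᴱ suc r′ ⊝ var j ^ᴱ suc r′ else con 1#) ≡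
      (if b then σ i ^ᴱ suc r′ ⊝ σ j ^ᴱ suc r′ else con 1#)
    conditional true i j = ≡.cong₂ _⊝_ (substitute-^ σ (var i) (suc r′)) (substitute-^ σ (var j) (suc r′))
    conditional false i j = ≡.refl

  module DiscriminantRing {n I} (X : Fin n → Lin I I) (commute : ∀ i j → Commute (X i) (X j)) where
    open ExprRing X commute
    open Vandermonde exprRing
    private
      module R = CommutativeRing exprRing
      module Exp′ = CSExp R.commutativeSemiring

    ^ᴱ-^ : ∀ p k → p ^ᴱ k ≡ p Exp′.^ k
    ^ᴱ-^ p zero    = ≡.refl
    ^ᴱ-^ p (suc k) = ≡.cong (p ⊗_) (^ᴱ-^ p k)

    ∏ᴱ-∏ᴿ : ∀ {m} (F : Fin m → Expr n) {G : Fin m → Expr n} → (∀ i → F i ≡ G i) → ∏ᴱ F ≡ ∏ᴿ G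
    ∏ᴱ-∏ᴿ {zero}  F e = ≡.refl
    ∏ᴱ-∏ᴿ {suc m} F e = ≡.cong₂ _⊗_ (e zero) (∏ᴱ-∏ᴿ (F ∘ suc) (e ∘ suc))

    discriminantᴱ-≡ : ∀ {m} r′ (y : Fin m → Expr n) → discriminantᴱ r′ y ≡ discriminant r′ y
    discriminantᴱ-≡ r′ y = ≡.cong₂ _⊗_ (∏ᴱ-∏ᴿ _ λ i → ^ᴱ-^ (y i) r′)
      (∏ᴱ-∏ᴿ _ λ i → ∏ᴱ-∏ᴿ _ λ j → ≡.cong (λ p → if does (i Fin.<? j) then p else con 1#)
        (≡.cong₂ _⊝_ (^ᴱ-^ (y i) (suc r′)) (^ᴱ-^ (y j) (suc r′))))

  raiseᵁ : ∀ {n} → Fin n → Lin (Vec ℕ n) (Vec ℕ n)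
  fn (raiseᵁ i) u a = (lookup a i ×′ 1#) * u (a [ i ]%= ℕ.pred)
  fncong (raiseᵁ i) p _ = *-congˡ (p _)
  fn-⊞ (raiseᵁ i) F G _ = distribˡ _ _ _
  fn-⊡ (raiseᵁ i) k F _ = *-swap _ _ _

  raiseᵁ-comm : ∀ {n} (i j : Fin n) → Commute (raiseᵁ i) (raiseᵁ j)
  raiseᵁ-comm i j u a = raise-comm i j (λ (a , J) → u a) (a , ⊥)

  embed : ∀ {n} → Lin (Vec ℕ n) (Monomial n)
  fn embed u (a , J) = when (does (Vec.≡-dec Bool._≟_ J ⊥)) (u a)
  fncong embed p (a , J) = when-cong (does (Vec.≡-dec Bool._≟_ J ⊥)) (p a)
  fn-⊞ embed u v (a , J) = when-+ (does (Vec.≡-dec Bool._≟_ J ⊥)) _ _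
  fn-⊡ embed k u (a , J) = when-* (does (Vec.≡-dec Bool._≟_ J ⊥)) _ _

  embed-raise : ∀ {n} (i : Fin n) → Intertwines embed (raiseᵁ i) (raise i)
  embed-raise i u (a , J) = when-* (does (Vec.≡-dec Bool._≟_ J ⊥)) _ _

  embed-⊥ : ∀ {n} (u : Fn (Vec ℕ n)) a → fn embed u (a , ⊥) ≈ u a
  embed-⊥ {n} u a = reflexive (≡.cong (λ b → when b (u a)) (dec-true (Vec.≡-dec Bool._≟_ (⊥ {n}) ⊥) ≡.refl))

  embed-contract : ∀ {n} (i : Fin n) u → fn (toggle false i) (fn embed u) ≗ 𝟘
  embed-contract i u (a , J) with lookup J i in e
  ... | true = refl
  ... | false = trans (*-congˡ (reflexive (≡.cong (λ b → when b (u a)) (dec-false (Vec.≡-dec Bool._≟_ (flip i J) ⊥)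
    λ e′ → contradiction′ (≡.trans (≡.sym (≡.trans (lookup-flip i J) (≡.cong not e)))
      (≡.trans (≡.cong (λ J → lookup J i) e′) (Vec.lookup-replicate i outside))))))) (zeroʳ _)
    where
    contradiction′ : true ≢ false
    contradiction′ ()

  𝟙ᵁ : ∀ {n} → Fn (Vec ℕ n)
  𝟙ᵁ a = 𝟙 (a , ⊥)

  embed-𝟙 : ∀ {n} → fn embed (𝟙ᵁ {n}) ≗ 𝟙
  embed-𝟙 {n} (a , J) with Vec.≡-dec Bool._≟_ J ⊥
  ... | yes ≡.refl = refl
  ... | no J≢⊥ = sym (hat-single-≢ a J (Vec.replicate n 0 , ⊥) 1# (J≢⊥ ∘ ,-injectiveʳ))

  𝟙ᵁ-origin : ∀ {n} → 𝟙ᵁ (Vec.replicate n 0) ≈ 1#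
  𝟙ᵁ-origin {n} = trans (hat-origin (1Ω {n})) (coeff-single {n} (Vec.replicate n 0 , ⊥) 1#)

  𝟙ᵁ-elsewhere : ∀ {n} (a : Vec ℕ n) → a ≢ Vec.replicate n 0 → 𝟙ᵁ a ≈ 0#
  𝟙ᵁ-elsewhere {n} a a≢0 = hat-single-≢ a ⊥ (Vec.replicate n 0 , ⊥) 1# (a≢0 ∘ ,-injectiveˡ)

  -- Degree, integrality and nonvanishing of δ.

  module Discriminant {n : ℕ} (r′ : ℕ) where
    open Elimination {n} r′ using (socle)
    open Core {n} using (Supp; IntFn; shift; shift-comm; sum-suc)
    open DiscriminantRing (raiseᵁ {n}) raiseᵁ-comm
    open ExprRing (raiseᵁ {n}) raiseᵁ-comm
    private
      r : ℕ
      r = suc r′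
      module R = CommutativeRing exprRing
      module V = Vandermonde exprRing
      module Exp′ = CSExp R.commutativeSemiring

    δE : Expr n
    δE = discriminantᴱ r′ var

    δᵁ : Fn (Vec ℕ n)
    δᵁ = fn (⟦ raiseᵁ ⟧ δE) 𝟙ᵁ

    hat-δ : hat (δΩ n r) ≗ fn embed δᵁ
    hat-δ x = trans (sym (✶-𝟙 (δΩ n r) x)) (trans (represents (represents-δ r′) raise-gens 𝟙 x)
      (trans (fncong (⟦ raise ⟧ δE) (λ y → sym (embed-𝟙 y)) x)
        (sym (intertwine-⟦⟧ raiseᵁ raise embed embed-raise δE 𝟙ᵁ x))))

    Raises : ℕ → Expr n → Set (c ⊔ ℓ)
    Raises e p = ∀ {d u} → Supp d u → Supp (e ℕ.+ d) (fn (⟦ raiseᵁ ⟧ p) u)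

    raises-var : ∀ i → Raises 1 (var i)
    raises-var i {d} s a h with lookup a i in e
    ... | zero  = zeroˡ _
    ... | suc k = trans (*-congˡ (s _ λ e′ → h (≡.trans (≡.cong Vec.sum (≡.sym (pred-suc a i e)))
                    (≡.trans (sum-suc (a [ i ]%= ℕ.pred) i) (≡.cong suc e′))))) (zeroʳ _)

    raises-1 : Raises 0 (con 1#)
    raises-1 s a h = trans (*-congˡ (s a h)) (zeroʳ _)

    raises-⊗ : ∀ {e e′ p q} → Raises e p → Raises e′ q → Raises (e ℕ.+ e′) (p ⊗ q)
    raises-⊗ {e} {e′} {p} {q} rp rq {d} {u} s = ≡.subst (λ k → Supp k (fn (⟦ raiseᵁ ⟧ (p ⊗ q)) u))
      (≡.sym (ℕ.+-assoc e e′ d)) (rp (rq s))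

    raises-^ : ∀ {p} → Raises 1 p → ∀ k → Raises k (p Exp′.^ k)
    raises-^ rp zero = raises-1
    raises-^ {p} rp (suc k) = raises-⊗ {p = p} {p Exp′.^ k} rp (raises-^ rp k)

    raises-- : ∀ {e p q} → Raises e p → Raises e q → Raises e (p R.- q)
    raises-- rp rq s a h = trans (+-cong (rp s a h) (trans (*-congˡ (rq s a h)) (zeroʳ _))) (+-identityˡ 0#)

    raises-∏ : ∀ {m} e (F : Fin m → Expr n) → (∀ i → Raises e (F i)) → Raises (m ℕ.* e) (V.∏ᴿ F)
    raises-∏ {zero}  e F h = raises-1
    raises-∏ {suc m} e F h = raises-⊗ {p = F zero} {V.∏ᴿ (F ∘ suc)} (h zero) (raises-∏ e (F ∘ suc) (h ∘ suc))

    vandermonde-degree : ℕ → ℕ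
    vandermonde-degree zero    = 0
    vandermonde-degree (suc m) = m ℕ.* r ℕ.+ vandermonde-degree m

    raises-vandermonde : ∀ {m} (y : Fin m → Expr n) → (∀ i → Raises r (y i)) →
      Raises (vandermonde-degree m) (V.vandermonde y)
    raises-vandermonde {zero}  y h = raises-1
    raises-vandermonde {suc m} y h = raises-⊗ {p = V.∏ᴿ λ j → y zero R.- y (suc j)} {V.vandermonde (y ∘ suc)}
      (raises-∏ r _ λ j → raises-- {p = y zero} {y (suc j)} (h zero) (h (suc j)))
          (raises-vandermonde (y ∘ suc) (h ∘ suc))

    -- Identifies the degree of δ with the socle degree for n variables, so that δ can serve as the
    -- generator in `cyclic-flagged`.
    socle-degree : ∀ m → m ℕ.* r′ ℕ.+ vandermonde-degree m ≡ socle m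
    socle-degree zero    = ≡.refl
    socle-degree (suc m) = ≡.trans (arith r′ m (vandermonde-degree m)) (≡.cong (ℕ._+ (r′ ℕ.+ r ℕ.* m)) (socle-degree m))
      where
      arith : ∀ r′ m v → suc m ℕ.* r′ ℕ.+ (m ℕ.* suc r′ ℕ.+ v) ≡ m ℕ.* r′ ℕ.+ v ℕ.+ (r′ ℕ.+ suc r′ ℕ.* m)
      arith = solve-∀

    productForm : Expr n
    productForm = V.∏ᴿ (λ i → var i Exp′.^ r′) ⊗ V.vandermonde (λ i → var i Exp′.^ r)

    δ-productForm : δE ≋ productForm
    δ-productForm = R.trans (R.reflexive (discriminantᴱ-≡ r′ var)) (V.discriminant-vandermonde r′ var)

    supp-δ : Supp (socle n) δᵁ
    supp-δ a h = trans (at δ-productForm 𝟙ᵁ a) (raised a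
        (λ e → h (≡.trans e (≡.trans (ℕ.+-identityʳ _) (socle-degree n)))))
      where
      origin-sum : ∀ m → Vec.sum (Vec.replicate m 0) ≡ 0
      origin-sum zero    = ≡.refl
      origin-sum (suc m) = origin-sum m
      raised : Supp (n ℕ.* r′ ℕ.+ vandermonde-degree n ℕ.+ 0) (fn (⟦ raiseᵁ ⟧ productForm) 𝟙ᵁ)
      raised = raises-⊗ {p = V.∏ᴿ (λ i → var i Exp′.^ r′)} {V.vandermonde (λ i → var i Exp′.^ r)}
        (raises-∏ {n} r′ _ λ i → raises-^ {var i} (raises-var i) r′)
        (raises-vandermonde _ λ i → raises-^ {var i} (raises-var i) r)
        λ a h → 𝟙ᵁ-elsewhere a (λ { ≡.refl → h (origin-sum n) })

    Integralᵁ : Expr n → Set (c ⊔ ℓ)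
    Integralᵁ p = ∀ {u} → IntFn u → IntFn (fn (⟦ raiseᵁ ⟧ p) u)

    integral-1ᵁ : Integralᵁ (con 1#)
    integral-1ᵁ h a = int-* int-1 (h a)

    integral-^ᵁ : ∀ i k → Integralᵁ (var i Exp′.^ k)
    integral-^ᵁ i zero    = integral-1ᵁ
    integral-^ᵁ i (suc k) h a = int-* (int-× (lookup a i)) (integral-^ᵁ i k h _)

    integral-∏ᵁ : ∀ {m} (F : Fin m → Expr n) → (∀ i → Integralᵁ (F i)) → Integralᵁ (V.∏ᴿ F)
    integral-∏ᵁ {zero}  F h = integral-1ᵁ
    integral-∏ᵁ {suc m} F h i = h zero (integral-∏ᵁ (F ∘ suc) (h ∘ suc) i)

    integral-vandermonde : ∀ {m} (y : Fin m → Expr n) → (∀ i → Integralᵁ (y i)) → Integralᵁ (V.vandermonde y)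
    integral-vandermonde {zero}  y h = integral-1ᵁ
    integral-vandermonde {suc m} y h i = integral-∏ᵁ (λ j → y zero R.- y (suc j))
      (λ j k a → int-+ (h zero k a) (int-* (int-neg int-1) (h (suc j) k a)))
          (integral-vandermonde (y ∘ suc) (h ∘ suc) i)

    integral-δ : IntFn δᵁ
    integral-δ a = int-resp (sym (at δ-productForm 𝟙ᵁ a)) (integral-∏ᵁ {n} _ (λ i → integral-^ᵁ i r′)
      (integral-vandermonde _ (λ i → integral-^ᵁ i r) λ b → int-𝟙 b) a)
      where
      int-𝟙 : IntFn 𝟙ᵁ
      int-𝟙 b = decide (Vec.≡-dec ℕ._≟_ b (Vec.replicate n 0))
        where
        decide : Dec (b ≡ Vec.replicate n 0) → Int (𝟙ᵁ b)
        decide (yes ≡.refl) = int-resp (sym (𝟙ᵁ-origin {n})) int-1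
        decide (no b≢0)     = int-resp (sym (𝟙ᵁ-elsewhere b b≢0)) int-0

    -- The value of δ at the point (1, …, n) is a unit.

    module _ where
      private
        I : Set
        I = Fin 1
        point : Fin n → ℕ
        point i = suc (toℕ i)
        X : Fin n → Lin I I
        X i = scaleL (point i ×′ 1#) idL
        X-commute : ∀ i j → Commute (X i) (X j)
        X-commute i j F x = *-swap _ _ _
        gens : Generators X (λ _ → zeroL)
        gens = record
          { commute = X-commute
          ; mixed = λ i j F x → sym (zeroʳ _)
          ; exterior = record { anti = λ i j F x → sym -0#≈0# ; square = λ i F x → refl }
          }
        Value : Expr n → Carrier → Set (c ⊔ ℓ)
        Value p k = ∀ F → fn (⟦ X ⟧ p) F ≗ k ⊡ F

        UnitValue : Expr n → Set (c ⊔ ℓ)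
        UnitValue p = ∃ λ k → Unit k × Value p k

        unit-1 : Unit 1#
        unit-1 = 1# , *-identityˡ 1#

        value-⊗ : ∀ {p q} → UnitValue p → UnitValue q → UnitValue (p ⊗ q)
        value-⊗ (k , u , v) (k′ , u′ , v′) = k * k′ , unit-* u u′ , λ F x →
          trans (v _ x) (trans (*-congˡ (v′ F x)) (sym (*-assoc _ _ _)))

        value-∏ : ∀ {m} (F : Fin m → Expr n) → (∀ i → UnitValue (F i)) → UnitValue (∏ᴱ F)
        value-∏ {zero}  F h = 1# , unit-1 , λ F x → refl
        value-∏ {suc m} F h = value-⊗ {F zero} {∏ᴱ (F ∘ suc)} (h zero) (value-∏ (F ∘ suc) (h ∘ suc))

        value-^ : ∀ i k → Value (var i ^ᴱ k) ((point i ℕ.^ k) ×′ 1#)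
        value-^ i zero    F x = *-congʳ (sym (+-identityʳ 1#))
        value-^ i (suc k) F x = trans (*-congˡ (value-^ i k F x)) (trans (sym (*-assoc _ _ _))
          (*-congʳ (sym (Mult.×1-homo-* (point i) (point i ℕ.^ k)))))

        value-difference : ∀ i j → i ≢ j → UnitValue (var i ^ᴱ r ⊝ var j ^ᴱ r)
        value-difference i j i≢j = a + - b ,
          unit-difference (point i ℕ.^ r) (point j ℕ.^ r)
            (λ e → i≢j (Fin.toℕ-injective (ℕ.suc-injective (power-injective e))))
            (trans (+-assoc _ _ _) (trans (+-congˡ (-‿inverseˡ b)) (+-identityʳ a))) ,
          λ F x → trans (+-cong (value-^ i r F x) (trans (*-congˡ (value-^ j r F x))
              (trans (-1*x≈-x _) (-‿distribˡ-* _ _))))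
            (sym (distribʳ _ _ _))
          where
          a b : Carrier
          a = (point i ℕ.^ r) ×′ 1#
          b = (point j ℕ.^ r) ×′ 1#
          power-injective : point i ℕ.^ r ≡ point j ℕ.^ r → point i ≡ point j
          power-injective e with ℕ.<-cmp (point i) (point j)
          ... | tri< lt _ _ = ⊥-elim (ℕ.<⇒≢ (ℕ.^-monoˡ-< r lt) e)
          ... | tri≈ _ eq _ = eq
          ... | tri> _ _ gt = ⊥-elim (ℕ.<⇒≢ (ℕ.^-monoˡ-< r gt) (≡.sym e))

        value-δ : UnitValue δE
        value-δ = value-⊗ {∏ᴱ λ i → var i ^ᴱ r′} {∏ᴱ λ i → ∏ᴱ (factor i)}
          (value-∏ (λ i → var i ^ᴱ r′) λ i → (point i ℕ.^ r′) ×′ 1# , power-unit (point i ℕ.^ r′)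
              (ℕ.m^n>0 (point i) r′) , value-^ i r′)
          (value-∏ (λ i → ∏ᴱ (factor i)) λ i → value-∏ (factor i) (entry i))
          where
          factor : Fin n → Fin n → Expr n
          factor i j = if does (i Fin.<? j) then var i ^ᴱ r ⊝ var j ^ᴱ r else con 1#
          power-unit : ∀ m → 1 ℕ.≤ m → Unit (m ×′ 1#)
          power-unit (suc m) _ = unit-suc m
          entry : ∀ i j → UnitValue (factor i j)
          entry i j = conditional (does (i Fin.<? j)) λ { e ≡.refl →
            true≢false (≡.trans (≡.sym e) (dec-false (i Fin.<? i) (ℕ.<-irrefl ≡.refl))) }
            where
            true≢false : true ≢ false
            true≢false ()
            conditional : ∀ b → (b ≡ true → i ≢ j) → UnitValue (if b then var i ^ᴱ r ⊝ var j ^ᴱ r else con 1#)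
            conditional true  h = value-difference i j (h ≡.refl)
            conditional false h = 1# , unit-1 , λ F x → refl

      -- Scalar multiplications by 1, ..., n are commuting operators on which Ω acts, so a vanishing
      -- δ would have value 0 at this point, against `value-δ`.
      δ≉0 : ¬ δᵁ ≗ 𝟘
      δ≉0 z with value-δ
      ... | k , u , v = unit-≉0 u (trans (sym (*-identityʳ k)) (trans (sym (v (λ _ → 1#) zero))
        (trans (sym (represents (represents-δ r′) gens (λ _ → 1#) zero))
          (apply-resp X (λ _ → zeroL) {δΩ n r} {0Ω} (hat-injective {f = δΩ n r} {0Ω} λ x →
            trans (hat-δ x) (trans (fn-zero embed z x) (sym (hat-0 x)))) (λ _ → 1#) zero))))

  lookup-transpose : ∀ {a} {A : Set a} {n} (k : Adj n) (v : Vec A n) i →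
    lookup (transposeᵛ k v) i ≡ lookup v (transpose k i)
  lookup-transpose swap     (x ∷ y ∷ v) zero          = ≡.refl
  lookup-transpose swap     (x ∷ y ∷ v) (suc zero)    = ≡.refl
  lookup-transpose swap     (x ∷ y ∷ v) (suc (suc i)) = ≡.refl
  lookup-transpose (skip k) (x ∷ v)     zero          = ≡.refl
  lookup-transpose (skip k) (x ∷ v)     (suc i)       = lookup-transpose k v i

  update-transpose : ∀ {a} {A : Set a} {n} (k : Adj n) (v : Vec A n) i f →
    transposeᵛ k (v [ transpose k i ]%= f) ≡ transposeᵛ k v [ i ]%= f
  update-transpose swap     (x ∷ y ∷ v) zero          f = ≡.refl
  update-transpose swap     (x ∷ y ∷ v) (suc zero)    f = ≡.refl
  update-transpose swap     (x ∷ y ∷ v) (suc (suc i)) f = ≡.refl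
  update-transpose (skip k) (x ∷ v)     zero          f = ≡.refl
  update-transpose (skip k) (x ∷ v)     (suc i)       f = ≡.cong (x ∷_) (update-transpose k v i f)

  transposeᵛ-involutive : ∀ {a} {A : Set a} {n} (k : Adj n) (v : Vec A n) → transposeᵛ k (transposeᵛ k v) ≡ v
  transposeᵛ-involutive swap     (x ∷ y ∷ v) = ≡.refl
  transposeᵛ-involutive (skip k) (x ∷ v)     = ≡.cong (x ∷_) (transposeᵛ-involutive k v)

  transposeᵛ-replicate : ∀ {a} {A : Set a} {n} (k : Adj n) (x : A) → transposeᵛ k (Vec.replicate n x) ≡ Vec.replicate
      n x
  transposeᵛ-replicate swap     x = ≡.refl
  transposeᵛ-replicate (skip k) x = ≡.cong (x ∷_) (transposeᵛ-replicate k x)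

  transposeᵁ : ∀ {n} → Adj n → Lin (Vec ℕ n) (Vec ℕ n)
  fn (transposeᵁ k) u a = u (transposeᵛ k a)
  fncong (transposeᵁ k) p _ = p _
  fn-⊞ (transposeᵁ k) F G _ = refl
  fn-⊡ (transposeᵁ k) l F _ = refl

  Alternating : ∀ {n} → Fn (Vec ℕ n) → Set ℓ
  Alternating u = ∀ k a → u (transposeᵛ k a) ≈ - u a

  -- Alternating functions on exponents congruent to -1 modulo r.

  module Sorting (r′ : ℕ) where
    private
      r : ℕ
      r = suc r′

    Residue : ℕ → Set
    Residue x = ∃ λ q → x ≡ q ℕ.* r ℕ.+ r′

    data Ascending : ∀ {n} → ℕ → Vec ℕ n → Set where
      []  : ∀ {l} → Ascending l []
      _∷_ : ∀ {l n x} {a : Vec ℕ n} → l ℕ.≤ x → Ascending x a → Ascending l (x ∷ a)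

    -- `reflects` is required of every alternating u, so that the recursion may apply it after
    -- fixing the first coordinate.
    record Rearranged {n} (l : ℕ) (a : Vec ℕ n) : Set (c ⊔ ℓ) where
      field
        result    : Vec ℕ n
        ascending : Ascending l result
        same-sum  : Vec.sum result ≡ Vec.sum a
        residues  : (∀ i → Residue (lookup a i)) → ∀ i → Residue (lookup result i)
        reflects  : ∀ {u} → Alternating u → u result ≈ 0# → u a ≈ 0#

    open Rearranged

    insert : ∀ {n} l x (a : Vec ℕ n) → l ℕ.≤ x → Ascending l a → Rearranged l (x ∷ a)
    insert l x [] l≤x [] = record
      { result = x ∷ [] ; ascending = l≤x ∷ [] ; same-sum = ≡.refl ; residues = λ h → h ; reflects = λ _ z → z }
    insert l x (y ∷ a) l≤x (l≤y ∷ asc) with ℕ.≤-total x y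
    ... | inj₁ x≤y = record
      { result = x ∷ y ∷ a ; ascending = l≤x ∷ x≤y ∷ asc ; same-sum = ≡.refl ; residues = λ h → h ; reflects = λ _ z →
          z }
    ... | inj₂ y≤x = record
      { result = y ∷ result rec
      ; ascending = l≤y ∷ ascending rec
      ; same-sum = ≡.trans (≡.cong (y ℕ.+_) (same-sum rec)) (exchange y x (Vec.sum a))
      ; residues = λ h → λ { zero → h (suc zero)
                           ; (suc i) → residues rec (λ { zero → h zero ; (suc i) → h (suc (suc i)) }) i }
      ; reflects = λ {u} alt z → trans (sym (-‿involutive _)) (trans (-‿cong (sym (alt swap (x ∷ y ∷ a))))
          (trans (-‿cong (reflects rec {λ b → u (y ∷ b)} (λ k b → alt (skip k) (y ∷ b)) z)) -0#≈0#))
      }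
      where
      rec : Rearranged y (x ∷ a)
      rec = insert y x a y≤x asc
      exchange : ∀ a b c → a ℕ.+ (b ℕ.+ c) ≡ b ℕ.+ (a ℕ.+ c)
      exchange = solve-∀

    sort : ∀ {n} (a : Vec ℕ n) → Rearranged 0 a
    sort [] = record { result = [] ; ascending = [] ; same-sum = ≡.refl ; residues = λ h → h ; reflects = λ _ z → z }
    sort (x ∷ a) = record
      { result = result inserted
      ; ascending = ascending inserted
      ; same-sum = ≡.trans (same-sum inserted) (≡.cong (x ℕ.+_) (same-sum rec))
      ; residues = λ h → residues inserted λ { zero → h zero ; (suc i) → residues rec (λ i → h (suc i)) i }
      ; reflects = λ {u} alt z → reflects rec {λ b → u (x ∷ b)} (λ k b → alt (skip k) (x ∷ b)) (reflects inserted alt z)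
      }
      where
      rec : Rearranged 0 a
      rec = sort a
      inserted : Rearranged 0 (x ∷ result rec)
      inserted = insert 0 x (result rec) ℕ.z≤n (ascending rec)

    -- The sum l + (l + r) + ... of n terms: the least sum of n distinct exponents that start at l
    -- and lie in one residue class modulo r.
    progression : ℕ → ℕ → ℕ
    progression l zero    = 0
    progression l (suc n) = l ℕ.+ progression (l ℕ.+ r) n

    progression-mono : ∀ {l m} n → l ℕ.≤ m → progression l n ℕ.≤ progression m n
    progression-mono zero    h = ℕ.z≤n
    progression-mono (suc n) h = ℕ.+-mono-≤ h (progression-mono n (ℕ.+-monoˡ-≤ r h))

    progression-suc : ∀ l n → progression (l ℕ.+ r) n ≡ progression l n ℕ.+ r ℕ.* n
    progression-suc l zero    = ≡.sym (ℕ.*-zeroʳ r)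
    progression-suc l (suc n) = ≡.trans (≡.cong (l ℕ.+ r ℕ.+_) (progression-suc (l ℕ.+ r) n))
      (arith l r (progression (l ℕ.+ r) n) n)
      where
      arith : ∀ l r p n → l ℕ.+ r ℕ.+ (p ℕ.+ r ℕ.* n) ≡ l ℕ.+ p ℕ.+ r ℕ.* suc n
      arith = solve-∀

    progression-socle : ∀ n → progression r′ n ≡ Elimination.socle {n} r′ n
    progression-socle n = go n
      where
      go : ∀ m → progression r′ m ≡ Elimination.socle {n} r′ m
      go zero    = ≡.refl
      go (suc m) = ≡.trans (≡.cong (r′ ℕ.+_) (progression-suc r′ m))
        (≡.trans (arith r′ (progression r′ m) (r ℕ.* m)) (≡.cong (ℕ._+ (r′ ℕ.+ r ℕ.* m)) (go m)))
        where
        arith : ∀ a b c → a ℕ.+ (b ℕ.+ c) ≡ b ℕ.+ (a ℕ.+ c)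
        arith = solve-∀

    residue-gap : ∀ {x y} → Residue x → Residue y → x ℕ.< y → x ℕ.+ r ℕ.≤ y
    residue-gap {x} {y} (p , ≡.refl) (q , ≡.refl) x<y = ℕ.≤-trans (ℕ.≤-reflexive (arith p r r′))
      (ℕ.+-monoˡ-≤ r′ (ℕ.*-monoˡ-≤ r (ℕ.*-cancelʳ-< r p q (ℕ.+-cancelʳ-< r′ (p ℕ.* r) (q ℕ.* r) x<y))))
      where
      arith : ∀ p r r′ → p ℕ.* r ℕ.+ r′ ℕ.+ r ≡ suc p ℕ.* r ℕ.+ r′
      arith = solve-∀

    double-zero : ∀ {k} → k ≈ - k → k ≈ 0#
    double-zero {k} e = unit-cancel (unit-suc 1) (trans (distribʳ k 1# (1# + 0#))
      (trans (+-cong (*-identityˡ k) (trans (*-congʳ (+-identityʳ 1#)) (*-identityˡ k)))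
        (trans (+-congʳ e) (-‿inverseˡ k))))

    -- Two equal neighbours give u = -u at this exponent, hence zero as 2 is a unit. Otherwise
    -- neighbours in the same residue class differ by at least r.
    ascending-bound : ∀ {n} x (a : Vec ℕ n) {u} → Alternating u → Ascending x a → Residue x →
      (∀ i → Residue (lookup a i)) → u (x ∷ a) ≈ 0# ⊎ progression x (suc n) ℕ.≤ x ℕ.+ Vec.sum a
    ascending-bound x [] alt asc rx ra = inj₂ ℕ.≤-refl
    ascending-bound {suc n} x (y ∷ a) {u} alt (x≤y ∷ asc) rx ra with ℕ.m≤n⇒m<n∨m≡n x≤y
    ... | inj₂ ≡.refl = inj₁ (double-zero (alt swap (x ∷ x ∷ a)))
    ... | inj₁ x<y with ascending-bound y a {λ b → u (x ∷ b)} (λ k b → alt (skip k) (x ∷ b)) asc (ra zero) (ra ∘ suc)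
    ...   | inj₁ z = inj₁ z
    ...   | inj₂ h = inj₂ (ℕ.+-monoʳ-≤ x (ℕ.≤-trans (progression-mono (suc n) (residue-gap rx (ra zero) x<y)) h))

    alternating-vanishes : ∀ {n} {u : Fn (Vec ℕ n)} → Alternating u → ∀ a → (∀ i → Residue (lookup a i)) →
      Vec.sum a ℕ.< progression r′ n → u a ≈ 0#
    alternating-vanishes {n} {u} alt a ra small = reflects s alt (vanish alt (result s) (ascending s) (residues s ra)
      (≡.subst (ℕ._< progression r′ n) (≡.sym (same-sum s)) small))
      where
      s : Rearranged 0 a
      s = sort a
      vanish : ∀ {n} {u : Fn (Vec ℕ n)} → Alternating u → ∀ b → Ascending 0 b → (∀ i → Residue (lookup b i)) →
        Vec.sum b ℕ.< progression r′ n → u b ≈ 0#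
      vanish alt [] _ _ ()
      vanish {suc n} {u} alt (x ∷ b) (_ ∷ asc) rb small with ascending-bound x b {u} alt asc (rb zero) (rb ∘ suc)
      ... | inj₁ z = z
      ... | inj₂ h = ⊥-elim (ℕ.<⇒≱ small (ℕ.≤-trans (progression-mono (suc n) r′≤x) h))
        where
        r′≤x : r′ ℕ.≤ x
        r′≤x = ≡.subst (r′ ℕ.≤_) (≡.sym (proj₂ (rb zero))) (ℕ.m≤n+m r′ (proj₁ (rb zero) ℕ.* r))

  adjacent : ∀ {n} → Adj n → Permutation′ n
  adjacent swap     = Perm.swap Perm.id
  adjacent (skip k) = Perm.lift₀ (adjacent k)

  adjacent-transpose : ∀ {n} (k : Adj n) i → adjacent k ⟨$⟩ʳ i ≡ transpose k i
  adjacent-transpose swap     zero          = ≡.refl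
  adjacent-transpose swap     (suc zero)    = ≡.refl
  adjacent-transpose swap     (suc (suc i)) = ≡.refl
  adjacent-transpose (skip k) zero          = ≡.refl
  adjacent-transpose (skip k) (suc i)       = ≡.cong suc (adjacent-transpose k i)

  all-or : ∀ {m p q} {P : Fin m → Set p} {Q : Set q} → (∀ i → P i ⊎ Q) → (∀ i → P i) ⊎ Q
  all-or {zero}  h = inj₁ λ ()
  all-or {suc m} h with h zero | all-or (h ∘ suc)
  ... | inj₂ q | _      = inj₂ q
  ... | inj₁ p | inj₂ q = inj₂ q
  ... | inj₁ p | inj₁ f = inj₁ λ { zero → p ; (suc i) → f i }

  -- Membership of δ in the inverse system.

  module DiscriminantHarmonic {n : ℕ} (r′ : ℕ) (ζ : Carrier) (root : ζ ^ suc r′ ≈ 1#)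
    (separated : ∀ k x → 0 ℕ.< k → k ℕ.< suc r′ → ζ ^ k * x ≈ x → x ≈ 0#) where

    open Core {n} using (U; Supp; shift; shift-comm; sum-suc)
    open Discriminant {n} r′
    open Invariance {n} r′ ζ root
    open Elimination {n} r′ using (socle)
    open Sorting r′
    private
      module D = DiscriminantRing (raiseᵁ {n}) raiseᵁ-comm
      module E = ExprRing (raiseᵁ {n}) raiseᵁ-comm
      module R = CommutativeRing E.exprRing
      module V = Vandermonde E.exprRing
      module VK = Vandermonde K
      module ExpR = CSExp R.commutativeSemiring
      r : ℕ
      r = suc r′

    δ-relabelled : ∀ (σ : Fin n → Expr n) F → fn (⟦ (λ i → ⟦ raiseᵁ ⟧ (σ i)) ⟧ δE) F ≗ fn
        (⟦ raiseᵁ ⟧ (V.discriminant r′ σ)) F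
    δ-relabelled σ F a = trans (sym (⟦substitute⟧ raiseᵁ σ δE F a)) (reflexive (≡.cong (λ p → fn (⟦ raiseᵁ ⟧ p) F a)
      (≡.trans (substitute-discriminant r′ σ) (D.discriminantᴱ-≡ r′ σ))))

    δ-discriminant : ∀ F → fn (⟦ raiseᵁ ⟧ (V.discriminant r′ var)) F ≗ fn (⟦ raiseᵁ ⟧ δE) F
    δ-discriminant F a = reflexive (≡.cong (λ p → fn (⟦ raiseᵁ ⟧ p) F a) (≡.sym (D.discriminantᴱ-≡ r′ var)))

    transpose-𝟙 : ∀ k → fn (transposeᵁ k) (𝟙ᵁ {n}) ≗ 𝟙ᵁ
    transpose-𝟙 k a = decide (Vec.≡-dec ℕ._≟_ a (Vec.replicate n 0))
      where
      decide : Dec (a ≡ Vec.replicate n 0) → 𝟙ᵁ (transposeᵛ k a) ≈ 𝟙ᵁ a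
      decide (yes ≡.refl) = reflexive (≡.cong 𝟙ᵁ (transposeᵛ-replicate k 0))
      decide (no a≢0) = trans (𝟙ᵁ-elsewhere (transposeᵛ k a) λ e → a≢0 (≡.trans (≡.sym (transposeᵛ-involutive k a))
        (≡.trans (≡.cong (transposeᵛ k) e) (transposeᵛ-replicate k 0)))) (sym (𝟙ᵁ-elsewhere a a≢0))

    -- Transposing coordinates amounts to relabelling the variables in the expression for δ, and 1
    -- is unaffected; the sign is that of the Vandermonde product.
    alternating-δ : Alternating δᵁ
    alternating-δ k a = trans (intertwine-⟦⟧ raiseᵁ (raiseᵁ ∘ transpose k) (transposeᵁ k)
        (λ i u a → *-cong (reflexive (≡.cong (_×′ 1#) (lookup-transpose k a i)))
          (reflexive (≡.cong u (≡.sym (update-transpose k a i ℕ.pred))))) δE 𝟙ᵁ a)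
      (trans (fncong (⟦ raiseᵁ ∘ transpose k ⟧ δE) (transpose-𝟙 k) a)
        (trans (δ-relabelled (var ∘ transpose k) 𝟙ᵁ a)
          (trans (E.at (V.discriminant-transpose r′ k var) 𝟙ᵁ a)
            (trans (*-congˡ (*-identityˡ _)) (trans (-1*x≈-x _) (-‿cong (δ-discriminant 𝟙ᵁ a)))))))

    module Scaling (s : Fin n → Carrier) (s^r : ∀ i → s i ^ r ≈ 1#) where
      weight : ∀ {m} → (Fin m → Carrier) → Vec ℕ m → Carrier
      weight t a = VK.∏ᴿ λ i → t i ^ lookup a i

      weight-suc : ∀ {m} (t : Fin m → Carrier) a i → weight t (a [ i ]%= suc) ≈ t i * weight t a
      weight-suc t (k ∷ a) zero    = *-assoc _ _ _
      weight-suc t (k ∷ a) (suc i) = trans (*-congˡ (weight-suc (t ∘ suc) a i)) (*-swap _ _ _)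

      scaleᵁ : Lin (Vec ℕ n) (Vec ℕ n)
      fn scaleᵁ u a = weight s a * u a
      fncong scaleᵁ p a = *-congˡ (p a)
      fn-⊞ scaleᵁ F G a = distribˡ _ _ _
      fn-⊡ scaleᵁ k F a = *-swap _ _ _

      scale-raise : ∀ i → Intertwines scaleᵁ (raiseᵁ i) (⟦ raiseᵁ ⟧ (con (s i) ⊗ var i))
      scale-raise i u a with lookup a i in e
      ... | zero = trans (*-congˡ (zeroˡ _)) (trans (zeroʳ _) (sym (trans (*-congˡ (zeroˡ _)) (zeroʳ _))))
      ... | suc k = trans (*-congʳ (trans (reflexive (≡.cong (weight s) (≡.sym (pred-suc a i e))))
          (weight-suc s (a [ i ]%= ℕ.pred) i)))
        (trans (*-assoc _ _ _) (*-congˡ (*-swap _ _ _)))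

      scale-𝟙 : fn scaleᵁ 𝟙ᵁ ≗ 𝟙ᵁ
      scale-𝟙 a = decide (Vec.≡-dec ℕ._≟_ a (Vec.replicate n 0))
        where
        decide : Dec (a ≡ Vec.replicate n 0) → weight s a * 𝟙ᵁ a ≈ 𝟙ᵁ a
        decide (yes ≡.refl) = trans (*-congʳ (VK.∏-1 {n} _ λ i →
          reflexive (≡.cong (s i ^_) (Vec.lookup-replicate i 0)))) (*-identityˡ _)
        decide (no a≢0) = trans (*-congˡ (𝟙ᵁ-elsewhere a a≢0)) (trans (zeroʳ _) (sym (𝟙ᵁ-elsewhere a a≢0)))

      con-^ : ∀ k m → con k ExpR.^ m E.≋ con (k ^ m)
      con-^ k zero    = R.refl
      con-^ k (suc m) = R.trans (R.*-congˡ {con k} (con-^ k m)) (E.equal λ F a → sym (*-assoc _ _ _))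

      module _ (j : Fin n) (trivial : ∀ i → i ≢ j → s i ≈ 1#) where
        one-^ : ∀ {k} m → k ≈ 1# → k ^ m ≈ 1#
        one-^ zero    e = refl
        one-^ (suc m) e = trans (*-cong e (one-^ m e)) (*-identityˡ 1#)

        weight-single : ∀ a → weight s a ≈ s j ^ lookup a j
        weight-single a = VK.∏-single {n} _ j λ i i≢j → one-^ (lookup a i) (trivial i i≢j)

        scale-δ : fn scaleᵁ δᵁ ≗ s j ^ r′ ⊡ δᵁ
        scale-δ a = trans (intertwine-⟦⟧ raiseᵁ (λ i → ⟦ raiseᵁ ⟧ (con (s i) ⊗ var i)) scaleᵁ scale-raise δE 𝟙ᵁ a)
          (trans (fncong (⟦ (λ i → ⟦ raiseᵁ ⟧ (con (s i) ⊗ var i)) ⟧ δE) scale-𝟙 a)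
            (trans (δ-relabelled (λ i → con (s i) ⊗ var i) 𝟙ᵁ a)
              (trans (E.at factored 𝟙ᵁ a) (*-congˡ (δ-discriminant 𝟙ᵁ a)))))
          where
          factored : V.discriminant r′ (λ i → con (s i) ⊗ var i) E.≋ con (s j ^ r′) ⊗ V.discriminant r′ var
          factored = R.trans
            (V.discriminant-scale r′ (λ i → con (s i)) var λ i → R.trans (con-^ (s i) r)
              (E.equal λ F a → *-congʳ (s^r i)))
            (R.*-congʳ {V.discriminant r′ var} (R.trans
              (V.∏-single {n} (λ i → con (s i) ExpR.^ r′) j λ i i≢j → R.trans (con-^ (s i) r′)
                (E.equal λ F a → *-congʳ (one-^ r′ (trivial i i≢j))))
              (con-^ (s j) r′)))

    no-θ : Fin n → Lin (Vec ℕ n) (Vec ℕ n)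
    no-θ i = zeroL

    shift-gens : Generators shift no-θ
    shift-gens = record
      { commute = shift-comm
      ; mixed = λ i j F x → refl
      ; exterior = record { anti = λ i j F x → sym -0#≈0# ; square = λ i F x → refl }
      }

    -- The element f ⊙ δ. The θ act by zero because every ∂ᶿᵢ kills δ.
    contraction : Ω n → U
    contraction f = fn (apply shift no-θ f) δᵁ

    module _ (σ : Wreath r n) where
      open Act σ using (perm; scalar)

      contraction-act : ∀ f → contraction (act r ζ σ f) ≗
        fn (apply (λ i → scaleL (scalar i) (shift (perm i))) no-θ f) δᵁ
      contraction-act f a = trans (interpret contraction (λ _ → refl) (λ f g → apply-+ shift no-θ f g δᵁ)
          (λ k f → apply-· shift no-θ k f δᵁ)
          (λ i h → (scalar i · xΩ (perm i)) *Ω h) (λ i h → (scalar i · θΩ (perm i)) *Ω h)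
          (λ i → scaleL (scalar i) (shift (perm i))) no-θ
          (λ i h b → trans (apply-* shift-gens (scalar i · xΩ (perm i)) h δᵁ b)
            (trans (apply-· shift no-θ (scalar i) (xΩ (perm i)) (contraction h) b) (*-congˡ
              (trans (apply-mulˣ shift-gens (perm i) 1Ω (contraction h) b) (apply-1 shift no-θ (contraction h) _)))))
          (λ i h b → trans (apply-* shift-gens (scalar i · θΩ (perm i)) h δᵁ b)
            (trans (apply-· shift no-θ (scalar i) (θΩ (perm i)) (contraction h) b) (trans (*-congˡ
              (apply-mulᶿ shift-gens (perm i) 1Ω (contraction h) b)) (zeroʳ _))))
          f 1Ω a)
        (fncong (apply (λ i → scaleL (scalar i) (shift (perm i))) no-θ f) (apply-1 shift no-θ δᵁ) a)

      contraction-invariant : ∀ {f} → act r ζ σ f ≈Ω f → contraction f ≗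
        fn (apply (λ i → scaleL (scalar i) (shift (perm i))) no-θ f) δᵁ
      contraction-invariant {f} inv a = trans (sym (apply-resp shift no-θ {act r ζ σ f} {f} inv δᵁ a))
          (contraction-act f a)

    contraction-alternating : ∀ {f} → Invariant r ζ f → Alternating (contraction f)
    contraction-alternating {f} inv k a = trans
      (intertwine-apply (transposeᵁ k) shift no-θ (λ i → scaleL (scalar i) (shift (perm i))) no-θ
        (λ i u b → trans (reflexive (≡.cong u (≡.trans (≡.sym (update-transpose k b i suc))
            (≡.cong (λ l → transposeᵛ k (b [ l ]%= suc)) (≡.sym (adjacent-transpose k i))))))
          (trans (sym (*-identityˡ _)) (*-congʳ (sym root))))
        (λ i u b → refl) f δᵁ a)
      (trans (fncong S {G = λ b → - δᵁ b} (alternating-δ k) a)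
          (trans (fn-neg S δᵁ a) (-‿cong (sym (contraction-invariant σ {f} (inv σ) a)))))
      where
      -- The diagonal part is trivial: the exponent 0 gives the scalar `ζ ^ r`, which is 1.
      σ : Wreath r n
      σ = (λ _ → zero) , adjacent k
      open Act σ using (perm; scalar)
      S : Lin (Vec ℕ n) (Vec ℕ n)
      S = apply (λ i → scaleL (scalar i) (shift (perm i))) no-θ f

    -- Let w be the value at a, and t the residue of its j-th exponent. Invariance under the
    -- diagonal element that scales xⱼ alone, by `ζ ^ r′`, the inverse of ζ, gives
    -- `ζ ^ (r′ ℕ.∸ t) * w ≈ w`. Unless t is r′, `separated` makes w zero.
    residue-or-zero : ∀ {f} → Invariant r ζ f → ∀ a j → Residue (lookup a j) ⊎ contraction f a ≈ 0#
    residue-or-zero {f} inv a j with (lookup a j % r) ℕ.≟ r′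
    ... | yes t≡r′ = inj₁ (lookup a j / r , ≡.trans (m≡m%n+[m/n]*n (lookup a j) r)
            (≡.trans (ℕ.+-comm _ (lookup a j / r ℕ.* r)) (≡.cong (lookup a j / r ℕ.* r ℕ.+_) t≡r′)))
    ... | no t≢r′ = inj₂ (separated (r′ ℕ.∸ t) (contraction f a) (ℕ.m<n⇒0<n∸m t<r′) (ℕ.s≤s (ℕ.m∸n≤m r′ t)) fixed)
      where
      t : ℕ
      t = lookup a j % r
      t<r′ : t ℕ.< r′
      t<r′ = ℕ.≤∧≢⇒< (ℕ.s≤s⁻¹ (m%n<n (lookup a j) r)) t≢r′
      -- The exponent 1 exists in `Fin r` only for r at least 2, which t < r′ guarantees.
      1<r : 1 ℕ.< r
      1<r = ℕ.s≤s (ℕ.≤-trans (ℕ.s≤s ℕ.z≤n) t<r′)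
      exponent : Fin n → Fin r
      exponent i = if does (i Fin.≟ j) then Fin.fromℕ< 1<r else zero
      σ : Wreath r n
      σ = exponent , Perm.id
      open Act σ using (perm; scalar; scalar-power)
      open Scaling scalar (λ i → scalar-power i r (divides 1 (≡.sym (ℕ.*-identityˡ r))))
      exponent-j : exponent j ≡ Fin.fromℕ< 1<r
      exponent-j = ≡.cong (λ b → if b then Fin.fromℕ< 1<r else zero) (dec-true (j Fin.≟ j) ≡.refl)
      scalar-j : scalar j ≈ ζ ^ r′
      scalar-j = reflexive (≡.cong (λ k → ζ ^ (r ℕ.∸ k)) (≡.trans (≡.cong toℕ exponent-j) (Fin.toℕ-fromℕ< 1<r)))
      trivial : ∀ i → i ≢ j → scalar i ≈ 1#
      trivial i i≢j = trans (reflexive (≡.cong (λ b → ζ ^ (r ℕ.∸ toℕ (if b then Fin.fromℕ< 1<r else zero)))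
        (dec-false (i Fin.≟ j) i≢j))) root
      w : Carrier
      w = contraction f a
      ζs : ζ * scalar j ≈ 1#
      ζs = trans (*-congˡ scalar-j) root
      -- Rescaling the coordinates turns the scaled shifts into plain ones and multiplies δ by
      -- `scalar j ^ r′`.
      scaled : scalar j ^ lookup a j * w ≈ scalar j ^ r′ * w
      scaled = begin
        scalar j ^ lookup a j * w ≈⟨ *-congʳ (weight-single j trivial a) ⟨
        fn scaleᵁ (contraction f) a ≈⟨ fncong scaleᵁ (contraction-invariant σ {f} (inv σ)) a ⟩
        fn scaleᵁ (fn (apply (λ i → scaleL (scalar i) (shift (perm i))) no-θ f) δᵁ) a
          ≈⟨ intertwine-apply scaleᵁ (λ i → scaleL (scalar i) (shift (perm i))) no-θ shift no-θ
               (λ i u b → trans (*-swap _ _ _) (trans (sym (*-assoc _ _ _)) (*-congʳ (sym (weight-suc scalar b i)))))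
               (λ i u b → zeroʳ _) f δᵁ a ⟩
        fn (apply shift no-θ f) (fn scaleᵁ δᵁ) a ≈⟨ fncong (apply shift no-θ f) (scale-δ j trivial) a ⟩
        fn (apply shift no-θ f) (scalar j ^ r′ ⊡ δᵁ) a ≈⟨ fn-⊡ (apply shift no-θ f) _ _ a ⟩
        scalar j ^ r′ * w ∎
        where open SetoidReasoning setoid
      cancel : ∀ k → ζ ^ k * scalar j ^ k ≈ 1#
      cancel k = trans (sym (Exp.^-distrib-* ζ (scalar j) k)) (one-^ j trivial k ζs)
      reduce : scalar j ^ lookup a j ≈ scalar j ^ t
      reduce = begin
        scalar j ^ lookup a j ≈⟨ reflexive (≡.cong (scalar j ^_) (m≡m%n+[m/n]*n (lookup a j) r)) ⟩
        scalar j ^ (t ℕ.+ lookup a j / r ℕ.* r) ≈⟨ Exp.^-homo-* (scalar j) t _ ⟩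
        scalar j ^ t * scalar j ^ (lookup a j / r ℕ.* r) ≈⟨ *-congˡ
            (scalar-power j _ (divides (lookup a j / r) ≡.refl)) ⟩
        scalar j ^ t * 1# ≈⟨ *-identityʳ _ ⟩
        scalar j ^ t ∎
        where open SetoidReasoning setoid
      fixed : ζ ^ (r′ ℕ.∸ t) * w ≈ w
      fixed = begin
        ζ ^ (r′ ℕ.∸ t) * w ≈⟨ *-congʳ (trans (*-congˡ (cancel t)) (*-identityʳ _)) ⟨
        ζ ^ (r′ ℕ.∸ t) * (ζ ^ t * scalar j ^ t) * w ≈⟨ *-congʳ (*-assoc _ _ _) ⟨
        ζ ^ (r′ ℕ.∸ t) * ζ ^ t * scalar j ^ t * w
          ≈⟨ *-congʳ (*-cong (trans (reflexive (≡.cong (ζ ^_) (≡.sym (ℕ.m∸n+n≡m (ℕ.<⇒≤ t<r′)))))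
               (Exp.^-homo-* ζ (r′ ℕ.∸ t) t)) reduce) ⟨
        ζ ^ r′ * scalar j ^ lookup a j * w ≈⟨ *-assoc _ _ _ ⟩
        ζ ^ r′ * (scalar j ^ lookup a j * w) ≈⟨ *-congˡ scaled ⟩
        ζ ^ r′ * (scalar j ^ r′ * w) ≈⟨ *-assoc _ _ _ ⟨
        ζ ^ r′ * scalar j ^ r′ * w ≈⟨ *-congʳ (cancel r′) ⟩
        1# * w ≈⟨ *-identityˡ w ⟩
        w ∎
        where open SetoidReasoning setoid

    powers-supp : ∀ {t u} → Supp t u → ∀ b a → Vec.sum a ℕ.+ Vec.sum b ≢ t → fn (powers shift b) u a ≈ 0#
    powers-supp {t} {u} s b = go (Vec.sum b) b ≡.refl
      where
      go : ∀ k b → Vec.sum b ≡ k → ∀ a → Vec.sum a ℕ.+ Vec.sum b ≢ t → fn (powers shift b) u a ≈ 0#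
      go k b e a h with exponent-cases b
      go k b e a h | inj₁ ≡.refl = trans (powers-0 shift u a)
        (s a λ e′ → h (≡.trans (≡.cong (Vec.sum a ℕ.+_) (origin-sum n)) (≡.trans (ℕ.+-identityʳ _) e′)))
        where
        origin-sum : ∀ m → Vec.sum (Vec.replicate m 0) ≡ 0
        origin-sum zero    = ≡.refl
        origin-sum (suc m) = origin-sum m
      go zero b e a h | inj₂ (_ , _ , _ , e′) with () ← ≡.trans (≡.sym e′) e
      go (suc k) b e a h | inj₂ (b′ , i , ≡.refl , e′) = trans (powers-suc shift shift-comm i b′ u a)
        (go k b′ (ℕ.suc-injective (≡.trans (≡.sym e′) e)) (a [ i ]%= suc) λ e″ → h
          (≡.trans (≡.cong (Vec.sum a ℕ.+_) e′) (≡.trans (ℕ.+-suc (Vec.sum a) (Vec.sum b′))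
            (≡.trans (≡.cong (ℕ._+ Vec.sum b′) (≡.sym (sum-suc a i))) e″))))

    wedge-no-θ : ∀ J → J ≢ ⊥ → ∀ u → fn (wedge no-θ J) u ≗ 𝟘
    wedge-no-θ J J≢⊥ u = vanish J J≢⊥
      where
      vanish : ∀ {m} (J : Subset m) → J ≢ ⊥ → fn (wedge (λ _ → zeroL) J) u ≗ 𝟘
      vanish [] J≢⊥ x = ⊥-elim (J≢⊥ ≡.refl)
      vanish (inside ∷ J) J≢⊥ x = refl
      vanish (outside ∷ J) J≢⊥ x = vanish J (λ e → J≢⊥ (≡.cong (outside ∷_) e)) x

    -- A monomial of positive degree lowers δ below the degree `socle n`, and one with a θ kills it,
    -- so only the constant term of f contributes.
    contraction-high : ∀ f a → socle n ℕ.≤ Vec.sum a → contraction f a ≈ constantTerm f * δᵁ a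
    contraction-high [] a h = sym (zeroˡ _)
    contraction-high ((k , b , J) ∷ f) a h = trans (+-cong (term (Vec.≡-dec ℕ._≟_ b (Vec.replicate n 0))
        (Vec.≡-dec Bool._≟_ J ⊥)) (contraction-high f a h)) (sym (trans (distribʳ _ _ _) refl))
      where
      c₀ : Carrier
      c₀ = if does ((Vec.replicate n 0 , ⊥) ≟ᵐ (b , J)) then k else 0#
      absent : (Vec.replicate n 0 , ⊥) ≢ (b , J) → c₀ ≈ 0#
      absent ne = reflexive (≡.cong (if_then k else 0#) (dec-false ((Vec.replicate n 0 , ⊥) ≟ᵐ (b , J)) ne))
      term : Dec (b ≡ Vec.replicate n 0) → Dec (J ≡ ⊥) → k * fn (powers shift b) (fn (wedge no-θ J) δᵁ) a ≈ c₀ * δᵁ a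
      term _ (no J≢⊥) = trans (*-congˡ (fn-zero (powers shift b) (wedge-no-θ J J≢⊥ δᵁ) a))
        (trans (zeroʳ k) (sym (trans (*-congʳ (absent λ e → J≢⊥ (≡.sym (,-injectiveʳ e)))) (zeroˡ _))))
      term (yes ≡.refl) (yes ≡.refl) = *-cong
        (reflexive (≡.cong (if_then k else 0#) (≡.sym (dec-true ((Vec.replicate n 0 , ⊥) ≟ᵐ (b , J)) ≡.refl))))
        (trans (powers-0 shift _ a) (wedge-⊥ no-θ δᵁ a))
      term (no b≢0) (yes ≡.refl) = trans (*-congˡ (trans (fncong (powers shift b) (wedge-⊥ no-θ δᵁ) a)
          (powers-supp supp-δ b a λ e → b≢0 (zero-sum b (ℕ.n≤0⇒n≡0 (ℕ.+-cancelˡ-≤ (Vec.sum a) _ _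
            (ℕ.≤-trans (ℕ.≤-reflexive e) (ℕ.≤-trans h (ℕ.≤-reflexive (≡.sym (ℕ.+-identityʳ (Vec.sum a))))))))))))
        (trans (zeroʳ k) (sym (trans (*-congʳ (absent λ e → b≢0 (≡.sym (,-injectiveˡ e)))) (zeroˡ _))))
        where
        zero-sum : ∀ {m} (b : Vec ℕ m) → Vec.sum b ≡ 0 → b ≡ Vec.replicate m 0
        zero-sum []         e = ≡.refl
        zero-sum (zero ∷ b) e = ≡.cong (0 ∷_) (zero-sum b e)

    contraction-zero : ∀ {f} → Generating f → contraction f ≗ 𝟘
    contraction-zero {f} (inv , z) a with Vec.sum a ℕ.<? socle n
    ... | no  h = trans (contraction-high f a (ℕ.≮⇒≥ h)) (trans (*-congʳ z) (zeroˡ _))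
    ... | yes h with all-or (residue-or-zero {f} inv a)
    ...   | inj₂ w≈0 = w≈0
    ...   | inj₁ residues = alternating-vanishes (contraction-alternating {f} inv) a residues
              (≡.subst (Vec.sum a ℕ.<_) (≡.sym (progression-socle n)) h)

    apply-embed : ∀ f u → f ⊛ fn embed u ≗ fn embed (fn (apply shift no-θ f) u)
    apply-embed f u x = sym (intertwine-apply embed shift no-θ lower (toggle false) (λ i u x → refl)
      (λ i u x → trans (fn-𝟘 embed x) (sym (embed-contract i u x))) f u x)

    -- With the θ acting by zero, Ω acts through a commutative ring; this lets a generator f reach δ
    -- past any h.
    apply-apply : ∀ f h u → fn (apply shift no-θ f) (fn (apply shift no-θ h) u) ≗ fn (apply shift no-θ h)
        (fn (apply shift no-θ f) u)
    apply-apply f h u x = sym (intertwine-apply (apply shift no-θ h) shift no-θ shift no-θ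
      (λ i v y → sym (intertwine-apply (shift i) shift no-θ shift no-θ (λ j → shift-comm i j) (λ j v y → refl) h v y))
      (λ i v y → fn-𝟘 (apply shift no-θ h) y) f u x)

    δ-harmonic : (Ideal Generating ^⊥) (δΩ n r)
    δ-harmonic = generators-perp {g = δΩ n r} λ {f} f∈ h x → trans
      (fncong (apply lower (toggle false) f) (λ y → trans (fncong (apply lower (toggle false) h) hat-δ y)
          (apply-embed h δᵁ y)) x)
      (trans (apply-embed f (fn (apply shift no-θ h) δᵁ) x) (fn-zero embed
        (λ a → trans (apply-apply f h δᵁ a) (fn-zero (apply shift no-θ h) (contraction-zero {f} f∈) a)) x))

  sum-single : ∀ {m} (F : Fin m → Carrier) j → (∀ i → i ≢ j → F i ≈ 0#) → sum F ≈ F j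
  sum-single {suc m} F zero z = trans (+-congˡ (sum-zero (F ∘ suc) λ i → z (suc i) λ ())) (+-identityʳ _)
  sum-single {suc m} F (suc j) z = trans (+-cong (z zero λ ())
    (sum-single (F ∘ suc) j λ i i≢j → z (suc i) (i≢j ∘ Fin.suc-injective))) (+-identityˡ _)

  iterate-+ : ∀ {I} (T : Lin I I) a b F → fn (iterate T (a ℕ.+ b)) F ≗ fn (iterate T a) (fn (iterate T b) F)
  iterate-+ T zero    b F x = refl
  iterate-+ T (suc a) b F x = fncong T (iterate-+ T a b F) x

  -- The sum of the elements of J, counting positions from t.
  total : ∀ {m} → ℕ → Subset m → ℕ
  total t []      = 0
  total t (b ∷ J) = (if b then t else 0) ℕ.+ total (suc t) J

  total-flip : ∀ {m} t (i : Fin m) J → lookup J i ≡ false → total t (flip i J) ≡ total t J ℕ.+ (t ℕ.+ toℕ i)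
  total-flip t zero (false ∷ J) e = ≡.trans (ℕ.+-comm t _) (≡.cong (total (suc t) J ℕ.+_) (≡.sym (ℕ.+-identityʳ t)))
  total-flip t (suc i) (b ∷ J) e = ≡.trans (≡.cong (_ ℕ.+_) (total-flip (suc t) i J e))
    (≡.trans (≡.sym (ℕ.+-assoc (if b then t else 0) _ _)) (≡.cong (total t (b ∷ J) ℕ.+_) (≡.sym (ℕ.+-suc t (toℕ i)))))

  total-bound : ∀ {m} t (J : Subset m) → total t J ℕ.≤ total t (Vec.replicate m true)
  total-bound t []          = ℕ.z≤n
  total-bound t (true ∷ J)  = ℕ.+-monoʳ-≤ t (total-bound (suc t) J)
  total-bound t (false ∷ J) = ℕ.≤-trans (total-bound (suc t) J) (ℕ.m≤n+m _ t)

  subsets : ∀ m → List (Subset m)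
  subsets zero    = [] ∷ []
  subsets (suc m) = map (false ∷_) (subsets m) ++ map (true ∷_) (subsets m)

  subsets-complete : ∀ {m} (J : Subset m) → J ∈ subsets m
  subsets-complete []          = here ≡.refl
  subsets-complete (false ∷ J) = ∈-++⁺ˡ (∈-map⁺ (false ∷_) (subsets-complete J))
  subsets-complete (true ∷ J)  = ∈-++⁺ʳ (map (false ∷_) (subsets _)) (∈-map⁺ (true ∷_) (subsets-complete J))

  -- Combinations of Euler operators with a prescribed top component.

  module Triangular {n : ℕ} (r′ : ℕ) where
    open Core {n}
    open Elimination {n} r′
    open Flags {n} r′
    open Discriminant {n} r′
    private
      module L = ExprRing (lower {n}) lower-comm
      module LR = CommutativeRing L.exprRing
      module S = NaturalCoefficients LR.commutativeSemiring

    component : Subset n → Lin (Monomial n) (Vec ℕ n)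
    fn (component J) F a = F (a , J)
    fncong (component J) p a = p (a , J)
    fn-⊞ (component J) F G a = refl
    fn-⊡ (component J) k F a = refl

    poly : Expr n → Lin (Monomial n) (Monomial n)
    poly p = ⟦ lower ⟧ p

    component-poly : ∀ J p F → fn (component J) (fn (poly p) F) ≗ p ▸ fn (component J) F
    component-poly J p F = intertwine-⟦⟧ lower shift (component J) (λ i F a → refl) p F

    poly-iterate : ∀ i m F → fn (poly (var i ^ᴬ m)) F ≗ fn (iterate (lower i) m) F
    poly-iterate i zero    F x = *-identityˡ _
    poly-iterate i (suc m) F x = poly-iterate i m F _

    poly-Y^ : ∀ i k F → fn (poly (Y i ^ᴬ k)) F ≗ fn (iterate (lower i) (k ℕ.* r)) F
    poly-Y^ i zero    F x = *-identityˡ _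
    poly-Y^ i (suc k) F x = trans (poly-iterate i r _ x)
      (trans (fncong (iterate (lower i) r) (poly-Y^ i k F) x) (sym (iterate-+ (lower i) r (k ℕ.* r) F x)))

    twisted : (Fin n → Expr n) → ℕ → List (Fin n) → Fin n → Expr n
    twisted q k N i = q i ⊗ (Y i ^ᴬ k ⊗ differences i N)

    twisted-∷ : ∀ q k l N i → twisted q k (l ∷ N) i L.≋ twisted q (suc k) N i ⊕ con (- 1#) ⊗ (Y l ⊗ twisted q k N i)
    twisted-∷ q k l N i = S.solve 6 (λ q yk y m yl δ → q S.:* (yk S.:* ((y S.:+ m S.:* yl) S.:* δ)) S.:=
        q S.:* ((y S.:* yk) S.:* δ) S.:+ m S.:* (yl S.:* (q S.:* (yk S.:* δ)))) LR.refl
      (q i) (Y i ^ᴬ k) (Y i) (con (- 1#)) (Y l) (differences i N)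

    -- The analogue of `weightedSum` with operators Tᵢ in place of weights. With right
    -- multiplications and q i = xᵢ it combines Euler operators; with contractions and q i =
    -- xᵢ^(r-1) it combines the invariants Σ xᵢ^(kr+r-1) θᵢ.
    twistedSum : (Fin n → Lin (Monomial n) (Monomial n)) → (Fin n → Expr n) → ℕ → List (Fin n) → Lin (Monomial n)
        (Monomial n)
    twistedSum T q k N = sumL λ i → T i ⊚ poly (twisted q k N i)

    twistedSum-∷ : ∀ T q k l N → (∀ i p → Commute (T i) (poly p)) → ∀ F →
      fn (twistedSum T q k (l ∷ N)) F ≗ fn (twistedSum T q (suc k) N) F ⊞ - 1# ⊡ fn (poly (Y l))
          (fn (twistedSum T q k N) F)
    twistedSum-∷ T q k l N comm F x = trans (fn-sumL (λ i → T i ⊚ poly (twisted q k (l ∷ N) i)) F x)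
      (trans (sum-cong-≋ λ i → trans (fncong (T i) (L.at (twisted-∷ q k l N i) F) x) (trans (fn-⊞ (T i) _ _ x)
          (+-congˡ (trans (fn-⊡ (T i) (- 1#) (fn (poly (Y l)) (fn (poly (twisted q k N i)) F)) x)
            (*-congˡ (comm i (Y l) (fn (poly (twisted q k N i)) F) x))))))
        (trans (∑-distrib-+ (λ i → fn (T i ⊚ poly (twisted q (suc k) N i)) F x)
            (λ i → - 1# * fn (poly (Y l)) (fn (T i ⊚ poly (twisted q k N i)) F) x))
          (+-cong (sym (fn-sumL (λ i → T i ⊚ poly (twisted q (suc k) N i)) F x))
            (trans (sym (fn-sum (scaleL (- 1#) (poly (Y l))) (λ i → fn (T i ⊚ poly (twisted q k N i)) F) x))
              (*-congˡ (fncong (poly (Y l)) (λ y → sym (fn-sumL (λ i → T i ⊚ poly (twisted q k N i)) F y)) x))))))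

    toggle-poly : ∀ b i p → Commute (toggle b i) (poly p)
    toggle-poly b i p F x = intertwine-⟦⟧ lower lower (toggle b i) (λ j F y → refl) p F x

    rightMul-poly : ∀ i p → Commute (rightMul i) (poly p)
    rightMul-poly i p F x = intertwine-⟦⟧ lower lower (rightMul i) (λ j F y → refl) p F x

    Hat : ∀ {v} → Pred (Ω n) v → Dual {n} → Set _
    Hat V F = ∃ λ g → V g × (hat g ≗ F)

    module Closed {v} {V : Pred (Ω n) v} (closed : IsOperatorClosed n r V) where
      open IsOperatorClosed closed
      open IsSubspace isSubspace

      hat-≗ : ∀ {F G} → F ≗ G → Hat V F → Hat V G
      hat-≗ e (g , g∈V , e′) = g , g∈V , λ x → trans (e′ x) (e x)

      hat-𝟘 : Hat V 𝟘
      hat-𝟘 = 0Ω , 0∈V , hat-0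

      hat-⊞ : ∀ {F G} → Hat V F → Hat V G → Hat V (F ⊞ G)
      hat-⊞ (f , f∈V , e) (g , g∈V , e′) = f +Ω g , +∈V f∈V g∈V , λ x → trans (hat-+ f g x) (+-cong (e x) (e′ x))

      hat-⊡ : ∀ k {F} → Hat V F → Hat V (k ⊡ F)
      hat-⊡ k (f , f∈V , e) = k · f , ·∈V k f∈V , λ x → trans (hat-· k f x) (*-congˡ (e x))

      hat-poly : ∀ p {F} → Hat V F → Hat V (fn (poly p) F)
      hat-poly (con k) h = hat-⊡ k h
      hat-poly (var i) (f , f∈V , e) = ∂ i f , ∂-closed i f∈V , λ x → trans (hat-∂ i f x) (fncong (lower i) e x)
      hat-poly (p ⊕ q) h = hat-⊞ (hat-poly p h) (hat-poly q h)
      hat-poly (p ⊗ q) h = hat-poly p (hat-poly q h)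

      hat-euler : ∀ k → k ℕ.< n → ∀ {F} → Hat V F → Hat V (fn (euler (k ℕ.* r ℕ.+ 1)) F)
      hat-euler k k<n (f , f∈V , e) = dΩ (k ℕ.* r ℕ.+ 1) f ,
        ≡.subst (λ m → V (dΩ (m ℕ.* r ℕ.+ 1) f)) (Fin.toℕ-fromℕ< k<n) (d-closed (Fin.fromℕ< k<n) f∈V) ,
        λ x → trans (hat-d (k ℕ.* r ℕ.+ 1) f x) (fncong (euler (k ℕ.* r ℕ.+ 1)) e x)

      -- Expanding the product over N uses the Euler operators with indices from k to k + length N;
      -- the bound by n keeps to the permitted ones.
      hat-twisted : ∀ N k → k ℕ.+ length N ℕ.< n → ∀ {F} → Hat V F → Hat V (fn (twistedSum rightMul var k N) F)
      hat-twisted [] k k<n {F} h = hat-≗ (λ x → trans (fn-euler (k ℕ.* r ℕ.+ 1) F x)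
          (trans (sum-cong-≋ λ i → fncong (rightMul i) (λ y → sym (power i y)) x)
            (sym (fn-sumL (λ i → rightMul i ⊚ poly (twisted var k [] i)) F x))))
        (hat-euler k (≡.subst (ℕ._< n) (ℕ.+-identityʳ k) k<n) h)
        where
        power : ∀ i → fn (poly (twisted var k [] i)) F ≗ fn (iterate (lower i) (k ℕ.* r ℕ.+ 1)) F
        power i y = trans (poly-Y^ i k (fn (poly (con 1#)) F) _)
          (trans (fncong (iterate (lower i) (suc (k ℕ.* r))) (λ z → *-identityˡ (F z)) y)
            (reflexive (≡.cong (λ m → fn (iterate (lower i) m) F y) (ℕ.+-comm 1 (k ℕ.* r)))))
      hat-twisted (l ∷ N) k h {F} F∈ = hat-≗ (λ x → sym (twistedSum-∷ rightMul var k l N rightMul-poly F x))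
        (hat-⊞ (hat-twisted N (suc k) (≡.subst (ℕ._< n) (ℕ.+-suc k (length N)) h) F∈)
          (hat-⊡ (- 1#) (hat-poly (Y l) (hat-twisted N k (ℕ.<-trans (ℕ.+-monoʳ-< k (ℕ.n<1+n (length N))) h) F∈))))

    -- The final segment {t , t + 1 , …} of the variables, flagged by J.
    data Tail (J : Subset n) : ℕ → Flagged → Set where
      []   : Tail J n []
      step : ∀ {t L} j → toℕ j ≡ t → Tail J (suc t) L → Tail J t ((j , lookup J j) ∷ L)

    flags : Subset n → Flagged
    flags J = tabulate λ i → i , lookup J i

    flags-tail : ∀ J → Tail J 0 (flags J)
    flags-tail J = go id 0 (λ i → ≡.refl) ≡.refl
      where
      go : ∀ {m} (ι : Fin m → Fin n) t → (∀ i → toℕ (ι i) ≡ t ℕ.+ toℕ i) → t ℕ.+ m ≡ n →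
        Tail J t (tabulate λ i → ι i , lookup J (ι i))
      go {zero} ι t e e′ = ≡.subst (λ t → Tail J t []) (≡.trans (≡.sym e′) (ℕ.+-identityʳ t)) []
      go {suc m} ι t e e′ = step (ι zero) (≡.trans (e zero) (ℕ.+-identityʳ t))
        (go (ι ∘ suc) (suc t) (λ i → ≡.trans (e (suc i)) (ℕ.+-suc t (toℕ i))) (≡.trans (≡.sym (ℕ.+-suc t m)) e′))

    tail-length : ∀ {J t L} → Tail J t L → t ℕ.+ length L ≡ n
    tail-length [] = ℕ.+-identityʳ n
    tail-length (step {t} {L} j e tl) = ≡.trans (ℕ.+-suc t (length L)) (tail-length tl)

    tail-∈ : ∀ {J t L} → Tail J t L → ∀ i → t ℕ.≤ toℕ i → i ∈ map proj₁ L
    tail-∈ [] i n≤i = ⊥-elim (ℕ.<⇒≱ (Fin.toℕ<n i) n≤i)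
    tail-∈ (step j e tl) i t≤i with ℕ.m≤n⇒m<n∨m≡n t≤i
    ... | inj₁ t<i = there (tail-∈ tl i t<i)
    ... | inj₂ t≡i = here (Fin.toℕ-injective (≡.trans (≡.sym t≡i) (≡.sym e)))

    -- Twisting the Euler operators by ∏ (t - Yₗ), l > j, makes the coefficients of θᵢ
    -- vanish for i > j.
    element : Flagged → Dual {n}
    element []                = hat (δΩ n r)
    element ((j , false) ∷ L) = element L
    element ((j , true) ∷ L)  = fn (twistedSum rightMul var 0 (map proj₁ L)) (element L)

    flagged : Flagged → Subset n
    flagged []                = ⊥
    flagged ((j , false) ∷ L) = flagged L
    flagged ((j , true) ∷ L)  = flip j (flagged L)

    module _ {v} {V : Pred (Ω n) v} (closed : IsOperatorClosed n r V) where
      hat-element : ∀ {J t L} → Tail J t L → Hat V (element L)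
      hat-element [] = δΩ n r , IsOperatorClosed.δ∈V closed , λ x → refl
      hat-element {J} (step {t} {L} j e tl) with lookup J j
      ... | false = hat-element tl
      ... | true = Closed.hat-twisted closed (map proj₁ L) 0
        (≡.subst (ℕ._< n) (≡.sym (List.length-map proj₁ L))
          (ℕ.≤-trans (ℕ.m≤n+m (suc (length L)) t) (ℕ.≤-reflexive (≡.trans (ℕ.+-suc t (length L)) (tail-length tl)))))
        (hat-element tl)

    flagged-below : ∀ {J t L} → Tail J t L → ∀ i → toℕ i ℕ.< t → lookup (flagged L) i ≡ false
    flagged-below [] i i<t = Vec.lookup-replicate i outside
    flagged-below {J} (step {L = L} j ≡.refl tl) i i<t with lookup J j
    ... | false = flagged-below tl i (ℕ.m<n⇒m<1+n i<t)
    ... | true = ≡.trans (lookup-flip′ {i = j} {i} (λ { ≡.refl → ℕ.<-irrefl ≡.refl i<t }) (flagged L))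
        (flagged-below tl i (ℕ.m<n⇒m<1+n i<t))

    flagged-lookup : ∀ {J t L} → Tail J t L → ∀ i → t ℕ.≤ toℕ i → lookup (flagged L) i ≡ lookup J i
    flagged-lookup [] i n≤i = ⊥-elim (ℕ.<⇒≱ (Fin.toℕ<n i) n≤i)
    flagged-lookup {J} (step {L = L} j ≡.refl tl) i t≤i with i Fin.≟ j
    ... | no i≢j = ≡.trans (other (lookup J j)) (flagged-lookup tl i (ℕ.≤∧≢⇒< t≤i (i≢j ∘ Fin.toℕ-injective ∘ ≡.sym)))
      where
      other : ∀ b → lookup (flagged ((j , b) ∷ L)) i ≡ lookup (flagged L) i
      other true  = lookup-flip′ i≢j (flagged L)
      other false = ≡.refl
    ... | yes ≡.refl = self (lookup J i)
      where
      below : lookup (flagged L) i ≡ false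
      below = flagged-below tl i ℕ.≤-refl
      self : ∀ b → lookup (flagged ((i , b) ∷ L)) i ≡ b
      self true  = ≡.trans (lookup-flip i (flagged L)) (≡.cong not below)
      self false = below

    flagged-flags : ∀ J → flagged (flags J) ≡ J
    flagged-flags J = ≡.trans (≡.sym (Vec.tabulate∘lookup (flagged (flags J))))
      (≡.trans (Vec.tabulate-cong λ i → flagged-lookup (flags-tail J) i ℕ.z≤n) (Vec.tabulate∘lookup J))

    -- Components of smaller sum are left uncontrolled, since the descent reaches them later.
    record Leading (L : Flagged) : Set (c ⊔ ℓ) where
      field
        vanish : ∀ J → total 0 (flagged L) ℕ.≤ total 0 J → J ≢ flagged L → fn (component J) (element L) ≗ 𝟘
        unit   : Carrier
        isUnit : Unit unit
        lead   : fn (component (flagged L)) (element L) ≗ unit ⊡ generator L ▸ δᵁ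

    open Leading

    -- At J′ the i-th term involves the component of `element L` at J′ without i. For i > j the
    -- twisting polynomial is zero. For i ≤ j the smaller set still has sum at least that of
    -- `flagged L`, so its component vanishes unless it equals `flagged L`, and equality of the sums
    -- then forces i = j.
    leading-∷ : ∀ {J L} j b → Tail J (suc (toℕ j)) L → Leading L → Leading ((j , b) ∷ L)
    leading-∷ j false tl ld = record { vanish = vanish ld ; unit = unit ld ; isUnit = isUnit ld ; lead = lead ld }
    leading-∷ {_} {L} j true tl ld = record
      { vanish = λ J′ le ne a → trans (expand J′ a) (sum-zero {n} _ λ i → zero-term J′ le ne i a)
      ; unit = sign j B′ * (parity B * unit ld)
      ; isUnit = unit-* (sign j B′ , sign-square j B′) (unit-* (parity B , parity-square B) (isUnit ld))
      ; lead = λ a → trans (expand B′ a) (trans (sum-single _ j λ i i≢j → other i i≢j a) (at-j a))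
      }
      where
      B B′ : Subset n
      B = flagged L
      B′ = flip j B
      N : List (Fin n)
      N = map proj₁ L
      v : Dual {n}
      v = element L
      B-j : lookup B j ≡ false
      B-j = flagged-below tl j ℕ.≤-refl
      term : Subset n → Fin n → Vec ℕ n → Carrier
      term J′ i a = when (lookup J′ i) (sign i J′ *
          (parity (flip i J′) * (twisted var 0 N i ▸ fn (component (flip i J′)) v) a))
      expand : ∀ J′ a → fn (twistedSum rightMul var 0 N) v (a , J′) ≈ sum (λ i → term J′ i a)
      expand J′ a = trans (fn-sumL (λ i → rightMul i ⊚ poly (twisted var 0 N i)) v (a , J′))
        (sum-cong-≋ λ i → when-cong (lookup J′ i) (*-congˡ
            (*-congˡ (component-poly (flip i J′) (twisted var 0 N i) v a))))
      vanishing-term : ∀ J′ i a → (twisted var 0 N i ▸ fn (component (flip i J′)) v) a ≈ 0# → term J′ i a ≈ 0#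
      vanishing-term J′ i a z = trans (when-cong (lookup J′ i)
          (trans (*-congˡ (trans (*-congˡ z) (zeroʳ _))) (zeroʳ _)))
        (when-0 (lookup J′ i))
        where
        when-0 : ∀ b → when b 0# ≈ 0#
        when-0 true  = refl
        when-0 false = refl
      in-N : ∀ i → i ∈ N → ∀ u → twisted var 0 N i ▸ u ≗ 𝟘
      in-N i i∈N u = ▸-zero (var i) (λ a → trans (*-identityˡ _) (con0-kills (differences-∈ i∈N) a))
      not-in : ∀ J′ i a → lookup J′ i ≡ false → term J′ i a ≈ 0#
      not-in J′ i a e = reflexive (≡.cong (λ b → when b
          (sign i J′ * (parity (flip i J′) * (twisted var 0 N i ▸ fn (component (flip i J′)) v) a))) e)
      other : ∀ i → i ≢ j → ∀ a → term B′ i a ≈ 0#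
      other i i≢j a with toℕ i ℕ.<? suc (toℕ j)
      ... | yes i<t = not-in B′ i a (≡.trans (lookup-flip′ i≢j B) (flagged-below tl i i<t))
      ... | no i≮t = vanishing-term B′ i a (in-N i (tail-∈ tl i (ℕ.≮⇒≥ i≮t)) _ a)
      at-j : ∀ a → term B′ j a ≈ sign j B′ * (parity B * unit ld) * (generator ((j , true) ∷ L) ▸ δᵁ) a
      at-j a = trans (reflexive (≡.cong₂ (λ b D → when b
          (sign j B′ * (parity D * (twisted var 0 N j ▸ fn (component D) v) a)))
          (≡.trans (lookup-flip j B) (≡.cong not B-j)) (flip-flip j B)))
        (trans (*-congˡ (*-congˡ value)) (sym (trans (*-assoc _ _ _) (*-congˡ (*-assoc _ _ _)))))
        where
        value : (twisted var 0 N j ▸ fn (component B) v) a ≈ unit ld * (generator ((j , true) ∷ L) ▸ δᵁ) a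
        value = trans (▸-cong (twisted var 0 N j) (lead ld) a)
            (trans (fn-⊡ (⟦ shift ⟧ (twisted var 0 N j)) (unit ld) _ a)
          (*-congˡ (trans (*-identityˡ _) (▸-comm (cofactor j N) (generator L) δᵁ a))))
      zero-term : ∀ J′ → total 0 B′ ℕ.≤ total 0 J′ → J′ ≢ B′ → ∀ i a → term J′ i a ≈ 0#
      zero-term J′ le ne i a with lookup J′ i in e
      ... | false = refl
      ... | true with toℕ i ℕ.<? suc (toℕ j)
      ...   | no i≮t = trans (*-congˡ (trans (*-congˡ (in-N i (tail-∈ tl i (ℕ.≮⇒≥ i≮t)) _ a)) (zeroʳ _))) (zeroʳ _)
      ...   | yes (ℕ.s≤s i≤j) = trans (*-congˡ (trans
          (*-congˡ (▸-zero (twisted var 0 N i) (vanish ld (flip i J′) le′ ne′) a)) (zeroʳ _)))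
                (zeroʳ _)
        where
        sums : total 0 B ℕ.+ toℕ j ℕ.≤ total 0 (flip i J′) ℕ.+ toℕ i
        sums = ≡.subst₂ ℕ._≤_ (total-flip 0 j B B-j)
          (≡.trans (≡.cong (total 0) (≡.sym (flip-flip i J′)))
            (total-flip 0 i (flip i J′) (≡.trans (lookup-flip i J′) (≡.cong not e)))) le
        le′ : total 0 B ℕ.≤ total 0 (flip i J′)
        le′ = ℕ.+-cancelʳ-≤ (toℕ j) _ _ (ℕ.≤-trans sums (ℕ.+-monoʳ-≤ (total 0 (flip i J′)) i≤j))
        ne′ : flip i J′ ≢ B
        ne′ e′ = ne (≡.trans (≡.sym (flip-flip i J′)) (≡.cong₂ flip i≡j e′))
          where
          i≡j : i ≡ j
          i≡j = Fin.toℕ-injective (ℕ.≤-antisym i≤j (ℕ.+-cancelˡ-≤ (total 0 B) _ _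
            (ℕ.≤-trans sums (ℕ.≤-reflexive (≡.cong (λ D → total 0 D ℕ.+ toℕ i) e′)))))

    leading : ∀ {J t L} → Tail J t L → Leading L
    leading [] = record
      { vanish = λ J _ ne a → trans (hat-δ (a , J))
          (reflexive (≡.cong (λ b → when b (δᵁ a)) (dec-false (Vec.≡-dec Bool._≟_ J ⊥) ne)))
      ; unit = 1#
      ; isUnit = 1# , *-identityˡ 1#
      ; lead = λ a → trans (hat-δ (a , ⊥)) (trans (embed-⊥ δᵁ a) (sym (trans (*-identityˡ _) (*-identityˡ _))))
      }
    leading {J} (step j ≡.refl tl) = leading-∷ j (lookup J j) tl (leading tl)

  -- The inverse system is closed under the operators and minimal.

  module OperatorTheorem {n : ℕ} (r′ : ℕ) (ζ : Carrier) (root : ζ ^ suc r′ ≈ 1#)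
    (separated : ∀ k x → 0 ℕ.< k → k ℕ.< suc r′ → ζ ^ k * x ≈ x → x ≈ 0#) where

    open Core {n}
    open Elimination {n} r′
    open Flags {n} r′
    open Discriminant {n} r′
    open Invariance {n} r′ ζ root
    open DiscriminantHarmonic {n} r′ ζ root separated using (δ-harmonic)
    open Triangular {n} r′
    open Leading

    Perp : Pred (Ω n) (c ⊔ ℓ)
    Perp = SI n r ζ ^⊥

    perp-closed : IsOperatorClosed n r Perp
    perp-closed = record
      { isSubspace = perp-subspace {P = Generating}
      ; δ∈V = δ-harmonic
      ; ∂-closed = λ i {g} → perp-∂ {P = Generating} i {g}
      ; d-closed = λ k {g} → perp-d {P = Generating} (toℕ k ℕ.* r ℕ.+ 1) (λ {f} → derive-generating (toℕ k) {f})
          (λ {f} → conjugate-generating {f}) {g}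
      }

    generating-kills : ∀ {f F} → Generating f → Hat Perp F → f ⊛ F ≗ 𝟘
    generating-kills {f} f∈ (g , g∈ , e) x = trans (sym (fncong (apply lower (toggle false) f) e x))
        (perp-hat {P = Generating} {g = g} g∈ {f} (gen f∈) x)

    powers-kill : ∀ {F} → Hat Perp F → ∀ k x → sum (λ i → fn (poly (Y i ^ᴬ suc k)) F x) ≈ 0#
    powers-kill {F} F∈ k x = trans (sum-cong-≋ λ i → trans (poly-Y^ i (suc k) F x)
        (fncong (iterate (lower i) (suc k ℕ.* r)) (λ y → sym (apply-1 lower (toggle false) F y)) x))
      (trans (sym (apply-∑iterate lower-gens (suc k ℕ.* r) (λ i → 1Ω) F x))
        (generating-kills {powerSumΩ (suc k ℕ.* r)} (powerSumΩ-generating k) F∈ x))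

    killed : ∀ {F} → Hat Perp F → ∀ J J′ → Killed (unflag (flags J)) (fn (component J′) F)
    killed {F} F∈ J J′ k a = trans (expand id) (trans (sum-cong-≋ λ i → sym (component-poly J′ (Y i ^ᴬ suc k) F a))
      (powers-kill F∈ k (a , J′)))
      where
      expand : ∀ {m} (ι : Fin m → Fin n) →
        (powerSum (suc k) (unflag (tabulate λ i → ι i , lookup J (ι i))) ▸ fn (component J′) F) a ≈
        sum (λ i → (Y (ι i) ^ᴬ suc k ▸ fn (component J′) F) a)
      expand {zero}  ι = zeroˡ _
      expand {suc m} ι = +-cong (trans (*-congʳ (+-identityʳ 1#)) (*-identityˡ _)) (expand (ι ∘ suc))

    contractions-kill : ∀ {F} → Hat Perp F → ∀ N k → fn (twistedSum (toggle false) (λ i → var i ^ᴬ r′) k N) F ≗ 𝟘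
    contractions-kill {F} F∈ [] k x = trans (fn-sumL
        (λ i → toggle false i ⊚ poly (twisted (λ i → var i ^ᴬ r′) k [] i)) F x)
      (trans (sum-cong-≋ λ i → trans (toggle-poly false i (twisted (λ i → var i ^ᴬ r′) k [] i) F x)
          (trans (poly-iterate i r′ _ x) (trans (fncong (iterate (lower i) r′)
              (λ y → trans (poly-Y^ i k _ y) (fncong (iterate (lower i) (k ℕ.* r)) (λ z → trans (*-identityˡ _)
                (sym (trans (apply-mulᶿ lower-gens i 1Ω F z) (fncong (toggle false i) (apply-1 lower (toggle false) F)
                    z)))) y)) x)
            (sym (iterate-+ (lower i) r′ (k ℕ.* r) (θΩ i ⊛ F) x)))))
        (trans (sym (apply-∑iterate lower-gens (r′ ℕ.+ k ℕ.* r) θΩ F x))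
          (generating-kills {powerSumᶿ (r′ ℕ.+ k ℕ.* r)} (powerSumᶿ-generating k) F∈ x)))
    contractions-kill {F} F∈ (l ∷ N) k x = trans (twistedSum-∷ (toggle false) (λ i → var i ^ᴬ r′) k l N
        (toggle-poly false) F x)
      (trans (+-cong (contractions-kill F∈ N (suc k) x)
        (trans (*-congˡ (fn-zero (poly (Y l)) (contractions-kill F∈ N k) x)) (zeroʳ _))) (+-identityˡ 0#))

    -- The twisted combination of the invariants Σ xᵢ^(kr+r-1) θᵢ is evaluated at J without j, with
    -- one term for each i outside this set. For i > j the term meets a set of larger sum than J;
    -- for i < j a factor of the product over N is zero; i = j gives the numerator.
    numerator-kills : ∀ {F} → Hat Perp F → ∀ J → (∀ J′ → total 0 J ℕ.< total 0 J′ → fn (component J′) F ≗ 𝟘) →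
      ∀ j → lookup J j ≡ true → ∀ N → (∀ i → toℕ i ℕ.< toℕ j → lookup J i ≡ false → i ∈ N) →
      numerator j N ▸ fn (component J) F ≗ 𝟘
    numerator-kills {F} F∈ J above j Jj N N∋ a = unit-cancel (sign j J′ , sign-square j J′)
      (trans (sym at-j) (trans (sym (sum-single _ j other)) (trans (sym expand) (contractions-kill F∈ N 0 (a , J′)))))
      where
      J′ : Subset n
      J′ = flip j J
      J′j : lookup J′ j ≡ false
      J′j = ≡.trans (lookup-flip j J) (≡.cong not Jj)
      q : Fin n → Expr n
      q i = var i ^ᴬ r′
      term : Fin n → Carrier
      term i = when (not (lookup J′ i)) (sign i J′ * (twisted q 0 N i ▸ fn (component (flip i J′)) F) a)
      expand : fn (twistedSum (toggle false) q 0 N) F (a , J′) ≈ sum term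
      expand = trans (fn-sumL (λ i → toggle false i ⊚ poly (twisted q 0 N i)) F (a , J′))
        (sum-cong-≋ λ i → when-cong (not (lookup J′ i)) (*-congˡ (component-poly (flip i J′) (twisted q 0 N i) F a)))
      at-j : term j ≈ sign j J′ * (numerator j N ▸ fn (component J) F) a
      at-j = trans (reflexive (≡.cong₂ (λ b D → when (not b) (sign j J′ * (twisted q 0 N j ▸ fn (component D) F) a))
          J′j (flip-flip j J)))
        (*-congˡ (▸-cong (var j ^ᴬ r′) (λ b → *-identityˡ _) a))
      sums : ∀ i → lookup J′ i ≡ false → toℕ j ℕ.< toℕ i → total 0 J ℕ.< total 0 (flip i J′)
      sums i e j<i = ≡.subst₂ ℕ._<_ (≡.trans (≡.sym (total-flip 0 j J′ J′j)) (≡.cong (total 0) (flip-flip j J)))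
        (≡.sym (total-flip 0 i J′ e)) (ℕ.+-monoʳ-< (total 0 J′) j<i)
      other : ∀ i → i ≢ j → term i ≈ 0#
      other i i≢j with lookup J′ i in e
      ... | true = refl
      ... | false with ℕ.<-cmp (toℕ i) (toℕ j)
      ...   | tri≈ _ i≡j _ = ⊥-elim (i≢j (Fin.toℕ-injective i≡j))
      ...   | tri> _ _ j<i = trans (*-congˡ (▸-zero (twisted q 0 N i) (above (flip i J′) (sums i e j<i)) a)) (zeroʳ _)
      ...   | tri< i<j _ _ = trans (*-congˡ (▸-zero (var i ^ᴬ r′) (λ b → trans (*-identityˡ _)
                (con0-kills (differences-∈ (N∋ i i<j (≡.trans (≡.sym (lookup-flip′ i≢j J)) e))) b)) a)) (zeroʳ _)

    annihilated : ∀ {J u} → (∀ j → lookup J j ≡ true → ∀ N → (∀ i → toℕ i ℕ.< toℕ j → lookup J i ≡ false → i ∈ N) →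
        numerator j N ▸ u ≗ 𝟘) →
      ∀ {t L} → Tail J t L → ∀ N → (∀ i → toℕ i ℕ.< t → lookup J i ≡ false → i ∈ N) → Annihilated N L u
    annihilated kills [] N N∋ = tt
    annihilated {J} {u} kills (step {L = L} j ≡.refl tl) N N∋ = at-flag (lookup J j) ≡.refl
      where
      at-flag : ∀ b → lookup J j ≡ b → Annihilated N ((j , b) ∷ L) u
      at-flag false e = annihilated kills tl (N ++ j ∷ []) extended
        where
        extended : ∀ i → toℕ i ℕ.< suc (toℕ j) → lookup J i ≡ false → i ∈ N ++ j ∷ []
        extended i (ℕ.s≤s i≤j) e′ with ℕ.m≤n⇒m<n∨m≡n i≤j
        ... | inj₁ i<j = ∈-++⁺ˡ (N∋ i i<j e′)
        ... | inj₂ i≡j = ∈-++⁺ʳ N (here (Fin.toℕ-injective i≡j))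
      at-flag true e = kills j e N N∋ , annihilated kills tl N extended
        where
        extended : ∀ i → toℕ i ℕ.< suc (toℕ j) → lookup J i ≡ false → i ∈ N
        extended i (ℕ.s≤s i≤j) e′ with ℕ.m≤n⇒m<n∨m≡n i≤j
        ... | inj₁ i<j = N∋ i i<j e′
        ... | inj₂ i≡j with Fin.toℕ-injective i≡j
        ...   | ≡.refl with () ← ≡.trans (≡.sym e) e′

    initial-state : ∀ J → State (Killed (unflag (flags J))) (unflag (flags J)) 0
    initial-state J = record
      { submodule = record
        { resp = λ e h k a → trans (sym (▸-cong (powerSum (suc k) W) e a)) (h k a)
        ; ⊞-closed = λ h h′ k a → trans (fn-⊞ (⟦ shift ⟧ (powerSum (suc k) W)) _ _ a)
            (trans (+-cong (h k a) (h′ k a)) (+-identityˡ 0#))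
        ; ▸-closed = λ p h k a → trans (▸-comm (powerSum (suc k) W) p _ a) (▸-zero p (h k) a)
        }
      ; killed = λ h → h
      -- Every variable occurs in the list, so the vanishing of all listed variables leaves only the
      -- value at the origin, and d₀ is 0.
      ; residue = leaf λ (h , zs) i → All.lookup zs (in-W i)
      }
      where
      W : Weighted
      W = unflag (flags J)
      in-W : ∀ i → (i , 0) ∈ W
      in-W i = ∈-map⁺ (λ (j , b) → j , 0) (∈-tabulate⁺ i)

    top-component : ∀ {F} → Hat Perp F → ∀ J → (∀ J′ → total 0 J ℕ.< total 0 J′ → fn (component J′) F ≗ 𝟘) →
      fn (component J) F ∈⟨ generator (flags J) ▸ δᵁ ⟩
    top-component {F} F∈ J above = cyclic-flagged (flags J) [] (initial-state J) δ-killed supp-δ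
      (≡.cong socle (≡.sym (List.length-tabulate {n = n} λ i → i , lookup J i))) integral-δ δ≉0 (fn (component J) F)
          (killed F∈ J J)
      (annihilated (numerator-kills F∈ J above) (flags-tail J) [] λ i ())
      where
      δ-killed : Killed (unflag (flags J)) δᵁ
      δ-killed k a = trans (▸-cong (powerSum (suc k) (unflag (flags J)))
        (λ b → sym (trans (hat-δ (b , ⊥)) (embed-⊥ δᵁ b))) a)
        (killed {hat (δΩ n r)} (δΩ n r , δ-harmonic , λ x → refl) J ⊥ k a)

    module Minimal {v} {V : Pred (Ω n) v} (closed : IsOperatorClosed n r V) where
      private
        module CV = Closed closed
        module CP = Closed perp-closed

      -- Collects what the descent has to know about one subtraction, so that it can proceed without
      -- the element subtracted.
      record Subtracted (J : Subset n) (F : Dual {n}) : Set (c ⊔ ℓ ⊔ v) where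
        field
          remainder : Dual {n}
          perp      : Hat Perp remainder
          restore   : Hat V remainder → Hat V F
          cleared   : fn (component J) remainder ≗ 𝟘
          unchanged : ∀ J′ → total 0 J ℕ.≤ total 0 J′ → J′ ≢ J → fn (component J′) F ≗ 𝟘 → fn (component J′) remainder
              ≗ 𝟘

      open Subtracted

      poly-vanish : ∀ J p → ∀ J′ → total 0 J ℕ.≤ total 0 J′ → J′ ≢ J →
        fn (component J′) (fn (poly p) (element (flags J))) ≗ 𝟘
      poly-vanish J p J′ le ne a = trans (component-poly J′ p (element (flags J)) a) (▸-zero p
        (vanish (leading (flags-tail J)) J′ (≡.subst (λ D → total 0 D ℕ.≤ total 0 J′) (≡.sym (flagged-flags J)) le)
          (λ e → ne (≡.trans e (flagged-flags J)))) a)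

      subtract-leading : ∀ J {F} → Hat Perp F → fn (component J) F ∈⟨ generator (flags J) ▸ δᵁ ⟩ → Subtracted J F
      subtract-leading J {F} F∈ (h , F≗) = record
        { remainder = F ⊞ - 1# ⊡ W
        ; perp = CP.hat-⊞ {F} { - 1# ⊡ W} F∈ (CP.hat-⊡ (- 1#) {W}
            (CP.hat-poly p {E} (hat-element perp-closed (flags-tail J))))
        ; restore = λ G∈ → CV.hat-≗ {(F ⊞ - 1# ⊡ W) ⊞ W} {F} (λ x → trans (+-assoc (F x) (- 1# * W x) (W x))
            (trans (+-congˡ (trans (+-congʳ (-1*x≈-x (W x))) (-‿inverseˡ (W x)))) (+-identityʳ (F x))))
            (CV.hat-⊞ {F ⊞ - 1# ⊡ W} {W} G∈ (CV.hat-poly p {E} (hat-element closed (flags-tail J))))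
        ; cleared = λ a → trans (+-congˡ (trans (*-congˡ (W-lead a)) (-1*x≈-x (F (a , J))))) (-‿inverseʳ (F (a , J)))
        ; unchanged = λ J′ le ne z a → trans (+-cong (z a)
            (trans (*-congˡ (poly-vanish J p J′ le ne a)) (zeroʳ (- 1#)))) (+-identityˡ 0#)
        }
        where
        ld : Leading (flags J)
        ld = leading (flags-tail J)
        p : Expr n
        p = con (proj₁ (isUnit ld)) ⊗ h
        E W : Dual {n}
        E = element (flags J)
        W = fn (poly p) E
        C : U
        C = generator (flags J) ▸ δᵁ
        E-lead : fn (component J) E ≗ unit ld ⊡ C
        E-lead = ≡.subst (λ D → fn (component D) E ≗ unit ld ⊡ C) (flagged-flags J) (lead ld)
        W-lead : fn (component J) W ≗ fn (component J) F
        W-lead a = begin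
          W (a , J) ≈⟨ component-poly J p E a ⟩
          (p ▸ fn (component J) E) a ≈⟨ ▸-cong p E-lead a ⟩
          (p ▸ (unit ld ⊡ C)) a ≈⟨ fn-⊡ (⟦ shift ⟧ p) (unit ld) C a ⟩
          unit ld * (proj₁ (isUnit ld) * (h ▸ C) a) ≈⟨ *-assoc _ _ _ ⟨
          unit ld * proj₁ (isUnit ld) * (h ▸ C) a ≈⟨ *-congʳ (trans (*-comm _ _) (proj₂ (isUnit ld))) ⟩
          1# * (h ▸ C) a ≈⟨ *-identityˡ _ ⟩
          (h ▸ C) a ≈⟨ F≗ a ⟨
          F (a , J) ∎
          where open SetoidReasoning setoid

      -- Whether a component vanishes is undecidable, so the subsets listed in E are treated one
      -- after another. Clearing J disturbs no other component of sum at least b, because the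
      -- element subtracted has no other component there.
      reduce : ∀ b → (∀ {F} → Hat Perp F → (∀ J → b ℕ.≤ total 0 J → fn (component J) F ≗ 𝟘) → Hat V F) →
        ∀ E {F} → Hat Perp F → (∀ J → b ℕ.< total 0 J → fn (component J) F ≗ 𝟘) →
        (∀ J → total 0 J ≡ b → J ∈ E ⊎ fn (component J) F ≗ 𝟘) → Hat V F
      reduce b ih [] {F} F∈ above level = ih F∈ λ J b≤ → vanishing J (ℕ.m≤n⇒m<n∨m≡n b≤)
        where
        vanishing : ∀ J → b ℕ.< total 0 J ⊎ b ≡ total 0 J → fn (component J) F ≗ 𝟘
        vanishing J (inj₁ b<) = above J b<
        vanishing J (inj₂ b≡) with level J (≡.sym b≡)
        ... | inj₂ z = z
      reduce b ih (J ∷ E) {F} F∈ above level = compare (total 0 J ℕ.≟ b)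
        where
        shorter : total 0 J ≢ b → ∀ J′ → total 0 J′ ≡ b → J′ ∈ E ⊎ fn (component J′) F ≗ 𝟘
        shorter J≢b J′ e with level J′ e
        ... | inj₁ (here ≡.refl) = ⊥-elim (J≢b e)
        ... | inj₁ (there p) = inj₁ p
        ... | inj₂ z = inj₂ z
        compare : Dec (total 0 J ≡ b) → Hat V F
        compare (no J≢b) = reduce b ih E {F} F∈ above (shorter J≢b)
        compare (yes J≡b) = continue (subtract-leading J {F} F∈
            (top-component {F} F∈ J (λ J′ lt → above J′ (≡.subst (ℕ._< total 0 J′) J≡b lt))))
          where
          below : ∀ {m} → b ℕ.< m → total 0 J ℕ.< m
          below {m} = ≡.subst (ℕ._< m) (≡.sym J≡b)
          continue : Subtracted J F → Hat V F
          continue sub = restore sub (reduce b ih E {remainder sub} (perp sub)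
            (λ J′ lt → unchanged sub J′ (ℕ.<⇒≤ (below lt)) (λ { ≡.refl → ℕ.<-irrefl ≡.refl (below lt) }) (above J′ lt))
            λ J′ e → level′ J′ e (Vec.≡-dec Bool._≟_ J′ J) (level J′ e))
            where
            level′ : ∀ J′ → total 0 J′ ≡ b → Dec (J′ ≡ J) → J′ ∈ J ∷ E ⊎ fn (component J′) F ≗ 𝟘 →
              J′ ∈ E ⊎ fn (component J′) (remainder sub) ≗ 𝟘
            level′ J′ e (yes ≡.refl) _          = inj₂ (cleared sub)
            level′ J′ e (no ne) (inj₁ (here e′)) = ⊥-elim (ne e′)
            level′ J′ e (no ne) (inj₁ (there q)) = inj₁ q
            level′ J′ e (no ne) (inj₂ z) = inj₂ (unchanged sub J′ (ℕ.≤-reflexive (≡.trans J≡b (≡.sym e))) ne z)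

      eliminate : ∀ b {F} → Hat Perp F → (∀ J → b ℕ.≤ total 0 J → fn (component J) F ≗ 𝟘) → Hat V F
      eliminate zero    F∈ above = CV.hat-≗ (λ (a , J) → sym (above J ℕ.z≤n a)) CV.hat-𝟘
      eliminate (suc b) F∈ above = reduce b (eliminate b) (subsets n) F∈ above λ J _ → inj₁ (subsets-complete J)

      perp-minimal : Perp ⊆ V
      -- The descent starts above the sum of the full set, where there are no components to
      -- consider.
      perp-minimal {g} g∈ with eliminate (suc (total 0 (Vec.replicate n true))) {hat g} (g , g∈ , λ x → refl)
        (λ J h → ⊥-elim (ℕ.<⇒≱ h (total-bound 0 J)))
      ... | f , f∈V , e = IsSubspace.respects-≈ (IsOperatorClosed.isSubspace closed) (hat-injective {f = f} {g} e) f∈V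

  -- The average e of the powers of z = ζᵏ satisfies z e = e and e² = e, so it
  -- is 0 or 1; as z ≠ 1 it is 0.
  primitive-fixes-zero : (∀ e → e * e ≈ e → e ≈ 0# ⊎ e ≈ 1#) → ∀ r′ ζ → IsPrimitiveRoot (suc r′) ζ →
    ∀ k x → 0 ℕ.< k → k ℕ.< suc r′ → ζ ^ k * x ≈ x → x ≈ 0#
  primitive-fixes-zero connected r′ ζ (root , notEarlier) k x 0<k k<r zx≈x =
    unit-cancel (unit-suc r′) (trans (sym (geometric-fixed r x zx≈x)) (trans (*-congʳ s≈0) (zeroˡ x)))
    where
    r : ℕ
    r = suc r′
    z : Carrier
    z = ζ ^ k
    geometric : ℕ → Carrier
    geometric zero    = 0#
    geometric (suc m) = 1# + z * geometric m
    geometric-fixed : ∀ m y → z * y ≈ y → geometric m * y ≈ (m ×′ 1#) * y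
    geometric-fixed zero    y e = refl
    geometric-fixed (suc m) y e = trans (distribʳ y 1# (z * geometric m)) (trans (+-congˡ
      (trans (*-assoc z (geometric m) y) (trans (*-congˡ (geometric-fixed m y e))
        (trans (*-swap z (m ×′ 1#) y) (*-congˡ e))))) (sym (distribʳ y 1# (m ×′ 1#))))
    geometric-suc : ∀ m → geometric (suc m) ≈ geometric m + z ^ m
    geometric-suc zero    = trans (+-congˡ (zeroʳ z)) (+-comm 1# 0#)
    geometric-suc (suc m) = trans (+-congˡ (trans (*-congˡ (geometric-suc m)) (distribˡ z _ _))) (sym (+-assoc _ _ _))
    z^r : z ^ r ≈ 1#
    z^r = trans (Exp.^-assocʳ ζ k r) (trans (reflexive (≡.cong (ζ ^_) (ℕ.*-comm k r)))
      (trans (sym (Exp.^-assocʳ ζ r k)) (trans (Exp.^-congˡ k root) (one-power k))))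
      where
      one-power : ∀ k → 1# ^ k ≈ 1#
      one-power zero    = refl
      one-power (suc k) = trans (*-identityˡ _) (one-power k)
    s e r⁻¹ : Carrier
    s = geometric r
    r⁻¹ = proj₁ (unit-suc r′)
    e = r⁻¹ * s
    zs≈s : z * s ≈ s
    zs≈s = cancelʳ 1# s (trans (+-comm (z * s) 1#) (trans (geometric-suc r) (+-congˡ z^r)))
    ze≈e : z * e ≈ e
    ze≈e = trans (*-swap z r⁻¹ s) (*-congˡ zs≈s)
    e-idempotent : e * e ≈ e
    e-idempotent = trans (*-assoc r⁻¹ s e) (trans (*-congˡ (geometric-fixed r e ze≈e))
      (trans (sym (*-assoc _ _ _)) (trans (*-congʳ (proj₂ (unit-suc r′))) (*-identityˡ e))))
    e≈0 : e ≈ 0#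
    e≈0 with connected e e-idempotent
    ... | inj₁ e≈0 = e≈0
    ... | inj₂ e≈1 = ⊥-elim (notEarlier k 0<k k<r
        (trans (sym (*-identityʳ z)) (trans (*-congˡ (sym e≈1)) (trans ze≈e e≈1))))
    s≈0 : s ≈ 0#
    s≈0 = trans (sym (*-identityˡ s)) (trans (*-congʳ (sym (trans (*-comm _ _) (proj₂ (unit-suc r′)))))
      (trans (*-assoc _ r⁻¹ s) (trans (*-congˡ e≈0) (zeroʳ _))))

  -- Collects what is asked of the scalars: positive integers are invertible, 1 differs from 0, and
  -- there are no other idempotents.
  operator-theorem : (∀ e → e * e ≈ e → e ≈ 0# ⊎ e ≈ 1#) → ∀ {v} n r′ ζ → IsPrimitiveRoot (suc r′) ζ →
    IsOperatorClosed n (suc r′) (SI n (suc r′) ζ ^⊥) ×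
    (∀ (V : Pred (Ω n) v) → IsOperatorClosed n (suc r′) V → SI n (suc r′) ζ ^⊥ ⊆ V)
  operator-theorem connected n r′ ζ prim = perp-closed , λ V closed → Minimal.perp-minimal closed
    where open OperatorTheorem {n} r′ ζ (proj₁ prim) (primitive-fixes-zero connected r′ ζ prim)


-- The complex numbers: idempotents and inverses of positive integers.

module IdempotentIdentities {c ℓ} (R : CommutativeRing c ℓ) where
  open CommutativeRing R
  open RingProperties ring using (-‿distribʳ-*; -1*x≈-x)
  private module G = AbelianGroupProperties +-abelianGroup

  idempotent-product : ∀ a → a * a ≈ a → a * (a + - 1#) ≈ 0#
  idempotent-product a e = trans (distribˡ a a (- 1#)) (trans (+-cong e
    (trans (sym (-‿distribʳ-* a 1#)) (-‿cong (*-identityʳ a)))) (-‿inverseʳ a))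

  idempotent-product′ : ∀ a → a * a ≈ a → (a + - 1#) * a ≈ 0#
  idempotent-product′ a e = trans (*-comm _ a) (idempotent-product a e)

  -- The real and imaginary parts of (a + bi)² = a + bi.
  module _ (a b : Carrier) (re : a * a + - 1# * (b * b) ≈ a) (im : a * b + b * a ≈ b) where
    square : a * a ≈ a + b * b
    square = trans (sym (+-identityʳ _)) (trans (+-congˡ (sym (-‿inverseˡ (b * b))))
      (trans (sym (+-assoc _ _ _)) (+-congʳ (trans (+-congˡ (sym (-1*x≈-x _))) re))))

    -- From 2ab = b follows 4a²b = b, while a² = a + b² gives 4a²b = 2b + 4b³; hence b + 4b³ = 0.
    -- The product form is useful because over the reals its first factor is bounded below by 1.
    imaginary-product : (1# + (b + b) * (b + b)) * b ≈ 0#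
    -- Adding b to both sides avoids subtraction, so that the semiring solver applies.
    imaginary-product = G.∙-cancelˡ b _ _ (begin
      b + (1# + (b + b) * (b + b)) * b ≈⟨ regroup b 1# ⟩
      1# * b + b + (b + b) * (b + b) * b ≈⟨ +-congʳ (+-congʳ (*-identityˡ b)) ⟩
      b + b + (b + b) * (b + b) * b ≈⟨ +-congʳ (+-cong im im) ⟨
      a * b + b * a + (a * b + b * a) + (b + b) * (b + b) * b ≈⟨ collect a b ⟩
      (a + b * b + (a + b * b) + (a + b * b + (a + b * b))) * b ≈⟨ *-congʳ
          (+-cong (+-cong square square) (+-cong square square)) ⟨
      (a * a + a * a + (a * a + a * a)) * b ≈⟨ factor a b ⟩
      a * (a * b + b * a) + (a * b + b * a) * a ≈⟨ +-cong (*-congˡ im) (*-congʳ im) ⟩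
      a * b + b * a ≈⟨ im ⟩
      b ≈⟨ +-identityʳ b ⟨
      b + 0# ∎)
      where
      open import Relation.Binary.Reasoning.Setoid setoid
      open NaturalCoefficients commutativeSemiring
      regroup : ∀ b u → b + (u + (b + b) * (b + b)) * b ≈ u * b + b + (b + b) * (b + b) * b
      regroup = solve 2 (λ b u → b :+ (u :+ (b :+ b) :* (b :+ b)) :* b := u :* b :+ b :+ (b :+ b) :* (b :+ b) :* b) refl
      collect : ∀ a b → a * b + b * a + (a * b + b * a) + (b + b) * (b + b) * b ≈
        (a + b * b + (a + b * b) + (a + b * b + (a + b * b))) * b
      collect = solve 2 (λ a b → a :* b :+ b :* a :+ (a :* b :+ b :* a) :+ (b :+ b) :* (b :+ b) :* b :=
        (a :+ b :* b :+ (a :+ b :* b) :+ (a :+ b :* b :+ (a :+ b :* b))) :* b) refl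
      factor : ∀ a b → (a * a + a * a + (a * a + a * a)) * b ≈ a * (a * b + b * a) + (a * b + b * a) * a
      factor = solve 2 (λ a b → (a :* a :+ a :* a :+ (a :* a :+ a :* a)) :* b :=
        a :* (a :* b :+ b :* a) :+ (a :* b :+ b :* a) :* a) refl

    real-part : b ≈ 0# → a * a ≈ a
    real-part z = trans square (trans (+-congˡ (trans (*-congʳ z) (zeroˡ b))) (+-identityʳ a))

module ComplexNumbers where
  open import Data.Rational.Base using (∣_∣; positive; 1/_)
  open Defs using (ℝ; seq; cauchy; _≃_; _+ℝ_; _*ℝ_; -ℝ_; fromℚ; ℝ-ring)
  open IdempotentIdentities ℝ-ring

  ¼ : ℚ
  ¼ = ½ ℚ.* ½

  0<¼ : 0ℚ ℚ.< ¼
  0<¼ = ℚ.positive⁻¹ ¼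

  p≤∣p∣ : ∀ p → p ℚ.≤ ∣ p ∣
  p≤∣p∣ p with ℚ.≤-total p 0ℚ
  ... | inj₁ p≤0 = ℚ.≤-trans p≤0 (ℚ.0≤∣p∣ p)
  ... | inj₂ 0≤p = ℚ.≤-reflexive (≡.sym (ℚ.0≤p⇒∣p∣≡p 0≤p))

  -‿0 : ∀ p → p ℚ.- 0ℚ ≡ p
  -‿0 p = ℚ.+-identityʳ p

  -- The rational bound c below the absolute value of x rescales the tolerance: once xy is smaller
  -- than c ε, y is smaller than ε. This replaces the construction of a reciprocal.
  cancel-apart : ∀ x y c → 0ℚ ℚ.< c → (∃ λ N → ∀ n → N ℕ.≤ n → c ℚ.≤ ∣ seq x n ∣) →
    x *ℝ y ≃ fromℚ 0ℚ → y ≃ fromℚ 0ℚ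
  cancel-apart x y c 0<c (M , apart) xy≃0 ε 0<ε with xy≃0 (c ℚ.* ε) 0<cε
    where
    0<cε : 0ℚ ℚ.< c ℚ.* ε
    0<cε = ℚ.positive⁻¹ _ {{ℚ.pos*pos⇒pos c {{positive 0<c}} ε {{positive 0<ε}}}}
  ... | N , small = M ℕ.⊔ N , λ n le → ≡.subst (λ p → ∣ p ∣ ℚ.< ε) (≡.sym (-‿0 (seq y n)))
    (ℚ.*-cancelˡ-<-nonNeg c {{ℚ.pos⇒nonNeg c {{positive 0<c}}}} (ℚ.≤-<-trans
      (ℚ.*-monoʳ-≤-nonNeg ∣ seq y n ∣ {{ℚ.∣-∣-nonNeg (seq y n)}} (apart n (ℕ.≤-trans (ℕ.m≤m⊔n M N) le)))
      (≡.subst (ℚ._< c ℚ.* ε) (≡.trans (≡.cong ∣_∣ (-‿0 _)) (ℚ.∣p*q∣≡∣p∣*∣q∣ (seq x n) (seq y n)))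
        (small n (ℕ.≤-trans (ℕ.m≤n⊔m M N) le)))))

  difference-≃ : ∀ x y → x +ℝ -ℝ y ≃ fromℚ 0ℚ → x ≃ y
  difference-≃ x y d ε 0<ε with d ε 0<ε
  ... | N , h = N , λ n le → ≡.subst (λ p → ∣ p ∣ ℚ.< ε) (-‿0 _) (h n le)

  one : ℝ
  one = fromℚ 1ℚ

  -- A single rational approximation within 1/4 tells which factor of a (a - 1) = 0 is bounded away
  -- from zero: a value up to 1/2 keeps later terms at most 3/4, a value of 1/2 or more keeps them
  -- at least 1/4. The other factor then vanishes.
  real-idempotent : ∀ a → a *ℝ a ≃ a → a ≃ fromℚ 0ℚ ⊎ a ≃ one
  real-idempotent a aa≃a with cauchy a ¼ 0<¼
  ... | N , close with ℚ.≤-total (seq a N) ½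
  ...   | inj₁ q≤½ = inj₁ (cancel-apart (a +ℝ -ℝ one) a ¼ 0<¼ (N , apart) (idempotent-product′ a aa≃a))
    where
    restore : ∀ p q → q ℚ.+ (p ℚ.- q) ≡ p
    restore = solve 2 (λ p q → q :+ (p :- q) := p) ≡.refl
      where open +-*-Solver
    negate : ∀ p → 1ℚ ℚ.- p ≡ ℚ.- (p ℚ.- 1ℚ)
    negate = solve 1 (λ p → con 1ℚ :- p := :- (p :- con 1ℚ)) ≡.refl
      where open +-*-Solver
    apart : ∀ n → N ℕ.≤ n → ¼ ℚ.≤ ∣ seq a n ℚ.- 1ℚ ∣
    apart n le = ≡.subst (¼ ℚ.≤_) (≡.trans (≡.cong ∣_∣ (negate (seq a n))) (ℚ.∣-p∣≡∣p∣ (seq a n ℚ.- 1ℚ)))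
      (ℚ.≤-trans (ℚ.+-monoʳ-≤ 1ℚ (ℚ.neg-antimono-≤ upper)) (p≤∣p∣ (1ℚ ℚ.- seq a n)))
      where
      upper : seq a n ℚ.≤ ½ ℚ.+ ¼
      upper = ≡.subst (ℚ._≤ ½ ℚ.+ ¼) (restore (seq a n) (seq a N))
        (ℚ.+-mono-≤ q≤½ (ℚ.≤-trans (p≤∣p∣ _) (ℚ.<⇒≤ (close n N le ℕ.≤-refl))))
  ...   | inj₂ ½≤q = inj₂ (difference-≃ a one (cancel-apart a (a +ℝ -ℝ one) ¼ 0<¼ (N , apart)
      (idempotent-product a aa≃a)))
    where
    restore : ∀ p q → q ℚ.- (q ℚ.- p) ≡ p
    restore = solve 2 (λ p q → q :- (q :- p) := p) ≡.refl
      where open +-*-Solver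
    apart : ∀ n → N ℕ.≤ n → ¼ ℚ.≤ ∣ seq a n ∣
    apart n le = ℚ.≤-trans (≡.subst (¼ ℚ.≤_) (restore (seq a n) (seq a N))
      (ℚ.+-mono-≤ ½≤q (ℚ.neg-antimono-≤ (ℚ.≤-trans (p≤∣p∣ _) (ℚ.<⇒≤ (close N n ℕ.≤-refl le)))))) (p≤∣p∣ (seq a n))

  0≤p*p : ∀ p → 0ℚ ℚ.≤ p ℚ.* p
  0≤p*p p = ≡.subst (0ℚ ℚ.≤_) abs-square (ℚ.nonNegative⁻¹ _
    {{ℚ.nonNeg*nonNeg⇒nonNeg (∣ p ∣) {{ℚ.∣-∣-nonNeg p}} (∣ p ∣) {{ℚ.∣-∣-nonNeg p}}}})
    where
    abs-square : ∣ p ∣ ℚ.* ∣ p ∣ ≡ p ℚ.* p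
    abs-square with ℚ.∣p∣≡p∨∣p∣≡-p p
    ... | inj₁ e = ≡.cong (λ q → q ℚ.* q) e
    ... | inj₂ e = ≡.trans (≡.cong (λ q → q ℚ.* q) e) (solve 1 (λ p → (:- p) :* (:- p) := p :* p) ≡.refl p)
      where open +-*-Solver

  pointwise : ∀ {x y} → (∀ n → seq x n ≡ seq y n) → x ≃ y
  pointwise {x} {y} h ε ε>0 = 0 , λ n _ → ≡.subst (ℚ._< ε)
    (≡.sym (≡.cong ∣_∣ (≡.trans (≡.cong (ℚ._- seq y n) (h n)) (ℚ.+-inverseʳ (seq y n))))) ε>0

  complex-idempotent : ∀ (e : Defs.ℂ) → let open CommutativeRing Defs.ℂ-ring in
    e * e ≈ e → e ≈ 0# ⊎ e ≈ 1#
  complex-idempotent (a , b) (re , im) = conclude (real-idempotent a (real-part a b re im b≃0))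
    where
    square+1 : ℝ
    square+1 = fromℚ 1ℚ +ℝ (b +ℝ b) *ℝ (b +ℝ b)
    b≃0 : b ≃ fromℚ 0ℚ
    -- The constant 1 is a lower bound for 1 + (2b)², as squares are nonnegative.
    b≃0 = cancel-apart square+1 b 1ℚ (ℚ.positive⁻¹ 1ℚ)
      (0 , λ n _ → ℚ.≤-trans (≡.subst (ℚ._≤ seq square+1 n) (ℚ.+-identityʳ 1ℚ)
          (ℚ.+-monoʳ-≤ 1ℚ (0≤p*p (seq (b +ℝ b) n))))
        (p≤∣p∣ (seq square+1 n)))
      (imaginary-product a b re im)
    conclude : a ≃ fromℚ 0ℚ ⊎ a ≃ one →
      (a ≃ fromℚ 0ℚ × b ≃ fromℚ 0ℚ) ⊎ (a ≃ one × b ≃ fromℚ 0ℚ)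
    conclude (inj₁ z) = inj₁ (z , b≃0)
    conclude (inj₂ u) = inj₂ (u , b≃0)

  private module ℂR = CommutativeRing Defs.ℂ-ring
  open RawSemiring (Semiring.rawSemiring ℂR.semiring) using () renaming (_×_ to _×ℂ_)

  complex-nontrivial : ¬ ℂR.1# ℂR.≈ ℂR.0#
  complex-nontrivial (re , _) with re 1ℚ (ℚ.positive⁻¹ 1ℚ)
  ... | N , h = ℚ.<-irrefl ≡.refl (h N ℕ.≤-refl)

  natural : ℕ → ℚ
  natural zero    = 0ℚ
  natural (suc m) = 1ℚ ℚ.+ natural m

  natural-nonNeg : ∀ m → ℚ.NonNegative (natural m)
  natural-nonNeg zero    = _
  natural-nonNeg (suc m) = ℚ.nonNeg+nonNeg⇒nonNeg 1ℚ (natural m) {{natural-nonNeg m}}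

  natural-nonZero : ∀ m → ℚ.NonZero (natural (suc m))
  natural-nonZero m = ℚ.pos⇒nonZero (natural (suc m)) {{ℚ.pos+nonNeg⇒pos 1ℚ (natural m) {{natural-nonNeg m}}}}

  natural-real : ∀ m n → seq (proj₁ (m ×ℂ ℂR.1#)) n ≡ natural m
  natural-real zero    n = ≡.refl
  natural-real (suc m) n = ≡.cong (1ℚ ℚ.+_) (natural-real m n)

  natural-imaginary : ∀ m n → seq (proj₂ (m ×ℂ ℂR.1#)) n ≡ 0ℚ
  natural-imaginary zero    n = ≡.refl
  natural-imaginary (suc m) n = ≡.trans (ℚ.+-identityˡ _) (natural-imaginary m n)

  complex-inverse : ∀ m → ∃ λ k → (k ℂR.* (suc m ×ℂ ℂR.1#)) ℂR.≈ ℂR.1#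
  complex-inverse m = (fromℚ q⁻¹ , fromℚ 0ℚ) , pointwise {proj₁ product} {fromℚ 1ℚ} re , pointwise {proj₂ product}
      {fromℚ 0ℚ} im
    where
    q q⁻¹ : ℚ
    q = natural (suc m)
    q⁻¹ = (1/ q) {{natural-nonZero m}}
    k product : Defs.ℂ
    k = suc m ×ℂ ℂR.1#
    product = (fromℚ q⁻¹ , fromℚ 0ℚ) ℂR.* k
    re : ∀ n → q⁻¹ ℚ.* seq (proj₁ k) n ℚ.+ (ℚ.- 1ℚ) ℚ.* (0ℚ ℚ.* seq (proj₂ k) n) ≡ 1ℚ
    re n = ≡.trans (≡.cong₂ (λ x y → q⁻¹ ℚ.* x ℚ.+ (ℚ.- 1ℚ) ℚ.* y) (natural-real (suc m) n)
        (ℚ.*-zeroˡ (seq (proj₂ k) n)))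
      (≡.trans (ℚ.+-identityʳ (q⁻¹ ℚ.* q)) (ℚ.*-inverseˡ q {{natural-nonZero m}}))
    im : ∀ n → q⁻¹ ℚ.* seq (proj₂ k) n ℚ.+ 0ℚ ℚ.* seq (proj₁ k) n ≡ 0ℚ
    im n = ≡.trans (≡.cong₂ ℚ._+_ (≡.trans (≡.cong (q⁻¹ ℚ.*_) (natural-imaginary (suc m) n)) (ℚ.*-zeroʳ q⁻¹))
      (ℚ.*-zeroˡ (seq (proj₁ k) n))) (ℚ.+-identityʳ 0ℚ)

open import Defs

theorem3p20 : ∀ (ℓ : Level) (n r : ℕ) .{{_ : NonZero n}} .{{_ : NonZero r}} (ζ : ℂ) →
    IsPrimitiveRoot r ζ →
    IsOperatorClosed n r (SI n r ζ ^⊥) ×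
    (∀ (V : Pred (Ω n) ℓ) → IsOperatorClosed n r V → SI n r ζ ^⊥ ⊆ V)
theorem3p20 ℓ n zero    ζ prim = ⊥-elim (ℕ.≢-nonZero⁻¹ 0 ≡.refl)
theorem3p20 ℓ n (suc r′) ζ prim =
  operator-theorem complex-idempotent n r′ ζ prim
  where
  open ComplexNumbers
  open Theory ℂ-ring complex-inverse complex-nontrivial
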